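{- The decision problem STOCHASTIC-BLIND-POLICY is SQRT-SUM-hard; that is, there is a polynomial-time many-one reduction from SQRT-SUM to STOCHASTIC-BLIND-POLICY.
   Context: SQRT-SUM is the following decision problem: given nonnegative integers $c_1,\ldots,c_n$ and an integer $d$ (encoded in binary), is $\sum_{i=1}^n\sqrt{c_i}\le d$? An instance of STOCHASTIC-BLIND-POLICY consists of a discounted infinite-horizon Markov decision process (MDP) together with a target cost $r$. The MDP is given by: $n$ states, $k$ actions, a discount factor $\gamma$ with $0\le\gamma<1$, a cost matrix $\mathbf{C}=(c_{sa})$ of size $n\times k$ (state-action costs), a starting distribution $\boldsymbol{\mu}=(\mu_s)$ with $\mu_s\ge 0$ and $\sum_{s=1}^n\mu_s=1$, and transition probabilities $p(\bar s\mid s,a)\ge 0$ with $\sum_{\bar s}p(\bar s\mid s,a)=1$ for all states $s$ and actions $a$. (The number of states and the costs of an MDP instance are unrelated to the symbols $n$, $c_i$ in the definition of SQRT-SUM.) All numerical data, including $r$, are rational numbers encoded in binary. A stochastic blind controller is a vector $\boldsymbol{\pi}=(\pi_a)$ in the standard simplex $\Delta=\{\boldsymbol{\pi}\in\mathbb{R}^k:\boldsymbol{\pi}\ge 0,\ \sum_{a=1}^k\pi_a=1\}$; the same action distribution is used at every time step, independently of the state and history. The occupancy vector $\mathbf{x}=(x_s)\in\mathbb{R}^n$, $\mathbf{x}\ge 0$, associated with $\boldsymbol{\pi}$ is the unique solution of the Bellman occupancy constraints $$x_{\bar s}=(1-\gamma)\mu_{\bar s}+\gamma\sum_a\pi_a\sum_s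 p(\bar s\mid s,a)\,x_s\quad\text{for all states }\bar s.$$ The cost of $\boldsymbol{\pi}$ is $J(\boldsymbol{\pi})=\mathbf{x}^\top\mathbf{C}\boldsymbol{\pi}=\sum_{s,a}x_s\pi_a c_{sa}$. The question is: does there exist $\boldsymbol{\pi}\in\Delta$ with $J(\boldsymbol{\pi})\le r$? -}

module Defs where

open import Algebra.Bundles.Raw using (RawMonoid)
import Algebra.Definitions.RawMonoid as RawMonoidSum
open import Data.Fin.Base using (Fin)
open import Data.Integer.Base using (ℤ; +_; -[1+_])
open import Data.List.Base using (List; []; _∷_; _++_; concat; length; map; tabulate)
open import Data.Maybe.Base using (Maybe; just; nothing)
open import Data.Nat.Base as ℕ using (ℕ; zero; suc)
import Data.Nat.Properties as ℕ
open import Data.Product.Base using (∃; ∃-syntax; _×_; _,_)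
open import Data.Rational.Base as ℚ using (ℚ; 0ℚ; 1ℚ; ½)
import Data.Rational.Properties as ℚ
open import Data.Rational.Solver using (module +-*-Solver)
open import Data.Rational.Unnormalised.Base as ℚᵘ using (ℚᵘ; 0ℚᵘ; 1ℚᵘ; ↥_; ↧ₙ_)
open import Data.Sum.Base using (_⊎_; inj₁; inj₂)
open import Data.Vec.Base as Vec using (Vec)
open import Data.Vec.Functional using (Vector)
open import Function.Base using (_∘_)
open import Function.Bundles using (_↔_; _⇔_)
open import Level using (0ℓ)
open import Relation.Binary.PropositionalEquality

-- The real numbers are Cauchy sequences of rationals, with _≃ℝ_ as equality.

IsCauchy : (ℕ → ℚ) → Set
IsCauchy x = ∀ ε → 0ℚ ℚ.< ε →
  ∃[ N ] ∀ m n → N ℕ.≤ m → N ℕ.≤ n → ℚ.∣ x m ℚ.- x n ∣ ℚ.< ε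

record ℝ : Set where
  constructor mkℝ
  field
    seq    : ℕ → ℚ
    cauchy : IsCauchy seq

open ℝ public

infix 4 _≃ℝ_ _≤ℝ_

_≃ℝ_ : ℝ → ℝ → Set
x ≃ℝ y = ∀ ε → 0ℚ ℚ.< ε →
  ∃[ N ] ∀ n → N ℕ.≤ n → ℚ.∣ seq x n ℚ.- seq y n ∣ ℚ.< ε

_≤ℝ_ : ℝ → ℝ → Set
x ≤ℝ y = ∀ ε → 0ℚ ℚ.< ε →
  ∃[ N ] ∀ n → N ℕ.≤ n → seq x n ℚ.< seq y n ℚ.+ ε

private abstract
  0<½ε : ∀ {ε} → 0ℚ ℚ.< ε → 0ℚ ℚ.< ½ ℚ.* ε
  0<½ε {ε} 0<ε = subst (ℚ._< ½ ℚ.* ε) (ℚ.*-zeroʳ ½) (ℚ.*-monoʳ-<-pos ½ 0<ε)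

  ½ε+½ε : ∀ ε → ½ ℚ.* ε ℚ.+ ½ ℚ.* ε ≡ ε
  ½ε+½ε ε = trans (sym (ℚ.*-distribʳ-+ ε ½ ½)) (ℚ.*-identityˡ ε)

  const-cauchy : ∀ q → IsCauchy (λ _ → q)
  const-cauchy q ε 0<ε = 0 , λ _ _ _ _ →
    subst (ℚ._< ε) (sym (cong ℚ.∣_∣ (ℚ.+-inverseʳ q))) 0<ε

  +-cauchy : ∀ x y → IsCauchy x → IsCauchy y → IsCauchy (λ n → x n ℚ.+ y n)
  +-cauchy x y cx cy ε 0<ε with cx (½ ℚ.* ε) (0<½ε 0<ε) | cy (½ ℚ.* ε) (0<½ε 0<ε)
  ... | M , hx | N , hy = M ℕ.⊔ N , λ m n m≥ n≥ → begin-strict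
    ℚ.∣ (x m ℚ.+ y m) ℚ.- (x n ℚ.+ y n) ∣
      ≡⟨ cong ℚ.∣_∣ (rearrange (x m) (y m) (x n) (y n)) ⟩
    ℚ.∣ (x m ℚ.- x n) ℚ.+ (y m ℚ.- y n) ∣
      ≤⟨ ℚ.∣p+q∣≤∣p∣+∣q∣ (x m ℚ.- x n) (y m ℚ.- y n) ⟩
    ℚ.∣ x m ℚ.- x n ∣ ℚ.+ ℚ.∣ y m ℚ.- y n ∣
      <⟨ ℚ.+-mono-< (hx m n (ℕ.m⊔n≤o⇒m≤o M N m≥) (ℕ.m⊔n≤o⇒m≤o M N n≥))
                    (hy m n (ℕ.m⊔n≤o⇒n≤o M N m≥) (ℕ.m⊔n≤o⇒n≤o M N n≥)) ⟩
    ½ ℚ.* ε ℚ.+ ½ ℚ.* ε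
      ≡⟨ ½ε+½ε ε ⟩
    ε ∎
    where
    open ℚ.≤-Reasoning
    rearrange : ∀ a b c d → (a ℚ.+ b) ℚ.- (c ℚ.+ d) ≡ (a ℚ.- c) ℚ.+ (b ℚ.- d)
    rearrange = solve 4 (λ a b c d → (a :+ b) :- (c :+ d) := (a :- c) :+ (b :- d)) refl
      where open +-*-Solver

  eventually-bounded : ∀ x → IsCauchy x →
    ∃[ B ] ∃[ N ] ∀ n → N ℕ.≤ n → ℚ.∣ x n ∣ ℚ.≤ B
  eventually-bounded x cx with cx 1ℚ (ℚ.positive⁻¹ 1ℚ)
  ... | N , h = 1ℚ ℚ.+ ℚ.∣ x N ∣ , N , λ n n≥ → begin
    ℚ.∣ x n ∣                            ≡⟨ cong ℚ.∣_∣ (split (x n) (x N)) ⟩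
    ℚ.∣ (x n ℚ.- x N) ℚ.+ x N ∣          ≤⟨ ℚ.∣p+q∣≤∣p∣+∣q∣ (x n ℚ.- x N) (x N) ⟩
    ℚ.∣ x n ℚ.- x N ∣ ℚ.+ ℚ.∣ x N ∣      ≤⟨ ℚ.+-monoˡ-≤ ℚ.∣ x N ∣ (ℚ.<⇒≤ (h n N n≥ ℕ.≤-refl)) ⟩
    1ℚ ℚ.+ ℚ.∣ x N ∣                     ∎
    where
    open ℚ.≤-Reasoning
    split : ∀ a b → a ≡ (a ℚ.- b) ℚ.+ b
    split = solve 2 (λ a b → a := (a :- b) :+ b) refl
      where open +-*-Solver

  -- Multiplying by a factor bounded by B shrinks a small enough quantity below ε.
  scale : ∀ B ε → 0ℚ ℚ.< ε →
    ∃[ δ ] 0ℚ ℚ.< δ × (∀ p q → ℚ.∣ p ∣ ℚ.≤ B → ℚ.∣ q ∣ ℚ.< δ → ℚ.∣ p ℚ.* q ∣ ℚ.< ε)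
  scale B ε 0<ε = δ , 0<δ , bound
    where
    B⁺ : ℚ
    B⁺ = 1ℚ ℚ.+ ℚ.∣ B ∣
    0<B⁺ : 0ℚ ℚ.< B⁺
    0<B⁺ = ℚ.+-mono-<-≤ (ℚ.positive⁻¹ 1ℚ) (ℚ.0≤∣p∣ B)
    instance
      B⁺-pos : ℚ.Positive B⁺
      B⁺-pos = ℚ.positive 0<B⁺
      B⁺-nonZero : ℚ.NonZero B⁺
      B⁺-nonZero = ℚ.pos⇒nonZero B⁺
      1/B⁺-pos : ℚ.Positive (ℚ.1/ B⁺)
      1/B⁺-pos = ℚ.1/pos⇒pos B⁺
    δ : ℚ
    δ = ℚ.1/ B⁺ ℚ.* ε
    0<δ : 0ℚ ℚ.< δ
    0<δ = subst (ℚ._< δ) (ℚ.*-zeroʳ (ℚ.1/ B⁺)) (ℚ.*-monoʳ-<-pos (ℚ.1/ B⁺) 0<ε)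
    B⁺δ≡ε : B⁺ ℚ.* δ ≡ ε
    B⁺δ≡ε = trans (sym (ℚ.*-assoc B⁺ (ℚ.1/ B⁺) ε))
              (trans (cong (ℚ._* ε) (ℚ.*-inverseʳ B⁺)) (ℚ.*-identityˡ ε))
    B≤B⁺ : ∀ p → ℚ.∣ p ∣ ℚ.≤ B → ℚ.∣ p ∣ ℚ.≤ B⁺
    B≤B⁺ p p≤B = begin
      ℚ.∣ p ∣          ≤⟨ p≤B ⟩
      B                ≡⟨ ℚ.0≤p⇒∣p∣≡p (ℚ.≤-trans (ℚ.0≤∣p∣ p) p≤B) ⟨
      ℚ.∣ B ∣          ≡⟨ ℚ.+-identityˡ ℚ.∣ B ∣ ⟨
      0ℚ ℚ.+ ℚ.∣ B ∣   ≤⟨ ℚ.+-monoˡ-≤ ℚ.∣ B ∣ (ℚ.<⇒≤ (ℚ.positive⁻¹ 1ℚ)) ⟩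
      B⁺               ∎
      where open ℚ.≤-Reasoning
    bound : ∀ p q → ℚ.∣ p ∣ ℚ.≤ B → ℚ.∣ q ∣ ℚ.< δ → ℚ.∣ p ℚ.* q ∣ ℚ.< ε
    bound p q p≤B q<δ = begin-strict
      ℚ.∣ p ℚ.* q ∣        ≡⟨ ℚ.∣p*q∣≡∣p∣*∣q∣ p q ⟩
      ℚ.∣ p ∣ ℚ.* ℚ.∣ q ∣  ≤⟨ ℚ.*-monoʳ-≤-nonNeg ℚ.∣ q ∣ {{ℚ.∣-∣-nonNeg q}} (B≤B⁺ p p≤B) ⟩
      B⁺ ℚ.* ℚ.∣ q ∣       <⟨ ℚ.*-monoʳ-<-pos B⁺ q<δ ⟩
      B⁺ ℚ.* δ             ≡⟨ B⁺δ≡ε ⟩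
      ε                    ∎
      where open ℚ.≤-Reasoning

  *-cauchy : ∀ x y → IsCauchy x → IsCauchy y → IsCauchy (λ n → x n ℚ.* y n)
  *-cauchy x y cx cy ε 0<ε =
    let Bx , Kx , x≤ = eventually-bounded x cx
        By , Ky , y≤ = eventually-bounded y cy
        δy , 0<δy , sy = scale Bx (½ ℚ.* ε) (0<½ε 0<ε)
        δx , 0<δx , sx = scale By (½ ℚ.* ε) (0<½ε 0<ε)
        Mx , hx = cx δx 0<δx
        My , hy = cy δy 0<δy
    in (Kx ℕ.⊔ Ky) ℕ.⊔ (Mx ℕ.⊔ My), λ m n m≥ n≥ →
    let K≤m = ℕ.m⊔n≤o⇒m≤o (Kx ℕ.⊔ Ky) (Mx ℕ.⊔ My) m≥
        K≤n = ℕ.m⊔n≤o⇒m≤o (Kx ℕ.⊔ Ky) (Mx ℕ.⊔ My) n≥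
        M≤m = ℕ.m⊔n≤o⇒n≤o (Kx ℕ.⊔ Ky) (Mx ℕ.⊔ My) m≥
        M≤n = ℕ.m⊔n≤o⇒n≤o (Kx ℕ.⊔ Ky) (Mx ℕ.⊔ My) n≥
    in begin-strict
    ℚ.∣ (x m ℚ.* y m) ℚ.- (x n ℚ.* y n) ∣
      ≡⟨ cong ℚ.∣_∣ (rearrange (x m) (y m) (x n) (y n)) ⟩
    ℚ.∣ x m ℚ.* (y m ℚ.- y n) ℚ.+ y n ℚ.* (x m ℚ.- x n) ∣
      ≤⟨ ℚ.∣p+q∣≤∣p∣+∣q∣ (x m ℚ.* (y m ℚ.- y n)) (y n ℚ.* (x m ℚ.- x n)) ⟩
    ℚ.∣ x m ℚ.* (y m ℚ.- y n) ∣ ℚ.+ ℚ.∣ y n ℚ.* (x m ℚ.- x n) ∣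
      <⟨ ℚ.+-mono-<
           (sy (x m) (y m ℚ.- y n) (x≤ m (ℕ.m⊔n≤o⇒m≤o Kx Ky K≤m))
             (hy m n (ℕ.m⊔n≤o⇒n≤o Mx My M≤m) (ℕ.m⊔n≤o⇒n≤o Mx My M≤n)))
           (sx (y n) (x m ℚ.- x n) (y≤ n (ℕ.m⊔n≤o⇒n≤o Kx Ky K≤n))
             (hx m n (ℕ.m⊔n≤o⇒m≤o Mx My M≤m) (ℕ.m⊔n≤o⇒m≤o Mx My M≤n))) ⟩
    ½ ℚ.* ε ℚ.+ ½ ℚ.* ε
      ≡⟨ ½ε+½ε ε ⟩
    ε ∎
    where
    open ℚ.≤-Reasoning
    rearrange : ∀ a b c d →
      (a ℚ.* b) ℚ.- (c ℚ.* d) ≡ a ℚ.* (b ℚ.- d) ℚ.+ d ℚ.* (a ℚ.- c)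
    rearrange = solve 4 (λ a b c d →
      (a :* b) :- (c :* d) := a :* (b :- d) :+ d :* (a :- c)) refl
      where open +-*-Solver

infixl 6 _+ℝ_
infixl 7 _*ℝ_

_+ℝ_ : ℝ → ℝ → ℝ
x +ℝ y = mkℝ (λ n → seq x n ℚ.+ seq y n) (+-cauchy (seq x) (seq y) (cauchy x) (cauchy y))

_*ℝ_ : ℝ → ℝ → ℝ
x *ℝ y = mkℝ (λ n → seq x n ℚ.* seq y n) (*-cauchy (seq x) (seq y) (cauchy x) (cauchy y))

fromℚᵘ : ℚᵘ → ℝ
fromℚᵘ q = mkℝ (λ _ → ℚ.fromℚᵘ q) (const-cauchy (ℚ.fromℚᵘ q))

fromℤ : ℤ → ℝ
fromℤ i = fromℚᵘ (i ℚᵘ./ 1)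

0ℝ 1ℝ : ℝ
0ℝ = fromℚᵘ 0ℚᵘ
1ℝ = fromℚᵘ 1ℚᵘ

+ℝ-rawMonoid : RawMonoid 0ℓ 0ℓ
+ℝ-rawMonoid = record { Carrier = ℝ ; _≈_ = _≃ℝ_ ; _∙_ = _+ℝ_ ; ε = 0ℝ }

open RawMonoidSum +ℝ-rawMonoid public using () renaming (sum to sumℝ)
open RawMonoidSum ℚᵘ.+-0-rawMonoid public using () renaming (sum to sumℚᵘ)

IsSqrt : ℝ → ℕ → Set
IsSqrt y c = 0ℝ ≤ℝ y × y *ℝ y ≃ℝ fromℤ (+ c)

data Symbol : Set where
  0b 1b minus sep : Symbol

Word : Set
Word = List Symbol

-- Binary expansion, least significant bit first and without leading
-- zeros (so 0 is the empty word).
increment : Word → Word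
increment (0b ∷ w) = 1b ∷ w
increment (1b ∷ w) = 0b ∷ increment w
increment w        = 1b ∷ w

bits : ℕ → Word
bits zero    = []
bits (suc n) = increment (bits n)

encodeℕ : ℕ → Word
encodeℕ n = bits n ++ sep ∷ []

encodeℤ : ℤ → Word
encodeℤ (+ n)    = encodeℕ n
encodeℤ -[1+ n ] = minus ∷ encodeℕ (suc n)

-- A rational is presented by any numerator and positive denominator, not
-- necessarily in lowest terms; hence the use of ℚᵘ.
encodeℚᵘ : ℚᵘ → Word
encodeℚᵘ q = encodeℤ (↥ q) ++ encodeℕ (↧ₙ q)

encodeVector : ∀ {a} {A : Set a} {n} → (A → Word) → Vector A n → Word
encodeVector enc v = concat (tabulate (enc ∘ v))

Finite : Set → Set
Finite X = ∃[ n ] (X ↔ Fin n)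

data Move : Set where
  left stay right : Move

-- A two-way infinite tape: the cells to the left of the head (nearest
-- first), the scanned cell, and the cells to its right (nearest first).
-- All cells beyond the two lists are blank.
record Tape (Cell : Set) : Set where
  constructor mkTape
  field
    before : List Cell
    here   : Cell
    after  : List Cell

open Tape public

record TuringMachine : Set₁ where
  field
    tapes         : ℕ
    inTape        : Fin tapes
    outTape       : Fin tapes
    Extra         : Set            -- work symbols besides Symbol and blank
    Extra-finite  : Finite Extra
    State         : Set
    State-finite  : Finite State
    initial       : State

  Cell : Set
  Cell = Maybe (Symbol ⊎ Extra)

  field
    -- The machine halts where δ is undefined.
    δ : State → Vec Cell tapes → Maybe (State × Vec (Cell × Move) tapes)

module Semantics (M : TuringMachine) where
  open TuringMachine M

  blank : Cell
  blank = nothing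

  moveHead : Move → Tape Cell → Tape Cell
  moveHead stay  t                       = t
  moveHead left  (mkTape []       h r)   = mkTape [] blank (h ∷ r)
  moveHead left  (mkTape (c ∷ l)  h r)   = mkTape l c (h ∷ r)
  moveHead right (mkTape l h [])         = mkTape (h ∷ l) blank []
  moveHead right (mkTape l h (c ∷ r))    = mkTape (h ∷ l) c r

  act : Cell × Move → Tape Cell → Tape Cell
  act (c , m) t = moveHead m (record t { here = c })

  Configuration : Set
  Configuration = State × Vec (Tape Cell) tapes

  step : Configuration → Maybe Configuration
  step (q , ts) with δ q (Vec.map here ts)
  ... | nothing       = nothing
  ... | just (q′ , as) = just (q′ , Vec.zipWith act as ts)

  -- c ⇓[ t ] c′: from c the machine halts in c′ after exactly t steps.
  data _⇓[_]_ : Configuration → ℕ → Configuration → Set where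
    halt : ∀ {c} → step c ≡ nothing → c ⇓[ 0 ] c
    next : ∀ {c c′ c″ t} → step c ≡ just c′ → c′ ⇓[ t ] c″ → c ⇓[ suc t ] c″

  blankTape : Tape Cell
  blankTape = mkTape [] blank []

  inputTape : Word → Tape Cell
  inputTape []      = blankTape
  inputTape (a ∷ w) = mkTape [] (just (inj₁ a)) (map (just ∘ inj₁) w)

  start : Word → Configuration
  start w = initial , (Vec.replicate tapes blankTape Vec.[ inTape ]≔ inputTape w)

  -- The output word runs from the head of the output tape rightwards up to
  -- the first cell that does not hold a Symbol.
  readWord : List Cell → Word
  readWord (just (inj₁ a) ∷ cs) = a ∷ readWord cs
  readWord _                    = []

  output : Configuration → Word
  output (_ , ts) = readWord (here t ∷ after t)
    where t = Vec.lookup ts outTape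

record DecisionProblem : Set₁ where
  field
    Instance : Set
    encode   : Instance → Word
    Yes      : Instance → Set

record PolynomialTime {I J : Set} (encI : I → Word) (encJ : J → Word)
                      (f : I → J) : Set₁ where
  field
    machine : TuringMachine
  open Semantics machine
  field
    coefficient degree : ℕ
    computes : ∀ i → ∃[ t ] ∃[ c ]
      (start (encI i) ⇓[ t ] c)
      × output c ≡ encJ (f i)
      × t ℕ.≤ coefficient ℕ.* length (encI i) ℕ.^ degree ℕ.+ coefficient

infix 4 _≤ₚ_

record _≤ₚ_ (P Q : DecisionProblem) : Set₁ where
  private
    module P = DecisionProblem P
    module Q = DecisionProblem Q
  field
    reduce         : P.Instance → Q.Instance
    correct        : ∀ i → P.Yes i ⇔ Q.Yes (reduce i)
    polynomialTime : PolynomialTime P.encode Q.encode reduce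

record SqrtSumInstance : Set where
  field
    n : ℕ
    c : Vector ℕ n
    d : ℤ

SQRT-SUM : DecisionProblem
SQRT-SUM = record
  { Instance = SqrtSumInstance
  -- d comes first so that no marker is needed for the end of c.
  ; encode   = λ I → let open SqrtSumInstance I in
                 encodeℤ d ++ encodeVector encodeℕ c
  ; Yes      = λ I → let open SqrtSumInstance I in
                 ∃[ s ] (∀ i → IsSqrt (s i) (c i)) × sumℝ s ≤ℝ fromℤ d
  }

record MDP : Set where
  field
    n k      : ℕ
    n>0      : 0 ℕ.< n
    k>0      : 0 ℕ.< k
    γ        : ℚᵘ
    0≤γ      : 0ℚᵘ ℚᵘ.≤ γ
    γ<1      : γ ℚᵘ.< 1ℚᵘ
    C        : Fin n → Fin k → ℚᵘ
    μ        : Vector ℚᵘ n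
    μ≥0      : ∀ s → 0ℚᵘ ℚᵘ.≤ μ s
    ∑μ≃1     : sumℚᵘ μ ℚᵘ.≃ 1ℚᵘ
    -- p s a s̄ is the probability of moving from s to s̄ under action a.
    p        : Fin n → Fin k → Fin n → ℚᵘ
    p≥0      : ∀ s a s̄ → 0ℚᵘ ℚᵘ.≤ p s a s̄
    ∑p≃1     : ∀ s a → sumℚᵘ (p s a) ℚᵘ.≃ 1ℚᵘ

module BlindControl (M : MDP) where
  open MDP M

  InSimplex : Vector ℝ k → Set
  InSimplex π = (∀ a → 0ℝ ≤ℝ π a) × sumℝ π ≃ℝ 1ℝ

  -- Since γ < 1, exactly one x is the occupancy vector of a given π in the
  -- simplex.
  IsOccupancy : Vector ℝ k → Vector ℝ n → Set
  IsOccupancy π x = (∀ s → 0ℝ ≤ℝ x s) × (∀ s̄ →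
    x s̄ ≃ℝ fromℚᵘ ((1ℚᵘ ℚᵘ.- γ) ℚᵘ.* μ s̄)
             +ℝ fromℚᵘ γ *ℝ sumℝ (λ a → π a *ℝ sumℝ (λ s → fromℚᵘ (p s a s̄) *ℝ x s)))

  cost : Vector ℝ k → Vector ℝ n → ℝ
  cost π x = sumℝ (λ s → sumℝ (λ a → x s *ℝ π a *ℝ fromℚᵘ (C s a)))

record BlindPolicyInstance : Set where
  field
    mdp : MDP
    r   : ℚᵘ
  open MDP mdp public

STOCHASTIC-BLIND-POLICY : DecisionProblem
STOCHASTIC-BLIND-POLICY = record
  { Instance = BlindPolicyInstance
  ; encode   = λ I → let open BlindPolicyInstance I in
                 encodeℕ n ++ encodeℕ k
                 ++ encodeℚᵘ γ
                 ++ encodeVector (encodeVector encodeℚᵘ) C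
                 ++ encodeVector encodeℚᵘ μ
                 ++ encodeVector (encodeVector (encodeVector encodeℚᵘ)) p
                 ++ encodeℚᵘ r
  ; Yes      = λ I → let open BlindPolicyInstance I
                         open BlindControl mdp in
                 ∃[ π ] InSimplex π × (∃[ x ] IsOccupancy π x × cost π x ≤ℝ fromℚᵘ r)
  }

{-# OPTIONS --safe #-}

-- By the inequality of arithmetic and geometric means, Y + 4 c / Y ≥ 4 √c with
-- equality at Y = 2 √c.  Let γ = T / (1 + T), let each of the K states have initial
-- probability 1 / K, and let state j be left (for an absorbing state) exactly under
-- its own action j.  The occupancy of state j is then 1 / (K Y_j) for
-- Y_j = 1 + T π_j.  A cost 4 c_j in state j, a cost T for action j in a further
-- absorbing state, and a cost 1 everywhere add up to (2 + Σ (Y_j + 4 c_j / Y_j)) / K.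
-- All Y_j = 2 √c_j are attained at once if T ≥ Σ c_j, so some policy meets the
-- threshold (4 d + 2) / K if and only if Σ √c_j ≤ d.
--
-- There is one state for every symbol of the encoded list; those without a number,
-- and those with c_j = 0, cost nothing and contribute Y_j - 1 / Y_j, whose minimum
-- is 0.  With T a power of 2, the machine needs no arithmetic but a binary counter:
-- it writes the instance, back to front, by nested loops over the input.

module Submission where

-- Nonnegative action probabilities force Y_j ≥ 1. For c_j ≥ 1 the optimum 2 √c_j respects this, but
-- for c_j = 0 it would be 0; a zero therefore loses its base cost, and its contribution Y - 1 / Y
-- is least at Y = 1 with value 0 = 4 √0. The same choice makes the additional states of a number
-- harmless. The cost 1 everywhere is there because the actions pay only for T π_j = Y_j - 1: all
-- occupancies together make K / K, which returns the missing 1 of every Y_j. The bound T ≥ Σ c_j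
-- suffices because 2 √c - 1 ≤ c. Division by real numbers is avoided: the occupancy x is used
-- through x Y = κ, with κ = 1 / K, and completing the square leaves x (Y - 2 √c)², which is visibly
-- nonnegative. With one state per symbol, a loop over the input is a loop over states or actions,
-- and "the entries before and after the current one" are the parts of the tape beside the current
-- symbol. Output is written back to front because it is read rightwards from the head: a word grown
-- by pushing at the head ends with the head on its first symbol.

open import Defs
open import Data.Bool.Base using (Bool; true; false; if_then_else_)
open import Data.Empty using (⊥; ⊥-elim)
open import Data.Fin.Base using (Fin; zero; suc)
open import Data.Fin.Patterns
import Data.Fin.Properties as Fin
open import Data.Integer.Base as ℤ using (ℤ; -[1+_])
import Data.Integer.Properties as ℤ
open import Data.List.Base as List using (List; []; _∷_; _++_; length; replicate)
import Data.List.Properties as List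
open import Data.Nat.Base as ℕ using (ℕ; zero; suc; z≤n; s≤s)
import Data.Nat.Properties as ℕ
open import Data.Product.Base using (∃-syntax; _×_; _,_; proj₁; proj₂)
open import Data.Rational.Unnormalised.Base as ℚᵘ using (ℚᵘ; mkℚᵘ; 0ℚᵘ; 1ℚᵘ; *≡*; *<*; *≤*)
import Data.Rational.Unnormalised.Properties as ℚᵘ
open import Data.Sum.Base using (_⊎_; inj₁; inj₂; [_,_]′)
open import Data.Vec.Functional using (Vector)
open import Function.Base using (_∘_; const)
open import Function.Bundles using (_⇔_; mk⇔)
open import Function.Definitions using (Injective)
open import Relation.Binary.PropositionalEquality as ≡
open import Relation.Nullary.Decidable using (Dec; yes; no; does; dec-true; dec-false)

-- Turing machines as stack programs

module Programs where

  open import Data.Bool.Base using (T; not)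
  open import Data.Fin.Base using (toℕ; inject₁; combine; remQuot; splitAt; _↑ʳ_)
  open import Data.List.Base using (map; head; takeWhileᵇ; dropWhileᵇ; _ʳ++_)
  open import Data.Maybe.Base using (Maybe; just; nothing; maybe′)
  open import Data.Nat.Base using (_+_; _*_; _≤_; _<_)
  open import Data.Sum.Function.Propositional using (_⊎-↔_)
  open import Data.Unit.Base using (⊤; tt)
  open import Data.Vec.Base as Vec using (Vec; lookup; tabulate; zipWith; _[_]≔_) renaming ([] to ⟨⟩; _∷_ to infixr 5 _,,_)
  import Data.Vec.Properties as Vec
  open import Function.Properties.Inverse using (↔-sym; ↔-trans)

  data Part : Set where
    prv cur nxt : Part

  -- `inp` holds the input, `dd` the signed binary expansion of `d`, `bin` that of the number of
  -- states; the nine `lvl` tapes serve three levels of nested loops. `scr` and `out` stay outside,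
  -- so that emitters cannot read them.
  data RVar : Set where
    inp dd bin : RVar
    lvl        : Fin 3 → Part → RVar

  data Var : Set where
    rd      : RVar → Var
    scr out : Var

  -- The Booleans are the extra work symbols. They mark the two states that belong to no symbol of
  -- the input.
  Γ : Set
  Γ = Symbol ⊎ Bool

  Sym : Set
  Sym = Maybe Γ

  private
    codeP : Part → Fin 3
    codeP prv = 0F
    codeP cur = 1F
    codeP nxt = 2F

    decodeP : Fin 3 → Part
    decodeP 0F = prv
    decodeP 1F = cur
    decodeP 2F = nxt

    decode-codeP : ∀ p → decodeP (codeP p) ≡ p
    decode-codeP prv = refl
    decode-codeP cur = refl
    decode-codeP nxt = refl

    decodeBase : Fin 5 → Var
    decodeBase 0F = rd inp
    decodeBase 1F = rd dd
    decodeBase 2F = rd bin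
    decodeBase 3F = scr
    decodeBase 4F = out

    decodeLvl : Fin 3 × Fin 3 → Var
    decodeLvl (i , p) = rd (lvl i (decodeP p))

  code : Var → Fin 14
  code (rd inp)       = 0F
  code (rd dd)        = 1F
  code (rd bin)       = 2F
  code scr            = 3F
  code out            = 4F
  code (rd (lvl i p)) = 5 ↑ʳ combine i (codeP p)

  decode : Fin 14 → Var
  decode k = [ decodeBase , decodeLvl ∘ remQuot 3 ]′ (splitAt 5 k)

  decode-code : ∀ v → decode (code v) ≡ v
  decode-code (rd inp) = refl
  decode-code (rd dd)  = refl
  decode-code (rd bin) = refl
  decode-code scr      = refl
  decode-code out      = refl
  decode-code (rd (lvl i p)) =
    trans (cong decodeLvl (Fin.remQuot-combine i (codeP p))) (cong (rd ∘ lvl i) (decode-codeP p))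

  code-injective : ∀ {u v} → code u ≡ code v → u ≡ v
  code-injective {u} {v} eq =
    trans (sym (decode-code u)) (trans (cong decode eq) (decode-code v))

  infix 4 _≟_
  _≟_ : (u v : Var) → Dec (u ≡ v)
  u ≟ v with code u Fin.≟ code v
  ... | yes e = yes (code-injective e)
  ... | no ¬e = no (¬e ∘ cong code)

  -- Structured programs and their control locations

  data Prog : Set where
    step  : ((Var → Sym) → Var → Sym × Move) → Prog
    _⨾_   : Prog → Prog → Prog
    while : Var → (Sym → Bool) → Prog → Prog
    ite   : Var → (Sym → Bool) → Prog → Prog → Prog

  infixr 5 _⨾_

  Loc : Prog → Set
  Loc (step f)      = ⊤
  Loc (p ⨾ q)       = Loc p ⊎ Loc q
  Loc (while v b p) = ⊤ ⊎ Loc p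
  Loc (ite v b p q) = ⊤ ⊎ (Loc p ⊎ Loc q)

  Loc-finite : ∀ p → Finite (Loc p)
  Loc-finite (step f) = 1 , ↔-sym Fin.1↔⊤
  Loc-finite (p ⨾ q) with Loc-finite p | Loc-finite q
  ... | m , f | n , g = m + n , ↔-trans (f ⊎-↔ g) (↔-sym Fin.+↔⊎)
  Loc-finite (while v b p) with Loc-finite p
  ... | m , f = 1 + m , ↔-trans (↔-sym Fin.1↔⊤ ⊎-↔ f) (↔-sym Fin.+↔⊎)
  Loc-finite (ite v b p q) with Loc-finite p | Loc-finite q
  ... | m , f | n , g = 1 + (m + n) ,
    ↔-trans (↔-sym Fin.1↔⊤ ⊎-↔ ↔-trans (f ⊎-↔ g) (↔-sym Fin.+↔⊎)) (↔-sym Fin.+↔⊎)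

  entry : ∀ p → Loc p
  entry (step f)      = tt
  entry (p ⨾ q)       = inj₁ (entry p)
  entry (while v b p) = inj₁ tt
  entry (ite v b p q) = inj₁ tt

  -- Writing back what was scanned: a test takes one step and changes no tape.
  idle : (Var → Sym) → Var → Sym × Move
  idle cs v = cs v , stay

  -- `f` embeds the locations of a part into the whole; `e` is where control goes when the part is
  -- left.
  continue : ∀ {A B : Set} → (A → B) → Maybe B → Maybe A → Maybe B
  continue f e (just s) = just (f s)
  continue f e nothing  = e

  -- nothing stands for leaving the program.
  jump : ∀ p → Loc p → (Var → Sym) → Maybe (Loc p)
  jump (step f) tt cs = nothing
  jump (p ⨾ q) (inj₁ s) cs = continue inj₁ (just (inj₂ (entry q))) (jump p s cs)
  jump (p ⨾ q) (inj₂ s) cs = continue inj₂ nothing (jump q s cs)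
  jump (while v b p) (inj₁ tt) cs = if b (cs v) then just (inj₂ (entry p)) else nothing
  jump (while v b p) (inj₂ s)  cs = continue inj₂ (just (inj₁ tt)) (jump p s cs)
  jump (ite v b p q) (inj₁ tt) cs =
    just (inj₂ (if b (cs v) then inj₁ (entry p) else inj₂ (entry q)))
  jump (ite v b p q) (inj₂ (inj₁ s)) cs = continue (inj₂ ∘ inj₁) nothing (jump p s cs)
  jump (ite v b p q) (inj₂ (inj₂ s)) cs = continue (inj₂ ∘ inj₂) nothing (jump q s cs)

  action : ∀ p → Loc p → (Var → Sym) → Var → Sym × Move
  action (step f)      tt               = f
  action (p ⨾ q)       (inj₁ s)         = action p s
  action (p ⨾ q)       (inj₂ s)         = action q s
  action (while v b p) (inj₁ tt)        = idle
  action (while v b p) (inj₂ s)         = action p s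
  action (ite v b p q) (inj₁ tt)        = idle
  action (ite v b p q) (inj₂ (inj₁ s))  = action p s
  action (ite v b p q) (inj₂ (inj₂ s))  = action q s

  Tapes : Set
  Tapes = Vec (Tape Sym) 14

  -- Head movement restated without reference to a machine, so that programs can be reasoned about
  -- before one is built from them; `moveHead≗move` identifies the two.
  move : Move → Tape Sym → Tape Sym
  move stay  t                     = t
  move left  (mkTape []      h r)  = mkTape [] nothing (h ∷ r)
  move left  (mkTape (c ∷ l) h r)  = mkTape l c (h ∷ r)
  move right (mkTape l h [])       = mkTape (h ∷ l) nothing []
  move right (mkTape l h (c ∷ r))  = mkTape (h ∷ l) c r

  perform : Sym × Move → Tape Sym → Tape Sym
  perform (c , m) t = move m (record t { here = c })

  heads : Tapes → Var → Sym
  heads ts v = lookup (Vec.map here ts) (code v)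

  apply : (Var → Sym × Move) → Tapes → Tapes
  apply f ts = zipWith perform (tabulate (f ∘ decode)) ts

  tape : Tapes → Var → Tape Sym
  tape ts v = lookup ts (code v)

  heads-tape : ∀ ts v → heads ts v ≡ here (tape ts v)
  heads-tape ts v = Vec.lookup-map (code v) here ts

  tape-apply : ∀ f ts v → tape (apply f ts) v ≡ perform (f v) (tape ts v)
  tape-apply f ts v
    rewrite Vec.lookup-zipWith perform (code v) (tabulate (f ∘ decode)) ts
          | Vec.lookup∘tabulate (f ∘ decode) (code v)
          | decode-code v = refl

  -- The action at the exit location is still performed and counted, so the lengths of consecutive
  -- parts add up exactly.
  data Path (p : Prog) : Loc p → Tapes → ℕ → Tapes → Set where
    exit : ∀ {s ts} → jump p s (heads ts) ≡ nothing →
           Path p s ts 1 (apply (action p s (heads ts)) ts)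
    go   : ∀ {s s′ ts t ts′} → jump p s (heads ts) ≡ just s′ →
           Path p s′ (apply (action p s (heads ts)) ts) t ts′ → Path p s ts (suc t) ts′

  module _ {p q : Prog} where

    seq-right : ∀ {s ts t ts′} → Path q s ts t ts′ → Path (p ⨾ q) (inj₂ s) ts t ts′
    seq-right (exit e) = exit (cong (continue inj₂ nothing) e)
    seq-right (go e P) = go (cong (continue inj₂ nothing) e) (seq-right P)

    seq-path : ∀ {s ts t ts′ t′ ts″} → Path p s ts t ts′ → Path q (entry q) ts′ t′ ts″ →
               Path (p ⨾ q) (inj₁ s) ts (t + t′) ts″
    seq-path (exit e) Q = go (cong (continue inj₁ (just (inj₂ (entry q)))) e) (seq-right Q)
    seq-path (go e P) Q = go (cong (continue inj₁ (just (inj₂ (entry q)))) e) (seq-path P Q)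

    module _ {v : Var} {b : Sym → Bool} where

      ite-left : ∀ {s ts t ts′} → Path p s ts t ts′ →
                 Path (ite v b p q) (inj₂ (inj₁ s)) ts t ts′
      ite-left (exit e) = exit (cong (continue (inj₂ ∘ inj₁) nothing) e)
      ite-left (go e P) = go (cong (continue (inj₂ ∘ inj₁) nothing) e) (ite-left P)

      ite-right : ∀ {s ts t ts′} → Path q s ts t ts′ →
                  Path (ite v b p q) (inj₂ (inj₂ s)) ts t ts′
      ite-right (exit e) = exit (cong (continue (inj₂ ∘ inj₂) nothing) e)
      ite-right (go e P) = go (cong (continue (inj₂ ∘ inj₂) nothing) e) (ite-right P)

  while-path : ∀ {v b p s ts t ts′ t′ ts″} → Path p s ts t ts′ →
               Path (while v b p) (inj₁ tt) ts′ t′ ts″ →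
               Path (while v b p) (inj₂ s) ts (t + t′) ts″
  while-path (exit e) W = go (cong (continue inj₂ (just (inj₁ tt))) e) W
  while-path (go e P) W = go (cong (continue inj₂ (just (inj₁ tt))) e) (while-path P W)

  -- A tape stores a stack: the nonblank cells from the head rightwards.

  Store : Set
  Store = Var → List Γ

  prefix : List Sym → List Γ
  prefix (just a ∷ cs) = a ∷ prefix cs
  prefix _             = []

  stack : Tape Sym → List Γ
  stack t = prefix (here t ∷ after t)

  infix 4 _⊨_
  _⊨_ : Tapes → Store → Set
  ts ⊨ S = ∀ v → stack (tape ts v) ≡ S v

  top : List Γ → Sym
  top = head

  here≡top : ∀ t → here t ≡ top (stack t)
  here≡top (mkTape l (just x) r) = refl
  here≡top (mkTape l nothing  r) = refl

  heads≡top : ∀ {ts S} → ts ⊨ S → ∀ v → heads ts v ≡ top (S v)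
  heads≡top {ts} ts⊨S v =
    trans (heads-tape ts v) (trans (here≡top (tape ts v)) (cong top (ts⊨S v)))

  ⊨-resp : ∀ {ts S S′} → S ≗ S′ → ts ⊨ S → ts ⊨ S′
  ⊨-resp eq ts⊨S v = trans (ts⊨S v) (eq v)

  ⊨-idle : ∀ {ts S} → ts ⊨ S → apply (idle (heads ts)) ts ⊨ S
  ⊨-idle {ts} {S} ts⊨S v rewrite tape-apply (idle (heads ts)) ts v | heads-tape ts v = ts⊨S v

  -- Total-correctness triples with time bounds

  record Triple (p : Prog) (S S′ : Store) (B : ℕ) : Set where
    constructor triple
    field run : ∀ {ts} → ts ⊨ S →
                ∃[ t ] ∃[ ts′ ] t ≤ B × Path p (entry p) ts t ts′ × ts′ ⊨ S′

  open Triple public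

  -- The rule of consequence. Stores are functions, and lacking extensionality they can only be
  -- compared pointwise.
  restate : ∀ {p S₁ S₂ S₁′ S₂′ B} → S₁ ≗ S₂ → S₁′ ≗ S₂′ → Triple p S₂ S₁′ B → Triple p S₁ S₂′ B
  restate eq eq′ P .run {ts} ts⊨S =
    let t , ts′ , t≤ , P′ , ts⊨S′ = P .run (⊨-resp {ts} eq ts⊨S)
    in  t , ts′ , t≤ , P′ , ⊨-resp {ts′} eq′ ts⊨S′

  weaken : ∀ {p S S′ B B′} → B ≤ B′ → Triple p S S′ B → Triple p S S′ B′
  weaken B≤ P .run ts⊨S =
    let t , ts′ , t≤ , P′ , ts⊨S′ = P .run ts⊨S
    in  t , ts′ , ℕ.≤-trans t≤ B≤ , P′ , ts⊨S′

  infixr 5 _⟫_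
  _⟫_ : ∀ {p q S S′ S″ B B′} → Triple p S S′ B → Triple q S′ S″ B′ → Triple (p ⨾ q) S S″ (B + B′)
  (P ⟫ Q) .run ts⊨S =
    let t  , ts′ , t≤  , P′ , ts⊨S′ = P .run ts⊨S
        t′ , ts″ , t′≤ , Q′ , ts⊨S″ = Q .run ts⊨S′
    in  t + t′ , ts″ , ℕ.+-mono-≤ t≤ t′≤ , seq-path P′ Q′ , ts⊨S″

  while-done : ∀ {v b p S} → b (top (S v)) ≡ false → Triple (while v b p) S S 1
  while-done {v} {b} e .run {ts} ts⊨S =
    1 , _ , ℕ.≤-refl ,
    exit (cong (if_then _ else nothing) (trans (cong b (heads≡top {ts} ts⊨S v)) e)) ,
    ⊨-idle {ts} ts⊨S

  while-step : ∀ {v b p S S′ S″ B B′} → b (top (S v)) ≡ true → Triple p S S′ B →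
               Triple (while v b p) S′ S″ B′ → Triple (while v b p) S S″ (1 + (B + B′))
  while-step {v} {b} e P W .run {ts} ts⊨S =
    let t  , ts′ , t≤  , P′ , ts⊨S′ = P .run (⊨-idle {ts} ts⊨S)
        t′ , ts″ , t′≤ , W′ , ts⊨S″ = W .run ts⊨S′
    in  suc (t + t′) , ts″ , s≤s (ℕ.+-mono-≤ t≤ t′≤) ,
        go (cong (if_then _ else nothing) (trans (cong b (heads≡top {ts} ts⊨S v)) e))
           (while-path P′ W′) ,
        ts⊨S″

  ite-true : ∀ {v b p q S S′ B} → b (top (S v)) ≡ true → Triple p S S′ B →
             Triple (ite v b p q) S S′ (1 + B)
  ite-true {v} {b} {p} {q} e P .run {ts} ts⊨S =
    let t  , ts′ , t≤  , P′ , ts⊨S′ = P .run (⊨-idle {ts} ts⊨S)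
    in  suc t , ts′ , s≤s t≤ ,
        go (cong (λ c → just (inj₂ (if c then inj₁ (entry p) else inj₂ (entry q))))
                 (trans (cong b (heads≡top {ts} ts⊨S v)) e)) (ite-left P′) ,
        ts⊨S′

  ite-false : ∀ {v b p q S S′ B} → b (top (S v)) ≡ false → Triple q S S′ B →
              Triple (ite v b p q) S S′ (1 + B)
  ite-false {v} {b} {p} {q} e P .run {ts} ts⊨S =
    let t  , ts′ , t≤  , P′ , ts⊨S′ = P .run (⊨-idle {ts} ts⊨S)
    in  suc t , ts′ , s≤s t≤ ,
        go (cong (λ c → just (inj₂ (if c then inj₁ (entry p) else inj₂ (entry q))))
                 (trans (cong b (heads≡top {ts} ts⊨S v)) e)) (ite-right P′) ,
        ts⊨S′

  infixl 9 _[_≔_]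
  _[_≔_] : Store → Var → List Γ → Store
  (S [ v ≔ w ]) u = if does (u ≟ v) then w else S u

  shift : Move → Var → (Var → Sym) → Var → Sym × Move
  shift m v cs u = cs u , (if does (u ≟ v) then m else stay)

  pop : Var → Prog
  pop v = step (shift right v)

  -- A machine step writes before it moves, hence two steps: one to reach the cell left of the top,
  -- one to fill it.
  push : Γ → Var → Prog
  push a v = step (shift left v) ⨾ step (λ cs u → (if does (u ≟ v) then just a else cs u) , stay)

  copyTop : Var → Var → Prog
  copyTop x v = step (shift left v) ⨾ step (λ cs u → (if does (u ≟ v) then cs x else cs u) , stay)

  transfer : Var → Var → Prog
  transfer x v = copyTop x v ⨾ pop x

  pop-stack : ∀ {c a w} t → c ≡ here t → stack t ≡ a ∷ w → stack (perform (c , right) t) ≡ w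
  pop-stack (mkTape l (just _) [])      refl refl = refl
  pop-stack (mkTape l (just _) (c ∷ r)) refl refl = refl

  stay-stack : ∀ {c} t → c ≡ here t → stack (perform (c , stay) t) ≡ stack t
  stay-stack t refl = refl

  push-stack : ∀ {c} a t → c ≡ here t →
               stack (perform (just a , stay) (perform (c , left) t)) ≡ a ∷ stack t
  push-stack a (mkTape []      h r) refl = refl
  push-stack a (mkTape (_ ∷ _) h r) refl = refl

  pop-triple : ∀ {v a w S} → S v ≡ a ∷ w → Triple (pop v) S (S [ v ≔ w ]) 1
  pop-triple {v} {a} {w} {S} e .run {ts} ts⊨S = 1 , _ , ℕ.≤-refl , exit refl , result
    where
    result : apply (shift right v (heads ts)) ts ⊨ S [ v ≔ w ]
    result u rewrite tape-apply (shift right v (heads ts)) ts u with u ≟ v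
    ... | yes refl = pop-stack (tape ts v) (heads-tape ts v) (trans (ts⊨S v) e)
    ... | no _     = trans (stay-stack (tape ts u) (heads-tape ts u)) (ts⊨S u)

  module _ {v : Var} {a : Γ} {S : Store} {ts : Tapes} (ts⊨S : ts ⊨ S) where

    private
      ts₁ : Tapes
      ts₁ = apply (shift left v (heads ts)) ts

    push-result : (f : Sym) → f ≡ just a →
      apply (λ u → (if does (u ≟ v) then f else heads ts₁ u) , stay) ts₁ ⊨ S [ v ≔ a ∷ S v ]
    push-result f refl u
      rewrite tape-apply (λ u → (if does (u ≟ v) then just a else heads ts₁ u) , stay) ts₁ u
            | heads-tape ts₁ u
            | tape-apply (shift left v (heads ts)) ts u
      with u ≟ v
    ... | yes refl = trans (push-stack a (tape ts v) (heads-tape ts v)) (cong (a ∷_) (ts⊨S v))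
    ... | no _     = trans (stay-stack (tape ts u) (heads-tape ts u)) (ts⊨S u)

  push-triple : ∀ {v S} a → Triple (push a v) S (S [ v ≔ a ∷ S v ]) 2
  push-triple a .run {ts} ts⊨S =
    2 , _ , ℕ.≤-refl , go refl (exit refl) , push-result {ts = ts} ts⊨S (just a) refl

  -- The symbol of `x` is read after the head of `v` has moved; it is still the old top because `x`
  -- is another tape.
  copyTop-triple : ∀ {x v a w S} → x ≢ v → S x ≡ a ∷ w →
                   Triple (copyTop x v) S (S [ v ≔ a ∷ S v ]) 2
  copyTop-triple {x} {v} {a} {w} {S} x≢v e .run {ts} ts⊨S =
    2 , _ , ℕ.≤-refl , go refl (exit refl) , push-result {ts = ts} ts⊨S _ unchanged
    where
    unchanged : heads (apply (shift left v (heads ts)) ts) x ≡ just a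
    unchanged rewrite heads-tape (apply (shift left v (heads ts)) ts) x
                    | tape-apply (shift left v (heads ts)) ts x
      with x ≟ v
    ... | yes x≡v = ⊥-elim (x≢v x≡v)
    ... | no _    = trans (heads≡top {ts} ts⊨S x) (cong top e)

  ≔-same : ∀ S v w → (S [ v ≔ w ]) v ≡ w
  ≔-same S v w with v ≟ v
  ... | yes _   = refl
  ... | no  v≢v = ⊥-elim (v≢v refl)

  ≔-other : ∀ S {u v} w → u ≢ v → (S [ v ≔ w ]) u ≡ S u
  ≔-other S {u} {v} w u≢v with u ≟ v
  ... | yes u≡v = ⊥-elim (u≢v u≡v)
  ... | no  _   = refl

  orHalt : ∀ {A : Set} → Maybe A → ⊤ ⊎ A
  orHalt (just s) = inj₂ s
  orHalt nothing  = inj₁ tt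

  -- The Turing machine of a program

  machine : Prog → TuringMachine
  machine p = record
    { tapes        = 14
    ; inTape       = code (rd inp)
    ; outTape      = code out
    ; Extra        = Bool
    ; Extra-finite = 2 , ↔-sym Fin.2↔Bool
    ; State        = ⊤ ⊎ Loc p
    ; State-finite = let m , f = Loc-finite p in
                     1 + m , ↔-trans (↔-sym Fin.1↔⊤ ⊎-↔ f) (↔-sym Fin.+↔⊎)
    ; initial      = inj₂ (entry p)
    ; δ            = λ { (inj₁ tt) cs → nothing
                       ; (inj₂ s)  cs → just
                           ( orHalt (jump p s (λ v → lookup cs (code v)))
                           , tabulate (action p s (λ v → lookup cs (code v)) ∘ decode)) }
    }

  module _ (p : Prog) where

    private module M = Semantics (machine p)

    private
      moveHead≗move : ∀ m t → M.moveHead m t ≡ move m t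
      moveHead≗move stay  t                    = refl
      moveHead≗move left  (mkTape []      h r) = refl
      moveHead≗move left  (mkTape (_ ∷ _) h r) = refl
      moveHead≗move right (mkTape l h [])      = refl
      moveHead≗move right (mkTape l h (_ ∷ _)) = refl

      apply-act : ∀ {n} (as : Vec (Sym × Move) n) ts → zipWith M.act as ts ≡ zipWith perform as ts
      apply-act Vec.[]             Vec.[]       = refl
      apply-act ((c , m) Vec.∷ as) (t Vec.∷ ts) = cong₂ Vec._∷_ (moveHead≗move m _) (apply-act as ts)

    path-run : ∀ {s ts t ts′} → Path p s ts t ts′ → (inj₂ s , ts) M.⇓[ t ] (inj₁ tt , ts′)
    path-run {s} {ts} (exit e) = M.next (cong just (cong₂ _,_ (cong orHalt e) (apply-act _ ts))) (M.halt refl)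
    path-run {s} {ts} (go e P) = M.next (cong just (cong₂ _,_ (cong orHalt e) (apply-act _ ts))) (path-run P)

    readWord-prefix : ∀ cs w → prefix cs ≡ map inj₁ w → M.readWord cs ≡ w
    readWord-prefix []                   []      e  = refl
    readWord-prefix (nothing ∷ _)        []      e  = refl
    readWord-prefix (just (inj₁ a) ∷ cs) (b ∷ w) e with List.∷-injective e
    ... | refl , e′ = cong (a ∷_) (readWord-prefix cs w e′)
    readWord-prefix (just (inj₂ a) ∷ cs) (b ∷ w) ()

    initialStore : Word → Store
    initialStore w (rd inp) = map inj₁ w
    initialStore w _        = []

    private
      prefix-input : ∀ w → prefix (map (just ∘ inj₁) w) ≡ map inj₁ w
      prefix-input []      = refl
      prefix-input (a ∷ w) = cong (inj₁ a ∷_) (prefix-input w)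

      stack-input : ∀ w → stack (M.inputTape w) ≡ map inj₁ w
      stack-input []      = refl
      stack-input (a ∷ w) = cong (inj₁ a ∷_) (prefix-input w)

      blank-stack : ∀ w (i : Fin 13) →
        stack (lookup (proj₂ (M.start w)) (suc i)) ≡ []
      blank-stack w i = cong stack (Vec.lookup-replicate i M.blankTape)

    start⊨initial : ∀ w → proj₂ (M.start w) ⊨ initialStore w
    start⊨initial w (rd inp)       = stack-input w
    start⊨initial w (rd dd)        = refl
    start⊨initial w (rd bin)       = refl
    start⊨initial w (rd (lvl i q)) = blank-stack w (4 ↑ʳ combine i (codeP q))
    start⊨initial w scr            = refl
    start⊨initial w out            = refl

    triple-run : ∀ {w S B u} → Triple p (initialStore w) S B → S out ≡ map inj₁ u →
      ∃[ t ] ∃[ c ] (M.start w M.⇓[ t ] c) × M.output c ≡ u × t ≤ B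
    triple-run {w} {S} {u = u} P e =
      let t , ts , t≤ , P′ , ts⊨S = P .run (start⊨initial w)
      in  t , (inj₁ tt , ts) , path-run P′ ,
          readWord-prefix _ u (trans (ts⊨S out) e) , t≤

  -- A store that differs from `S₀` at most on the tapes `ι` is given by the vector of their
  -- contents. Updates then compute on literal vectors; injectivity of `ι` rules out aliasing.
  module Slots {n} (ι : Fin n → Var) (ι-injective : Injective _≡_ _≡_ ι) (S₀ : Store) where

    slots : Vec (List Γ) n → Store
    slots ws v with Fin.any? (λ k → ι k ≟ v)
    ... | yes (k , _) = lookup ws k
    ... | no _        = S₀ v

    slots-unique : ∀ {S ws} → (∀ k → S (ι k) ≡ lookup ws k) →
                   (∀ v → (∀ k → ι k ≢ v) → S v ≡ S₀ v) → S ≗ slots ws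
    slots-unique in-slot elsewhere v with Fin.any? (λ k → ι k ≟ v)
    ... | yes (k , refl) = in-slot k
    ... | no ∄k          = elsewhere v (λ k e → ∄k (k , e))

    slots-lookup : ∀ ws k → slots ws (ι k) ≡ lookup ws k
    slots-lookup ws k with Fin.any? (λ l → ι l ≟ ι k)
    ... | yes (l , e) = cong (lookup ws) (ι-injective e)
    ... | no ∄l       = ⊥-elim (∄l (k , refl))

    slots-elsewhere : ∀ ws v → (∀ k → ι k ≢ v) → slots ws v ≡ S₀ v
    slots-elsewhere ws v ∉ι with Fin.any? (λ l → ι l ≟ v)
    ... | yes (l , e) = ⊥-elim (∉ι l e)
    ... | no _        = refl

    slots-update : ∀ ws k w → slots ws [ ι k ≔ w ] ≗ slots (ws [ k ]≔ w)
    slots-update ws k w = slots-unique in-slot elsewhere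
      where
      in-slot : ∀ l → (slots ws [ ι k ≔ w ]) (ι l) ≡ lookup (ws [ k ]≔ w) l
      in-slot l with l Fin.≟ k
      ... | yes refl = trans (≔-same (slots ws) (ι k) w) (sym (Vec.lookup∘update k ws w))
      ... | no l≢k   = trans (≔-other (slots ws) w (l≢k ∘ ι-injective))
                             (trans (slots-lookup ws l) (sym (Vec.lookup∘update′ l≢k ws w)))
      elsewhere : ∀ v → (∀ l → ι l ≢ v) → (slots ws [ ι k ≔ w ]) v ≡ S₀ v
      elsewhere v ∉ι = trans (≔-other (slots ws) w (∉ι k ∘ sym)) (slots-elsewhere ws v ∉ι)

    pop-slots : ∀ {ws a w} k → lookup ws k ≡ a ∷ w →
                Triple (pop (ι k)) (slots ws) (slots (ws [ k ]≔ w)) 1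
    pop-slots {ws} k e =
      restate (λ _ → refl) (slots-update ws k _) (pop-triple (trans (slots-lookup ws k) e))

    push-slots : ∀ {ws} a k → Triple (push a (ι k)) (slots ws) (slots (ws [ k ]≔ (a ∷ lookup ws k))) 2
    push-slots {ws} a k =
      restate (λ _ → refl)
              (λ v → trans (slots-update ws k _ v)
                           (cong (λ w → slots (ws [ k ]≔ (a ∷ w)) v) (slots-lookup ws k)))
              (push-triple a)

    copyTop-slots : ∀ {ws a w} k l → k ≢ l → lookup ws k ≡ a ∷ w →
                    Triple (copyTop (ι k) (ι l)) (slots ws) (slots (ws [ l ]≔ (a ∷ lookup ws l))) 2
    copyTop-slots {ws} {a} k l k≢l e =
      restate (λ _ → refl)
              (λ v → trans (slots-update ws l _ v)
                           (cong (λ w → slots (ws [ l ]≔ (a ∷ w)) v) (slots-lookup ws l)))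
              (copyTop-triple (k≢l ∘ ι-injective) (trans (slots-lookup ws k) e))

    transfer-slots : ∀ {ws a w} k l → k ≢ l → lookup ws k ≡ a ∷ w →
                     Triple (transfer (ι k) (ι l)) (slots ws)
                            (slots (ws [ l ]≔ (a ∷ lookup ws l) [ k ]≔ w)) 3
    transfer-slots {ws} k l k≢l e =
      copyTop-slots k l k≢l e ⟫ pop-slots k (trans (Vec.lookup∘update′ k≢l ws _) e)

    while-done-slots : ∀ {ws b p} k → b (top (lookup ws k)) ≡ false →
                       Triple (while (ι k) b p) (slots ws) (slots ws) 1
    while-done-slots {ws} {b} k e = while-done (trans (cong (b ∘ top) (slots-lookup ws k)) e)

    while-step-slots : ∀ {ws b p S S′ B B′} k → b (top (lookup ws k)) ≡ true →
                       Triple p (slots ws) S B → Triple (while (ι k) b p) S S′ B′ →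
                       Triple (while (ι k) b p) (slots ws) S′ (1 + (B + B′))
    while-step-slots {ws} {b} k e = while-step (trans (cong (b ∘ top) (slots-lookup ws k)) e)

  -- Emitters write a word back to front, by pushing onto the output tape.  In the
  -- body of a loop at level j, the tapes lvl j prv, lvl j cur and lvl j nxt hold the
  -- symbols before the current one (nearest first), the current one, and the rest.

  Env : Set
  Env = RVar → List Γ

  -- A loop at level `j` fills and clears its own three tapes, so it must range over a different
  -- one.
  offLevel : Fin 3 → RVar → Bool
  offLevel j (lvl i _) = not (does (i Fin.≟ j))
  offLevel j _         = true

  infixr 5 _·_
  -- A loop at level `j` has index `suc j` and its body index `j`: levels decrease strictly inwards,
  -- so nested loops never share tapes.
  data Emitter : Fin 4 → Set where
    emit  : ∀ {n} → Symbol → Emitter n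
    _·_   : ∀ {n} → Emitter n → Emitter n → Emitter n
    iftop : ∀ {n} → RVar → (Sym → Bool) → Emitter n → Emitter n → Emitter n
    for   : ∀ {j : Fin 3} (x : RVar) {_ : T (offLevel j x)} → (Γ → Bool) →
            Emitter (inject₁ j) → Emitter (suc j)

  level : List Γ → List Γ → List Γ → Part → List Γ
  level l x r prv = l
  level l x r cur = x
  level l x r nxt = r

  setLevel : Env → Fin 3 → (Part → List Γ) → Env
  setLevel ρ j f (lvl i p) = if does (i Fin.≟ j) then f p else ρ (lvl i p)
  setLevel ρ j f v         = ρ v

  -- The first symbol is the outermost application: output appears in reading order although the
  -- last symbol is treated first.
  eachIn : (List Γ → Γ → List Γ → Word → Word) → List Γ → List Γ → Word → Word
  eachIn f l []      o = o
  eachIn f l (a ∷ w) o = f l a w (eachIn f (a ∷ l) w o)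

  ⟦_⟧ : ∀ {n} → Emitter n → Env → Word → Word
  ⟦ emit a ⟧ ρ o          = a ∷ o
  ⟦ e · f ⟧ ρ o           = ⟦ e ⟧ ρ (⟦ f ⟧ ρ o)
  ⟦ iftop x b e f ⟧ ρ o   = if b (top (ρ x)) then ⟦ e ⟧ ρ o else ⟦ f ⟧ ρ o
  ⟦ for {j} x b e ⟧ ρ o   =
    eachIn (λ l a r → ⟦ e ⟧ (setLevel ρ j (level l (a ∷ []) r))) [] (takeWhileᵇ b (ρ x)) o

  on : (Γ → Bool) → Sym → Bool
  on b = maybe′ b false

  some : Sym → Bool
  some = on (const true)

  -- A loop copies the selected prefix of `x` to `prv`, parking it on `scr`, and restores `x`. Now
  -- the last symbol is on top of `prv`, so the traversal runs back to front, as pushing requires;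
  -- `prv` and `nxt` are the two sides of a zipper around `cur`.
  compile : ∀ {n} → Emitter n → Prog
  compile (emit a)        = push (inj₁ a) out
  compile (e · f)         = compile f ⨾ compile e
  compile (iftop x b e f) = ite (rd x) b (compile e) (compile f)
  compile (for {j} x b e) =
      while (rd x) (on b) (copyTop (rd x) (rd (lvl j prv)) ⨾ transfer (rd x) scr)
    ⨾ while scr some (transfer scr (rd x))
    ⨾ while (rd (lvl j prv)) some
        (transfer (rd (lvl j prv)) (rd (lvl j cur)) ⨾ compile e
          ⨾ transfer (rd (lvl j cur)) (rd (lvl j nxt)))
    ⨾ while (rd (lvl j nxt)) some (pop (rd (lvl j nxt)))

  time : ∀ {n} → Emitter n → ℕ → ℕ
  time (emit a)        N = 2
  time (e · f)         N = time f N + time e N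
  time (iftop x b e f) N = 1 + (time e N + time f N)
  time (for x b e)     N =
    -- Per round, test plus body: 1 + (2 + 3), 1 + 3, 1 + (3 + body + 3) and 1 + 1. The 1 before
    -- each product is the final failing test.
    (1 + N * 6) + ((1 + N * 4) + ((1 + N * (7 + time e N)) + (1 + N * 2)))

  store : Env → Word → Store
  store ρ o (rd v) = ρ v
  store ρ o scr    = []
  store ρ o out    = map inj₁ o

  -- A loop expects its own tapes to be empty and leaves them so; this demands it for all levels
  -- still available.
  Fresh : Fin 4 → Env → Set
  Fresh n ρ = ∀ i p → toℕ i < toℕ n → ρ (lvl i p) ≡ []

  Bounded : ℕ → Env → Set
  Bounded N ρ = ∀ v → length (ρ v) ≤ N

  -- Correctness and running time of compiled emitters

  length-reverse : ∀ (w : List Γ) → length (w ʳ++ []) ≡ length w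
  length-reverse w = trans (List.length-ʳ++ w) (ℕ.+-identityʳ _)

  private
    takeWhileᵇ++dropWhileᵇ : ∀ b (w : List Γ) → takeWhileᵇ b w ++ dropWhileᵇ b w ≡ w
    takeWhileᵇ++dropWhileᵇ b []      = refl
    takeWhileᵇ++dropWhileᵇ b (a ∷ w) with b a
    ... | true  = cong (a ∷_) (takeWhileᵇ++dropWhileᵇ b w)
    ... | false = refl

    length-takeWhileᵇ : ∀ b (w : List Γ) → length (takeWhileᵇ b w) ≤ length w
    length-takeWhileᵇ b []      = z≤n
    length-takeWhileᵇ b (a ∷ w) with b a
    ... | true  = s≤s (length-takeWhileᵇ b w)
    ... | false = z≤n

    backwards : (List Γ → Γ → List Γ → Word → Word) → List Γ → List Γ → Word → Word
    backwards f []      r o = o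
    backwards f (a ∷ l) r o = backwards f l (a ∷ r) (f l a r o)

    -- The machine takes the reversed word from its top. Moving one symbol of `w` at a time shows
    -- that the same bodies are composed as in `eachIn`, the last one first.
    backwards-ʳ++ : ∀ f l w o → backwards f (w ʳ++ l) [] o ≡ backwards f l w (eachIn f l w o)
    backwards-ʳ++ f l []      o = refl
    backwards-ʳ++ f l (a ∷ w) o = backwards-ʳ++ f (a ∷ l) w o

  module _ {j : Fin 3} {x : RVar} (x-off : T (offLevel j x)) where

    private
      ι : Fin 6 → Var
      ι 0F = rd x
      ι 1F = rd (lvl j prv)
      ι 2F = rd (lvl j cur)
      ι 3F = rd (lvl j nxt)
      ι 4F = scr
      ι 5F = out

      off : ∀ p → x ≢ lvl j p
      off p refl rewrite dec-true (j Fin.≟ j) refl = x-off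

      ι-injective : Injective _≡_ _≡_ ι
      ι-injective {0F} {0F} e = refl
      ι-injective {0F} {1F} refl = ⊥-elim (off prv refl)
      ι-injective {0F} {2F} refl = ⊥-elim (off cur refl)
      ι-injective {0F} {3F} refl = ⊥-elim (off nxt refl)
      ι-injective {1F} {0F} refl = ⊥-elim (off prv refl)
      ι-injective {2F} {0F} refl = ⊥-elim (off cur refl)
      ι-injective {3F} {0F} refl = ⊥-elim (off nxt refl)
      ι-injective {1F} {1F} e = refl
      ι-injective {2F} {2F} e = refl
      ι-injective {3F} {3F} e = refl
      ι-injective {4F} {4F} e = refl
      ι-injective {5F} {5F} e = refl
      ι-injective {0F} {4F} ()
      ι-injective {0F} {5F} ()
      ι-injective {1F} {2F} ()
      ι-injective {1F} {3F} ()
      ι-injective {1F} {4F} ()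
      ι-injective {1F} {5F} ()
      ι-injective {2F} {3F} ()
      ι-injective {2F} {4F} ()
      ι-injective {2F} {5F} ()
      ι-injective {3F} {4F} ()
      ι-injective {3F} {5F} ()
      ι-injective {4F} {5F} ()

    module _ {ρ : Env} {o₀ : Word} where

      open Slots ι ι-injective (store ρ o₀)

      copyWhile-triple : ∀ b w t u c r o →
        Triple (while (rd x) (on b) (copyTop (rd x) (rd (lvl j prv)) ⨾ transfer (rd x) scr))
          (slots (w ,, t ,, c ,, r ,, u ,, o ,, ⟨⟩))
          (slots (dropWhileᵇ b w ,, (takeWhileᵇ b w ʳ++ t) ,, c ,, r ,, (takeWhileᵇ b w ʳ++ u) ,, o ,, ⟨⟩))
          (1 + length (takeWhileᵇ b w) * 6)
      copyWhile-triple b [] t u c r o = while-done-slots 0F refl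
      copyWhile-triple b (a ∷ w) t u c r o with b a in eq
      ... | false = while-done-slots 0F eq
      ... | true  = weaken (ℕ.≤-reflexive (cong suc (ℕ.+-suc 5 _)))
        (while-step-slots 0F eq
          (copyTop-slots 0F 1F (λ ()) refl ⟫ transfer-slots 0F 4F (λ ()) refl)
          (copyWhile-triple b w (a ∷ t) (a ∷ u) c r o))

      restore-triple : ∀ u w t c r o →
        Triple (while scr some (transfer scr (rd x)))
          (slots (w ,, t ,, c ,, r ,, u ,, o ,, ⟨⟩))
          (slots ((u ʳ++ w) ,, t ,, c ,, r ,, [] ,, o ,, ⟨⟩))
          (1 + length u * 4)
      restore-triple []      w t c r o = while-done-slots 4F refl
      restore-triple (a ∷ u) w t c r o = weaken (ℕ.≤-reflexive (cong suc (ℕ.+-suc 3 _)))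
        (while-step-slots 4F refl (transfer-slots 4F 0F (λ ()) refl)
          (restore-triple u (a ∷ w) t c r o))

      clear-triple : ∀ r w t c u o →
        Triple (while (rd (lvl j nxt)) some (pop (rd (lvl j nxt))))
          (slots (w ,, t ,, c ,, r ,, u ,, o ,, ⟨⟩))
          (slots (w ,, t ,, c ,, [] ,, u ,, o ,, ⟨⟩))
          (1 + length r * 2)
      clear-triple []      w t c u o = while-done-slots 3F refl
      clear-triple (a ∷ r) w t c u o = weaken (ℕ.≤-reflexive (cong suc (ℕ.+-suc 1 _)))
        (while-step-slots 3F refl (pop-slots 3F refl) (clear-triple r w t c u o))

      module _ {p : Prog} {B : ℕ} (f : List Γ → Γ → List Γ → Word → Word)
               (N : ℕ) (w : List Γ)
               (body : ∀ l a r o → length (a ∷ l) + length r ≤ N →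
                 Triple p (slots (w ,, l ,, (a ∷ []) ,, r ,, [] ,, map inj₁ o ,, ⟨⟩))
                          (slots (w ,, l ,, (a ∷ []) ,, r ,, [] ,, map inj₁ (f l a r o) ,, ⟨⟩)) B)
               where

        -- The zipper moves but `length t + length r` is constant, which bounds the loop tapes in
        -- every round.
        body-triple : ∀ t r o → length t + length r ≤ N →
          Triple (while (rd (lvl j prv)) some
                   (transfer (rd (lvl j prv)) (rd (lvl j cur)) ⨾ p
                     ⨾ transfer (rd (lvl j cur)) (rd (lvl j nxt))))
            (slots (w ,, t ,, [] ,, r ,, [] ,, map inj₁ o ,, ⟨⟩))
            (slots (w ,, [] ,, [] ,, (t ʳ++ r) ,, [] ,, map inj₁ (backwards f t r o) ,, ⟨⟩))
            (1 + length t * (7 + B))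
        body-triple []      r o h = while-done-slots 1F refl
        body-triple (a ∷ t) r o h = weaken (ℕ.≤-reflexive arith)
          (while-step-slots 1F refl
            (transfer-slots 1F 2F (λ ()) refl ⟫ body t a r o h ⟫ transfer-slots 2F 3F (λ ()) refl)
            (body-triple t (a ∷ r) (f t a r o) (ℕ.≤-trans (ℕ.≤-reflexive (ℕ.+-suc (length t) (length r))) h)))
          where
          M = length t * (7 + B)
          arith : 1 + ((3 + (B + 3)) + (1 + M)) ≡ 1 + ((7 + B) + M)
          arith = cong suc (trans (ℕ.+-suc (3 + (B + 3)) M)
                    (cong (λ z → 4 + z + M) (ℕ.+-comm B 3)))

      store≗slots : Fresh (suc j) ρ → ∀ t c r o →
        store (setLevel ρ j (level t c r)) o ≗ slots (ρ x ,, t ,, c ,, r ,, [] ,, map inj₁ o ,, ⟨⟩)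
      store≗slots fresh t c r o = slots-unique in-slot elsewhere
        where
        σ : Env
        σ = setLevel ρ j (level t c r)

        σ-level : ∀ p → σ (lvl j p) ≡ level t c r p
        σ-level p rewrite dec-true (j Fin.≟ j) refl = refl

        σ-off : ∀ v → (∀ p → v ≢ lvl j p) → σ v ≡ ρ v
        σ-off inp       h = refl
        σ-off dd        h = refl
        σ-off bin       h = refl
        σ-off (lvl i p) h rewrite dec-false (i Fin.≟ j) (λ { refl → h p refl }) = refl

        in-slot : ∀ k → store σ o (ι k) ≡ lookup (ρ x ,, t ,, c ,, r ,, [] ,, map inj₁ o ,, ⟨⟩) k
        in-slot 0F = σ-off x off
        in-slot 1F = σ-level prv
        in-slot 2F = σ-level cur
        in-slot 3F = σ-level nxt
        in-slot 4F = refl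
        in-slot 5F = refl

        elsewhere : ∀ v → (∀ k → ι k ≢ v) → store σ o v ≡ store ρ o₀ v
        elsewhere (rd v) ∉ι = σ-off v (λ { prv refl → ∉ι 1F refl ; cur refl → ∉ι 2F refl
                                         ; nxt refl → ∉ι 3F refl })
        elsewhere scr ∉ι = refl
        elsewhere out ∉ι = ⊥-elim (∉ι 5F refl)

      setLevel-fresh : Fresh (suc j) ρ → ∀ v → setLevel ρ j (level [] [] []) v ≡ ρ v
      setLevel-fresh fresh inp = refl
      setLevel-fresh fresh dd  = refl
      setLevel-fresh fresh bin = refl
      setLevel-fresh fresh (lvl i p) with i Fin.≟ j
      ... | no _     = refl
      ... | yes refl = trans (empty p) (sym (fresh i p ℕ.≤-refl))
        where
        empty : ∀ p → level [] [] [] p ≡ []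
        empty prv = refl
        empty cur = refl
        empty nxt = refl

      initial≗slots : Fresh (suc j) ρ → ∀ o →
        store ρ o ≗ slots (ρ x ,, [] ,, [] ,, [] ,, [] ,, map inj₁ o ,, ⟨⟩)
      initial≗slots fresh o v = trans (store-cong v) (store≗slots fresh [] [] [] o v)
        where
        store-cong : store ρ o ≗ store (setLevel ρ j (level [] [] [])) o
        store-cong (rd v) = sym (setLevel-fresh fresh v)
        store-cong scr    = refl
        store-cong out    = refl

      -- All four stages run along a prefix of `ρ x` or a reversal of it, so the one bound `N`
      -- serves them all.
      for-triple : ∀ {b p B N} (f : List Γ → Γ → List Γ → Word → Word) →
        Fresh (suc j) ρ → length (ρ x) ≤ N →
        (∀ l a r o → length (a ∷ l) + length r ≤ N →
          let σ = setLevel ρ j (level l (a ∷ []) r) in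
          Triple p (store σ o) (store σ (f l a r o)) B) →
        Triple
          ( while (rd x) (on b) (copyTop (rd x) (rd (lvl j prv)) ⨾ transfer (rd x) scr)
          ⨾ while scr some (transfer scr (rd x))
          ⨾ while (rd (lvl j prv)) some
              (transfer (rd (lvl j prv)) (rd (lvl j cur)) ⨾ p
                ⨾ transfer (rd (lvl j cur)) (rd (lvl j nxt)))
          ⨾ while (rd (lvl j nxt)) some (pop (rd (lvl j nxt))))
          (store ρ o₀) (store ρ (eachIn f [] (takeWhileᵇ b (ρ x)) o₀))
          ((1 + N * 6) + ((1 + N * 4) + ((1 + N * (7 + B)) + (1 + N * 2))))
      for-triple {b} {p} {B} {N} f fresh len body =
        restate (initial≗slots fresh o₀) finish
          (  weaken (s≤s (ℕ.*-monoˡ-≤ 6 w≤N)) (copyWhile-triple b (ρ x) [] [] [] [] (map inj₁ o₀))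
          ⟫ weaken (s≤s (ℕ.*-monoˡ-≤ 4 w̄≤N)) (restore-triple w̄ (dropWhileᵇ b (ρ x)) w̄ [] [] _)
          ⟫ weaken (s≤s (ℕ.*-monoˡ-≤ (7 + B) w̄≤N))
              (restate (λ v → cong (λ z → slots (z ,, w̄ ,, [] ,, [] ,, [] ,, map inj₁ o₀ ,, ⟨⟩) v) whole)
                       (λ _ → refl)
                (body-triple f N (ρ x) body′ w̄ [] o₀ (ℕ.≤-trans (ℕ.≤-reflexive (ℕ.+-identityʳ _)) w̄≤N)))
          ⟫ weaken (s≤s (ℕ.*-monoˡ-≤ 2 w̄̄≤N)) (clear-triple (w̄ ʳ++ []) (ρ x) [] [] [] _))
        where
        w w̄ : List Γ
        w = takeWhileᵇ b (ρ x)
        w̄ = w ʳ++ []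
        w≤N : length w ≤ N
        w≤N = ℕ.≤-trans (length-takeWhileᵇ b (ρ x)) len
        w̄≤N : length w̄ ≤ N
        w̄≤N = ℕ.≤-trans (ℕ.≤-reflexive (length-reverse w)) w≤N
        w̄̄≤N : length (w̄ ʳ++ []) ≤ N
        w̄̄≤N = ℕ.≤-trans (ℕ.≤-reflexive (length-reverse w̄)) w̄≤N
        whole : w̄ ʳ++ dropWhileᵇ b (ρ x) ≡ ρ x
        whole = trans (List.ʳ++-ʳ++ w) (takeWhileᵇ++dropWhileᵇ b (ρ x))
        body′ : ∀ l a r o → length (a ∷ l) + length r ≤ N →
          Triple p (slots (ρ x ,, l ,, (a ∷ []) ,, r ,, [] ,, map inj₁ o ,, ⟨⟩))
                   (slots (ρ x ,, l ,, (a ∷ []) ,, r ,, [] ,, map inj₁ (f l a r o) ,, ⟨⟩)) B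
        body′ l a r o h = restate (λ v → sym (store≗slots fresh l (a ∷ []) r o v))
                                  (store≗slots fresh l (a ∷ []) r (f l a r o)) (body l a r o h)
        finish : slots (ρ x ,, [] ,, [] ,, [] ,, [] ,, map inj₁ (backwards f w̄ [] o₀) ,, ⟨⟩)
                 ≗ store ρ (eachIn f [] w o₀)
        finish v = trans (cong (λ z → slots (ρ x ,, [] ,, [] ,, [] ,, [] ,, map inj₁ z ,, ⟨⟩) v)
                               (backwards-ʳ++ f [] w o₀))
                         (sym (initial≗slots fresh (eachIn f [] w o₀) v))

  setLevel-Fresh : ∀ {j ρ f} → Fresh (suc j) ρ → Fresh (inject₁ j) (setLevel ρ j f)
  setLevel-Fresh {j} fresh i p i<j
    rewrite Fin.toℕ-inject₁ j
          | dec-false (i Fin.≟ j) (λ { refl → ℕ.<-irrefl refl i<j }) = fresh i p (ℕ.m<n⇒m<1+n i<j)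

  setLevel-Bounded : ∀ {j ρ l a r N} → Bounded N ρ → length (a ∷ l) + length r ≤ N →
                     Bounded N (setLevel ρ j (level l (a ∷ []) r))
  setLevel-Bounded bd h inp = bd inp
  setLevel-Bounded bd h dd  = bd dd
  setLevel-Bounded bd h bin = bd bin
  setLevel-Bounded {j} {l = l} {r = r} bd h (lvl i p) with i Fin.≟ j
  ... | no _  = bd (lvl i p)
  ... | yes _ = part p
    where
    part : ∀ p → length (level l (_ ∷ []) r p) ≤ _
    part prv = ℕ.≤-trans (ℕ.n≤1+n _) (ℕ.m+n≤o⇒m≤o (suc (length l)) h)
    part cur = ℕ.≤-trans (s≤s z≤n) h
    part nxt = ℕ.m+n≤o⇒n≤o (suc (length l)) h

  -- The time of a test charges both branches; the bound thus depends on `N` alone and not on the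
  -- tapes.
  compile-correct : ∀ {n} (e : Emitter n) {ρ o N} → Fresh n ρ → Bounded N ρ →
                    Triple (compile e) (store ρ o) (store ρ (⟦ e ⟧ ρ o)) (time e N)
  compile-correct (emit a) {ρ} {o} fr bd = restate (λ _ → refl) pushed (push-triple (inj₁ a))
    where
    pushed : store ρ o [ out ≔ map inj₁ (a ∷ o) ] ≗ store ρ (a ∷ o)
    pushed (rd v) = ≔-other (store ρ o) {u = rd v} (map inj₁ (a ∷ o)) λ ()
    pushed scr    = refl
    pushed out    = refl
  compile-correct (e · f) fr bd = compile-correct f fr bd ⟫ compile-correct e fr bd
  compile-correct (iftop x b e f) {ρ} fr bd with b (top (ρ x)) in eq
  ... | true  = weaken (s≤s (ℕ.m≤m+n _ _)) (ite-true eq (compile-correct e fr bd))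
  ... | false = weaken (s≤s (ℕ.m≤n+m _ (time e _))) (ite-false eq (compile-correct f fr bd))
  compile-correct (for {j} x {off} b e) {ρ} {N = N} fr bd =
    for-triple off _ fr (bd x)
      (λ l a r o h → compile-correct e (setLevel-Fresh {ρ = ρ} {f = level l (a ∷ []) r} fr) (setLevel-Bounded {ρ = ρ} bd h))

-- The instance built by the reduction

module Instances where

  open import Data.List.Base using (concat; tabulate; lookup)
  open import Data.Integer.Base using (+_)
  open import Data.Nat.Base using (_+_; _*_; _^_)

  -- One state for each symbol of the encoded list; the number is attached to
  -- its first symbol.
  block : ℕ → List ℕ
  block c = c ∷ replicate (length (bits c)) 0

  weights : ∀ {n} → Vector ℕ n → List ℕ
  weights c = concat (tabulate (block ∘ c))

  natℚᵘ : ℕ → ℚᵘ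
  natℚᵘ x = mkℚᵘ (+ x) 0

  itemCost : ℕ → ℕ
  itemCost zero    = 0
  itemCost (suc c) = 1 + suc c * 2 * 2

  indicator : ∀ {n} → Fin n → Fin n → ℚᵘ
  indicator t s = natℚᵘ (if does (s Fin.≟ t) then 1 else 0)

  -- State 0 absorbs, state 1 pays for the actions, and action 2 + j moves
  -- state 2 + j to state 0; t determines the discount factor t / (1 + t).
  module Blind (m t : ℕ) (w : Fin m → ℕ) where

    states : ℕ
    states = 2 + m

    stepCost : Fin states → Fin states → ℕ
    stepCost 0F            a             = 1
    stepCost 1F            (suc (suc _)) = 1 + t
    stepCost 1F            _             = 1
    stepCost (suc (suc j)) a             = itemCost (w j)

    next : Fin states → Fin states → Fin states
    next 0F            a = 0F
    next 1F            a = 1F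
    next (suc (suc j)) a = if does (a Fin.≟ suc (suc j)) then 0F else suc (suc j)

    private
      sum-uniform : ∀ k n → sumℚᵘ {n} (λ _ → mkℚᵘ (+ 1) k) ℚᵘ.≃ mkℚᵘ (+ n) k
      sum-uniform k zero    = *≡* refl
      sum-uniform k (suc n) = ℚᵘ.≃-trans (ℚᵘ.+-congʳ (mkℚᵘ (+ 1) k) (sum-uniform k n))
                                (*≡* (ℤ-identity (+ n) (+ suc k)))
        where
        open import Data.Integer.Tactic.RingSolver using (solve-∀)
        ℤ-identity : ∀ x y → (+ 1 ℤ.* y ℤ.+ x ℤ.* y) ℤ.* y ≡ (+ 1 ℤ.+ x) ℤ.* (y ℤ.* y)
        ℤ-identity = solve-∀

      sum-zero : ∀ n → sumℚᵘ {n} (λ _ → natℚᵘ 0) ℚᵘ.≃ 0ℚᵘ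
      sum-zero zero    = *≡* refl
      sum-zero (suc n) = ℚᵘ.≃-trans (ℚᵘ.+-congʳ 0ℚᵘ (sum-zero n)) (*≡* refl)

      sum-indicator : ∀ {n} (t : Fin n) → sumℚᵘ (indicator t) ℚᵘ.≃ 1ℚᵘ
      sum-indicator {suc n} zero    = ℚᵘ.≃-trans (ℚᵘ.+-congʳ 1ℚᵘ (sum-zero n)) (*≡* refl)
      sum-indicator {suc n} (suc t) = ℚᵘ.≃-trans (ℚᵘ.+-congʳ 0ℚᵘ (sum-indicator t)) (*≡* refl)

      natℚᵘ≥0 : ∀ x → 0ℚᵘ ℚᵘ.≤ natℚᵘ x
      natℚᵘ≥0 x = ℚᵘ.nonNegative⁻¹ (natℚᵘ x)

    blindMDP : MDP
    blindMDP = record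
      { n    = states
      ; k    = states
      ; n>0  = s≤s z≤n
      ; k>0  = s≤s z≤n
      ; γ    = mkℚᵘ (+ t) t
      ; 0≤γ  = ℚᵘ.nonNegative⁻¹ (mkℚᵘ (+ t) t)
      ; γ<1  = *<* (subst₂ ℤ._<_ (sym (ℤ.*-identityʳ (+ t))) (sym (ℤ.*-identityˡ (+ suc t)))
                     (ℤ.+<+ (ℕ.n<1+n t)))
      ; C    = λ s a → natℚᵘ (stepCost s a)
      ; μ    = λ _ → mkℚᵘ (+ 1) (suc m)
      ; μ≥0  = λ _ → ℚᵘ.nonNegative⁻¹ (mkℚᵘ (+ 1) (suc m))
      ; ∑μ≃1 = ℚᵘ.≃-trans (sum-uniform (suc m) states)
                 (*≡* (ℤ.*-comm (+ states) (+ 1)))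
      ; p    = λ s a → indicator (next s a)
      ; p≥0  = λ s a s̄ → natℚᵘ≥0 (if does (s̄ Fin.≟ next s a) then 1 else 0)
      ; ∑p≃1 = λ s a → sum-indicator (next s a)
      }

  -- Square roots and costs are both nonnegative, so for negative `d` a negative threshold gives the
  -- same answer, no.
  threshold : ℕ → ℤ → ℚᵘ
  threshold m (+ d)    = mkℚᵘ (+ ((1 + d * 2) * 2)) (suc m)
  threshold m -[1+ _ ] = mkℚᵘ -[1+ 0 ] (suc m)

  module _ (g : List ℕ) where

    size : ℕ
    size = 2 + length g

    -- With the exponent 1 + K, both T and 1 + T consist of one digit at each end and a run of
    -- exactly K zeros, which one loop over the marked input writes.
    speed : ℕ
    speed = 2 ^ (1 + size)

    open Blind (length g) speed (lookup g) public using () renaming (stepCost to costℕ; next to target; blindMDP to listMDP)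

  reduction : SqrtSumInstance → BlindPolicyInstance
  reduction I = record { mdp = listMDP (weights c) ; r = threshold (length (weights c)) d }
    where open SqrtSumInstance I

  -- The weights are bounded by a power of 2

  value : Word → ℕ
  value (0b ∷ w) = value w + value w
  value (1b ∷ w) = suc (value w + value w)
  value _        = 0

  value-increment : ∀ w → value (increment w) ≡ suc (value w)
  value-increment []          = refl
  value-increment (0b ∷ w)    = refl
  value-increment (1b ∷ w)    rewrite value-increment w = cong suc (ℕ.+-suc (value w) (value w))
  value-increment (minus ∷ w) = refl
  value-increment (sep ∷ w)   = refl

  value-bits : ∀ n → value (bits n) ≡ n
  value-bits zero    = refl
  value-bits (suc n) = trans (value-increment (bits n)) (cong suc (value-bits n))

  n+n≡2*n : ∀ n → n + n ≡ 2 * n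
  n+n≡2*n n = cong (n ℕ.+_) (sym (ℕ.+-identityʳ n))

  value< : ∀ w → value w ℕ.< 2 ^ length w
  value< []          = s≤s z≤n
  value< (0b ∷ w)    = ℕ.≤-trans (ℕ.+-mono-≤ (value< w) (ℕ.<⇒≤ (value< w))) (ℕ.≤-reflexive (n+n≡2*n (2 ^ length w)))
  value< (1b ∷ w)    = ℕ.≤-trans (ℕ.≤-reflexive (cong suc (sym (ℕ.+-suc (value w) (value w)))))
    (ℕ.≤-trans (ℕ.+-mono-≤ (value< w) (value< w)) (ℕ.≤-reflexive (n+n≡2*n (2 ^ length w))))
  value< (minus ∷ w) = ℕ.m^n>0 2 (suc (length w))
  value< (sep ∷ w)   = ℕ.m^n>0 2 (suc (length w))

  total : List ℕ → ℕ
  total = List.foldr _+_ 0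

  total-++ : ∀ l l′ → total (l ++ l′) ≡ total l + total l′
  total-++ []      l′ = refl
  total-++ (a ∷ l) l′ = trans (cong (a ℕ.+_) (total-++ l l′)) (sym (ℕ.+-assoc a (total l) (total l′)))

  total-block : ∀ c → total (block c) ≡ c
  total-block c = trans (cong (c ℕ.+_) (padding (length (bits c)))) (ℕ.+-identityʳ c)
    where
    padding : ∀ k → total (replicate k 0) ≡ 0
    padding zero    = refl
    padding (suc k) = padding k

  -- A number of k digits is below 2^k and has a block of k + 1 entries. The additional entry, for
  -- the separator, supplies the 2 in a + b ≤ 2 a b, valid for a, b ≥ 1.
  total-weights : ∀ {n} (c : Vector ℕ n) → total (weights c) ℕ.≤ 2 ^ length (weights c)
  total-weights {zero}  c = z≤n
  total-weights {suc n} c = begin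
    total (l₁ ++ l₂)                ≡⟨ trans (total-++ l₁ l₂) (cong (_+ total l₂) (total-block (c zero))) ⟩
    c zero + total l₂             ≤⟨ ℕ.+-mono-≤ c≤a (total-weights (c ∘ suc)) ⟩
    a + b                         ≤⟨ ℕ.+-mono-≤ (ℕ.m≤m*n a b) (ℕ.m≤n*m b a) ⟩
    a * b + a * b             ≡⟨ trans (n+n≡2*n (a * b)) (sym (ℕ.*-assoc 2 a b)) ⟩
    2 ^ suc k * 2 ^ length l₂     ≡⟨ ℕ.^-distribˡ-+-* 2 (suc k) (length l₂) ⟨
    2 ^ (suc k + length l₂)       ≡⟨ cong (2 ^_) (trans (List.length-++ l₁) (cong (λ k → suc k + length l₂) (List.length-replicate k))) ⟨
    2 ^ length (l₁ ++ l₂)           ∎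
    where
    open ℕ.≤-Reasoning
    l₁ l₂ : List ℕ
    l₁ = block (c zero)
    l₂ = weights (c ∘ suc)
    k a b : ℕ
    k = length (bits (c zero))
    a = 2 ^ k
    b = 2 ^ length l₂
    instance
      _ = ℕ.m^n≢0 2 k
      _ = ℕ.m^n≢0 2 (length l₂)
    c≤a : c zero ℕ.≤ a
    c≤a = ℕ.<⇒≤ (subst (ℕ._< a) (value-bits (c zero)) (value< (bits (c zero))))

-- Emitters for the encoded instance

module Emission where

  open Programs
  open Instances
  open import Data.Bool.Base using (T; not)
  open import Data.Fin.Base using (toℕ; inject₁)
  open import Data.Integer.Base using (+_)
  open import Data.List.Base using (map; concat; tabulate; lookup; takeWhileᵇ; _ʳ++_)
  open import Data.List.Relation.Unary.All as All using (All; []; _∷_)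
  open import Data.Nat.Base using (_+_; _*_; _^_; _≤_; _<_)
  open import Data.Vec.Base as Vec using () renaming ([] to ⟨⟩; _∷_ to infixr 5 _,,_)

  -- Doubling prepends a 0 except at zero, whose expansion is the empty word.
  bits-even : ∀ n → bits (suc n * 2) ≡ 0b ∷ bits (suc n)
  bits-even zero    = refl
  bits-even (suc n) = cong (increment ∘ increment) (bits-even n)

  bits-odd : ∀ n → bits (1 + n * 2) ≡ 1b ∷ bits n
  bits-odd zero    = refl
  bits-odd (suc n) = cong increment (bits-even n)

  bits-2^ : ∀ k → bits (2 ^ k) ≡ replicate k 0b ++ 1b ∷ []
  bits-2^ zero    = refl
  bits-2^ (suc k) = trans (cong bits (ℕ.*-comm 2 (2 ^ k))) (trans (even (2 ^ k) (ℕ.m^n>0 2 k))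
                      (cong (0b ∷_) (bits-2^ k)))
    where
    even : ∀ n → 0 < n → bits (n * 2) ≡ 0b ∷ bits n
    even (suc n) _ = bits-even n

  bits-1+2^ : ∀ k → bits (1 + 2 ^ suc k) ≡ 1b ∷ replicate k 0b ++ 1b ∷ []
  bits-1+2^ k = trans (cong (bits ∘ suc) (ℕ.*-comm 2 (2 ^ k)))
                  (trans (bits-odd (2 ^ k)) (cong (1b ∷_) (bits-2^ k)))

  isDigit is0 is1 isMinus : Symbol → Bool
  isDigit 0b = true
  isDigit 1b = true
  isDigit _  = false
  is0 0b = true
  is0 _  = false
  is1 1b = true
  is1 _  = false
  isMinus minus = true
  isMinus _     = false

  Digits : Word → Set
  Digits = All (T ∘ isDigit)

  increment-digits : ∀ {w} → Digits w → Digits (increment w)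
  increment-digits []                 = _ ∷ []
  increment-digits {0b ∷ w} (_ ∷ ds)  = _ ∷ ds
  increment-digits {1b ∷ w} (_ ∷ ds)  = _ ∷ increment-digits ds

  bits-digits : ∀ n → Digits (bits n)
  bits-digits zero    = []
  bits-digits (suc n) = increment-digits (bits-digits n)

  bits-nonempty : ∀ n → ∃[ b ] ∃[ w ] bits (suc n) ≡ b ∷ w
  bits-nonempty n = nonempty (bits n)
    where
    nonempty : ∀ w → ∃[ b ] ∃[ w′ ] increment w ≡ b ∷ w′
    nonempty []          = _ , _ , refl
    nonempty (0b ∷ _)    = _ , _ , refl
    nonempty (1b ∷ _)    = _ , _ , refl
    nonempty (minus ∷ _) = _ , _ , refl
    nonempty (sep ∷ _)   = _ , _ , refl

  -- Marks put in front of the input, so that loops over it pass the states 0 and 1 as well.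
  pattern sink = inj₂ true
  pattern lin  = inj₂ false

  all : Γ → Bool
  all = const true

  symbolic : (Symbol → Bool) → Γ → Bool
  symbolic b = [ b , const false ]′

  isSink : Γ → Bool
  isSink = [ const false , (λ s → s) ]′

  isLin : Γ → Bool
  isLin = [ const false , not ]′

  digit : ∀ {n} → Fin 3 → Emitter n
  digit j = iftop (lvl j cur) (on (symbolic is1)) (emit 1b) (emit 0b)

  number : ∀ {j} → Emitter (suc j)
  number {j} = for bin all (digit j) · emit sep

  -- The end of a numerator and the denominator 1. As 0 has no digits, this alone already spells the
  -- rational 0.
  over1 zeroE oneE : ∀ {n} → Emitter n
  over1 = emit sep · emit 1b · emit sep
  zeroE = over1
  oneE  = emit 1b · over1

  zeros : ∀ {j} → Emitter (suc j)
  zeros = for inp all (emit 0b)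

  -- T / (1 + T): the two expansions differ in their first digit only.
  discountE : Emitter 3F
  discountE = emit 0b · zeros · emit 1b · emit sep · emit 1b · zeros · emit 1b · emit sep

  -- The digits of c start at a digit that follows no digit; 1 0 in front of them
  -- makes them the digits of 1 + 4 c.
  costE : Emitter 1F
  costE =
    iftop (lvl 2F cur) (on (symbolic (const true)))
      (iftop (lvl 2F cur) (on (symbolic isDigit))
        (iftop (lvl 2F prv) (on (symbolic isDigit))
          zeroE
          (emit 1b · emit 0b · digit 2F · for (lvl 2F nxt) (symbolic isDigit) (digit 0F) · over1))
        zeroE)
      (iftop (lvl 2F cur) (on isLin)
        (iftop (lvl 1F cur) (on (symbolic (const true)))
          (emit 1b · zeros · emit 1b · over1)
          oneE)
        oneE)

  -- The unit vector at the current state of level 2; the tapes on both sides of its symbol supply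
  -- the right numbers of zeros.
  rowE : Emitter 1F
  rowE = for (lvl 2F prv) all zeroE · oneE · for (lvl 2F nxt) all zeroE

  sinkRowE : Emitter 2F
  sinkRowE = for inp all (iftop (lvl 1F cur) (on isSink) oneE zeroE)

  -- Actions are enumerated by splitting the input at the state itself, which singles out the action
  -- that leaves it. The marks stand for absorbing states, whose rows are all alike.
  transitionE : Emitter 2F
  transitionE =
    iftop (lvl 2F cur) (on (symbolic (const true)))
      (for (lvl 2F prv) all rowE · sinkRowE · for (lvl 2F nxt) all rowE)
      (for inp all rowE)

  -- The digits 0 1 in front of those of `d` yield 2 (1 + 2 d).
  thresholdE : Emitter 3F
  thresholdE =
    iftop dd (on (symbolic isMinus))
      (emit minus · emit 1b · emit sep)
      (emit 0b · emit 1b · for dd all (digit 2F) · emit sep)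
    · number

  instanceE : Emitter 3F
  instanceE =
      number · number · discountE
    · for inp all (for inp all costE)
    · for inp all (emit 1b · emit sep · number)
    · for inp all transitionE
    · thresholdE

  -- The words that the emitters write

  if-true : ∀ {b} {u v : Word} → b ≡ true → (if b then u else v) ≡ u
  if-true refl = refl

  if-false : ∀ {b} {u v : Word} → b ≡ false → (if b then u else v) ≡ v
  if-false refl = refl

  reps : ℕ → Word → Word
  reps k e = concat (replicate k e)

  takeWhileᵇ-all : ∀ w → takeWhileᵇ all w ≡ w
  takeWhileᵇ-all []      = refl
  takeWhileᵇ-all (a ∷ w) = cong (a ∷_) (takeWhileᵇ-all w)

  eachIn-reps : ∀ {f} e → (∀ l a r o → f l a r o ≡ e ++ o) → ∀ l w o →
                eachIn f l w o ≡ reps (length w) e ++ o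
  eachIn-reps e h l []      o = refl
  eachIn-reps e h l (a ∷ w) o =
    trans (h l a w _) (trans (cong (e ++_) (eachIn-reps e h (a ∷ l) w o)) (sym (List.++-assoc e _ o)))

  for-all : ∀ {j x off} (e : Emitter (inject₁ j)) ρ o →
    ⟦ for {j} x {off} all e ⟧ ρ o
      ≡ eachIn (λ l a r → ⟦ e ⟧ (setLevel ρ j (level l (a ∷ []) r))) [] (ρ x) o
  for-all {x = x} e ρ o = cong (λ w → eachIn _ [] w o) (takeWhileᵇ-all (ρ x))

  for-reps : ∀ {j x off ρ} (e : Emitter (inject₁ j)) u →
    (∀ l a r o → ⟦ e ⟧ (setLevel ρ j (level l (a ∷ []) r)) o ≡ u ++ o) → ∀ o →
    ⟦ for {j} x {off} all e ⟧ ρ o ≡ reps (length (ρ x)) u ++ o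
  for-reps {j} {x} {off} {ρ} e u h o = trans (for-all {j} {x} {off} e ρ o) (eachIn-reps u h [] (ρ x) o)

  reps-single : ∀ k (a : Symbol) → reps k (a ∷ []) ≡ replicate k a
  reps-single zero    a = refl
  reps-single (suc k) a = cong (a ∷_) (reps-single k a)

  zeros-correct : ∀ {j} ρ o → ⟦ zeros {j} ⟧ ρ o ≡ replicate (length (ρ inp)) 0b ++ o
  zeros-correct {j} ρ o = trans (for-reps {j} {inp} {_} {ρ} (emit 0b) (0b ∷ []) (λ _ _ _ _ → refl) o)
                            (cong (_++ o) (reps-single (length (ρ inp)) 0b))

  digit-correct : ∀ {n} j {ρ a o} → T (isDigit a) → ρ (lvl j cur) ≡ inj₁ a ∷ [] →
                  ⟦ digit {n} j ⟧ ρ o ≡ a ∷ o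
  digit-correct j {a = 0b} d e rewrite e = refl
  digit-correct j {a = 1b} d e rewrite e = refl

  setLevel-cur : ∀ ρ j l x r → setLevel ρ j (level l x r) (lvl j cur) ≡ x
  setLevel-cur ρ j l x r with j Fin.≟ j
  ... | yes _   = refl
  ... | no  j≢j = ⊥-elim (j≢j refl)

  eachIn-digits : ∀ {n} j ρ l {w} o → Digits w →
    eachIn (λ l a r → ⟦ digit {n} j ⟧ (setLevel ρ j (level l (a ∷ []) r))) l (map inj₁ w) o ≡ w ++ o
  eachIn-digits j ρ l o []       = refl
  eachIn-digits {n} j ρ l {a ∷ w} o (d ∷ ds) =
    trans (digit-correct {n} j {setLevel ρ j (level l (inj₁ a ∷ []) (map inj₁ w))} d
             (setLevel-cur ρ j l (inj₁ a ∷ []) (map inj₁ w)))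
          (cong (a ∷_) (eachIn-digits {n} j ρ (inj₁ a ∷ l) o ds))

  for-digits : ∀ {j x off ρ w} → ρ x ≡ map inj₁ w → Digits w → ∀ o →
    ⟦ for {j} x {off} all (digit j) ⟧ ρ o ≡ w ++ o
  for-digits {j} {x} {off} {ρ} e ds o =
    trans (for-all {j} {x} {off} (digit j) ρ o)
      (trans (cong (λ w → eachIn _ [] w o) e) (eachIn-digits {inject₁ j} j ρ [] o ds))

  number-correct : ∀ {j ρ} n → ρ bin ≡ map inj₁ (bits n) → ∀ o →
                   ⟦ number {j} ⟧ ρ o ≡ encodeℕ n ++ o
  number-correct {j} {ρ} n e o = trans (for-digits {j} {bin} {_} {ρ} e (bits-digits n) (sep ∷ o))
                               (sym (List.++-assoc (bits n) (sep ∷ []) o))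

  concat-tabulate-const : ∀ n (e : Word) → concat (tabulate {n = n} (λ _ → e)) ≡ reps n e
  concat-tabulate-const zero    e = refl
  concat-tabulate-const (suc n) e = cong (e ++_) (concat-tabulate-const n e)

  concat-tabulate-cong : ∀ {n} {f g : Fin n → Word} → f ≗ g → concat (tabulate f) ≡ concat (tabulate g)
  concat-tabulate-cong h = cong concat (List.tabulate-cong h)

  -- `y` is the number of entries after `t`, given by an equation so that no subtraction occurs and
  -- tape lengths can take its place.
  concat-tabulate-point : ∀ {n} (t : Fin n) y {a b : Word} {f : Fin n → Word} →
    (∀ i → f i ≡ (if does (i Fin.≟ t) then a else b)) → y + suc (toℕ t) ≡ n →
    concat (tabulate f) ≡ reps (toℕ t) b ++ a ++ reps y b
  concat-tabulate-point {suc n} zero y {a} {b} h e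
    with refl ← ℕ.suc-injective (trans (ℕ.+-comm 1 y) e) =
    cong₂ _++_ (h zero) (trans (concat-tabulate-cong (h ∘ suc)) (concat-tabulate-const y b))
  concat-tabulate-point {suc n} (suc t) y {b = b} h e =
    trans (cong₂ _++_ (h zero) (concat-tabulate-point t y (h ∘ suc)
            (ℕ.suc-injective (trans (sym (ℕ.+-suc y (suc (toℕ t)))) e))))
          (sym (List.++-assoc b _ _))

  length-symbols : ∀ (w : Word) → length {A = Γ} (map inj₁ w) ≡ length w
  length-symbols = List.length-map inj₁

  -- For output that depends only on how many symbols lie before and after. The summand `length l`
  -- accounts for symbols passed before `w`; in the use below these are the two marks.
  eachIn-tabulate : ∀ {F m} (Q : ℕ → ℕ → Word) (w : Word) l (f : Fin m → Word) →
    (∀ l a r o → F l (inj₁ a) r o ≡ Q (length l) (length r) ++ o) → length w ≡ m →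
    (∀ j y → y + suc (toℕ j) ≡ m → Q (toℕ j + length l) y ≡ f j) → ∀ o →
    eachIn F l (map inj₁ w) o ≡ concat (tabulate f) ++ o
  eachIn-tabulate Q []      l f h refl hf o = refl
  eachIn-tabulate {F} Q (a ∷ w) l f h refl hf o = begin
    F l (inj₁ a) (map inj₁ w) (eachIn F (inj₁ a ∷ l) (map inj₁ w) o)
      ≡⟨ h l a (map inj₁ w) _ ⟩
    Q (length l) (length (map inj₁ w)) ++ eachIn F (inj₁ a ∷ l) (map inj₁ w) o
      ≡⟨ cong₂ _++_ (trans (cong (Q (length l)) (length-symbols w)) (hf zero (length w) (ℕ.+-comm (length w) 1)))
           (eachIn-tabulate Q w (inj₁ a ∷ l) (f ∘ suc) h refl
             (λ j y e → trans (cong (λ x → Q x y) (ℕ.+-suc (toℕ j) (length l)))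
                              (hf (suc j) y (trans (ℕ.+-suc y (suc (toℕ j))) (cong suc e)))) o) ⟩
    f zero ++ concat (tabulate (f ∘ suc)) ++ o
      ≡⟨ List.++-assoc (f zero) _ o ⟨
    concat (tabulate f) ++ o ∎
    where open ≡-Reasoning

  Z One : Word
  Z   = encodeℚᵘ (natℚᵘ 0)
  One = encodeℚᵘ (natℚᵘ 1)

  AfterDigit : Bool → List Γ → Set
  AfterDigit b l = on (symbolic isDigit) (top l) ≡ b

  digit-top : ∀ {a l} → T (isDigit a) → AfterDigit true (inj₁ a ∷ l)
  digit-top {0b} _ = refl
  digit-top {1b} _ = refl

  -- A loop over an encoded list recognizes the first digit of a number by the
  -- symbol before it.
  module _ {F : List Γ → Γ → List Γ → Word → Word} {G : ℕ → Word}
    (at-sep   : ∀ l r o → F l (inj₁ sep) r o ≡ G 0 ++ o)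
    (at-inner : ∀ {a} l r → T (isDigit a) → AfterDigit true l → ∀ o → F l (inj₁ a) r o ≡ G 0 ++ o)
    (at-first : ∀ {a w} c l rest → bits (suc c) ≡ a ∷ w → AfterDigit false l → ∀ o →
                F l (inj₁ a) (map inj₁ (w ++ sep ∷ rest)) o ≡ G (suc c) ++ o)
    where

    -- After its first digit a number emits `G 0` throughout, including its separator. What precedes
    -- the next number is left open as `l′`: the separator on top already shows that it is no digit.
    block-tail : ∀ {w} l rest → Digits w → AfterDigit true l → ∀ o → ∃[ l′ ]
      eachIn F l (map inj₁ (w ++ sep ∷ rest)) o
        ≡ concat (map G (replicate (suc (length w)) 0)) ++ eachIn F (inj₁ sep ∷ l′) (map inj₁ rest) o
    block-tail l rest [] h o =
      l , trans (at-sep l _ _) (cong (_++ _) (sym (List.++-identityʳ (G 0))))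
    block-tail {a ∷ w} l rest (d ∷ ds) h o with block-tail (inj₁ a ∷ l) rest ds (digit-top {a} {l} d) o
    ... | l′ , eq = l′ , trans (at-inner l _ d h _)
                           (trans (cong (G 0 ++_) eq) (sym (List.++-assoc (G 0) _ _)))

    block-emitted : ∀ c l rest → AfterDigit false l → ∀ o → ∃[ l′ ]
      eachIn F l (map inj₁ (encodeℕ c ++ rest)) o
        ≡ concat (map G (block c)) ++ eachIn F (inj₁ sep ∷ l′) (map inj₁ rest) o
    -- The number 0 is encoded by its separator alone, which is then the whole block.
    block-emitted zero l rest h o =
      l , trans (at-sep l _ _) (cong (_++ _) (sym (List.++-identityʳ (G 0))))
    block-emitted (suc c) l rest h o with bits-nonempty c
    ... | a , w , eq with subst Digits eq (bits-digits (suc c))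
    ... | d ∷ ds with block-tail (inj₁ a ∷ l) rest ds (digit-top {a} {l} d) o
    ... | l′ , eq′ = l′ , (begin
      eachIn F l (map inj₁ ((bits (suc c) ++ sep ∷ []) ++ rest)) o
        ≡⟨ cong (λ u → eachIn F l (map inj₁ u) o) (List.++-assoc (bits (suc c)) (sep ∷ []) rest) ⟩
      eachIn F l (map inj₁ (bits (suc c) ++ sep ∷ rest)) o
        ≡⟨ cong (λ u → eachIn F l (map inj₁ (u ++ sep ∷ rest)) o) eq ⟩
      F l (inj₁ a) (map inj₁ (w ++ sep ∷ rest)) _
        ≡⟨ at-first c l rest eq h _ ⟩
      G (suc c) ++ eachIn F (inj₁ a ∷ l) (map inj₁ (w ++ sep ∷ rest)) o
        ≡⟨ cong (G (suc c) ++_) eq′ ⟩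
      G (suc c) ++ concat (map G (replicate (suc (length w)) 0)) ++ eachIn F (inj₁ sep ∷ l′) (map inj₁ rest) o
        ≡⟨ List.++-assoc (G (suc c)) _ _ ⟨
      concat (map G (suc c ∷ replicate (suc (length w)) 0)) ++ eachIn F (inj₁ sep ∷ l′) (map inj₁ rest) o
        ≡⟨ cong (λ k → concat (map G (suc c ∷ replicate (length k) 0)) ++ eachIn F (inj₁ sep ∷ l′) (map inj₁ rest) o) eq ⟨
      concat (map G (block (suc c))) ++ eachIn F (inj₁ sep ∷ l′) (map inj₁ rest) o ∎)
      where open ≡-Reasoning

    weights-emitted : ∀ {n} (c : Vector ℕ n) l → AfterDigit false l → ∀ o →
      eachIn F l (map inj₁ (encodeVector encodeℕ c)) o ≡ concat (map G (weights c)) ++ o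
    weights-emitted {zero}  c l h o = refl
    weights-emitted {suc n} c l h o with block-emitted (c zero) l (encodeVector encodeℕ (c ∘ suc)) h o
    ... | l′ , eq = begin
      eachIn F l (map inj₁ (encodeVector encodeℕ c)) o
        ≡⟨ eq ⟩
      concat (map G (block (c zero))) ++ eachIn F (inj₁ sep ∷ l′) (map inj₁ (encodeVector encodeℕ (c ∘ suc))) o
        ≡⟨ cong (concat (map G (block (c zero))) ++_) (weights-emitted (c ∘ suc) (inj₁ sep ∷ l′) refl o) ⟩
      concat (map G (block (c zero))) ++ concat (map G (weights (c ∘ suc))) ++ o
        ≡⟨ List.++-assoc (concat (map G (block (c zero)))) _ o ⟨
      (concat (map G (block (c zero))) ++ concat (map G (weights (c ∘ suc)))) ++ o
        ≡⟨ cong (_++ o) (List.concat-++ (map G (block (c zero))) _) ⟩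
      concat (map G (block (c zero)) ++ map G (weights (c ∘ suc))) ++ o
        ≡⟨ cong (λ u → concat u ++ o) (List.map-++ G (block (c zero)) (weights (c ∘ suc))) ⟨
      concat (map G (weights c)) ++ o ∎
      where open ≡-Reasoning

  module _ {D wc : Word} {g : List ℕ} (length-wc : length wc ≡ length g) where

    private
      K : ℕ
      K = size g

    environment : Env
    environment inp       = sink ∷ lin ∷ map inj₁ wc
    environment dd        = map inj₁ D
    environment bin       = map inj₁ (bits K)
    environment (lvl _ _) = []

    private
      ρ : Env
      ρ = environment

      at : Fin 3 → List Γ → Γ → List Γ → Env → Env
      at j l a r σ = setLevel σ j (level l (a ∷ []) r)

      length-inp : length (ρ inp) ≡ K
      length-inp = cong (λ m → suc (suc m)) (trans (length-symbols wc) length-wc)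

    discount-correct : ∀ o → ⟦ discountE ⟧ ρ o ≡ encodeℚᵘ (mkℚᵘ (+ speed g) (speed g)) ++ o
    discount-correct o = begin
      0b ∷ ⟦ zeros {2F} ⟧ ρ (1b ∷ sep ∷ 1b ∷ ⟦ zeros {2F} ⟧ ρ (1b ∷ sep ∷ o))
        ≡⟨ cong (0b ∷_) (zeros-correct {2F} ρ _) ⟩
      0b ∷ replicate (length (ρ inp)) 0b ++ 1b ∷ sep ∷ 1b ∷ ⟦ zeros {2F} ⟧ ρ (1b ∷ sep ∷ o)
        ≡⟨ cong (λ u → 0b ∷ replicate (length (ρ inp)) 0b ++ 1b ∷ sep ∷ 1b ∷ u) (zeros-correct {2F} ρ _) ⟩
      0b ∷ replicate (length (ρ inp)) 0b ++ 1b ∷ sep ∷ 1b ∷ replicate (length (ρ inp)) 0b ++ 1b ∷ sep ∷ o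
        ≡⟨ cong (λ k → 0b ∷ replicate k 0b ++ 1b ∷ sep ∷ 1b ∷ replicate k 0b ++ 1b ∷ sep ∷ o) length-inp ⟩
      0b ∷ 0ᴷ ++ 1b ∷ sep ∷ 1b ∷ 0ᴷ ++ 1b ∷ sep ∷ o
        ≡⟨ cong (λ u → 0b ∷ 0ᴷ ++ 1b ∷ sep ∷ u) (sym (last (1b ∷ 0ᴷ) o)) ⟩
      0b ∷ 0ᴷ ++ 1b ∷ sep ∷ ((1b ∷ 0ᴷ ++ 1b ∷ []) ++ sep ∷ []) ++ o
        ≡⟨ last (0b ∷ 0ᴷ) _ ⟨
      ((0b ∷ 0ᴷ ++ 1b ∷ []) ++ sep ∷ []) ++ ((1b ∷ 0ᴷ ++ 1b ∷ []) ++ sep ∷ []) ++ o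
        ≡⟨ List.++-assoc ((0b ∷ 0ᴷ ++ 1b ∷ []) ++ sep ∷ []) _ o ⟨
      (((0b ∷ 0ᴷ ++ 1b ∷ []) ++ sep ∷ []) ++ ((1b ∷ 0ᴷ ++ 1b ∷ []) ++ sep ∷ [])) ++ o
        ≡⟨ cong₂ (λ u v → ((u ++ sep ∷ []) ++ (v ++ sep ∷ [])) ++ o) (bits-2^ (suc K)) (bits-1+2^ K) ⟨
      encodeℚᵘ (mkℚᵘ (+ speed g) (speed g)) ++ o ∎
      where
      open ≡-Reasoning
      0ᴷ : Word
      0ᴷ = replicate K 0b
      last : ∀ u o → ((u ++ 1b ∷ []) ++ sep ∷ []) ++ o ≡ u ++ 1b ∷ sep ∷ o
      last u o = trans (cong (_++ o) (List.++-assoc u (1b ∷ []) (sep ∷ [])))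
                       (List.++-assoc u (1b ∷ sep ∷ []) o)

    uniform-correct : ∀ o →
      ⟦ for inp all (emit 1b · emit sep · number {1F}) ⟧ ρ o
        ≡ encodeVector {n = K} encodeℚᵘ (λ _ → mkℚᵘ (+ 1) (suc (length g))) ++ o
    uniform-correct o =
      trans (for-reps {2F} {inp} {_} {ρ} (emit 1b · emit sep · number {1F})
               (encodeℚᵘ (mkℚᵘ (+ 1) (suc (length g))))
               (λ l a r o → cong (λ u → 1b ∷ sep ∷ u) (number-correct {1F} {at 2F l a r ρ} K refl o)) o)
        (cong (_++ o) (trans (cong (λ k → reps k u) length-inp)
                             (sym (concat-tabulate-const K u))))
      where
      u : Word
      u = encodeℚᵘ (mkℚᵘ (+ 1) (suc (length g)))

    threshold-correct : ∀ d → encodeℤ d ≡ D ++ sep ∷ [] → ∀ o →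
      ⟦ thresholdE ⟧ ρ o ≡ encodeℚᵘ (threshold (length g) d) ++ o
    threshold-correct (+ d) e o = begin
      ⟦ thresholdE ⟧ ρ o
        ≡⟨ cong (if_then minus ∷ 1b ∷ sep ∷ ⟦ number {2F} ⟧ ρ o
                     else 0b ∷ 1b ∷ ⟦ for {2F} dd all (digit 2F) ⟧ ρ (sep ∷ ⟦ number {2F} ⟧ ρ o))
                (trans (cong (λ w → on (symbolic isMinus) (top (map {B = Γ} inj₁ w))) D≡) (no-minus (bits-digits d))) ⟩
      0b ∷ 1b ∷ ⟦ for {2F} dd all (digit 2F) ⟧ ρ (sep ∷ ⟦ number {2F} ⟧ ρ o)
        ≡⟨ cong (λ u → 0b ∷ 1b ∷ u) (for-digits {2F} {dd} {_} {ρ} (cong (map {B = Γ} inj₁) D≡) (bits-digits d) _) ⟩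
      0b ∷ 1b ∷ bits d ++ sep ∷ ⟦ number {2F} ⟧ ρ o
        ≡⟨ cong (λ u → 0b ∷ 1b ∷ bits d ++ sep ∷ u) (number-correct {2F} {ρ} K refl o) ⟩
      0b ∷ 1b ∷ bits d ++ sep ∷ encodeℕ K ++ o
        ≡⟨ cong (λ u → 0b ∷ 1b ∷ u) (List.++-assoc (bits d) (sep ∷ []) _) ⟨
      ((0b ∷ 1b ∷ bits d) ++ sep ∷ []) ++ encodeℕ K ++ o
        ≡⟨ cong (λ u → (u ++ sep ∷ []) ++ encodeℕ K ++ o) (trans (bits-even (d * 2)) (cong (0b ∷_) (bits-odd d))) ⟨
      encodeℕ ((1 + d * 2) * 2) ++ encodeℕ K ++ o
        ≡⟨ List.++-assoc (encodeℕ ((1 + d * 2) * 2)) (encodeℕ K) o ⟨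
      encodeℚᵘ (threshold (length g) (+ d)) ++ o ∎
      where
      open ≡-Reasoning
      D≡ : D ≡ bits d
      D≡ = sym (List.++-cancelʳ (sep ∷ []) (bits d) D e)
      no-minus : ∀ {w} → Digits w → on (symbolic isMinus) (top (map {B = Γ} inj₁ w)) ≡ false
      no-minus []                = refl
      no-minus {0b ∷ _} (_ ∷ _)  = refl
      no-minus {1b ∷ _} (_ ∷ _)  = refl
    threshold-correct -[1+ d ] e o
      with refl ← List.++-cancelʳ (sep ∷ []) (minus ∷ bits (suc d)) D e =
      cong (λ u → minus ∷ 1b ∷ sep ∷ u) (number-correct {2F} {ρ} K refl o)

    row : ℕ → ℕ → Word
    row x y = reps x Z ++ One ++ reps y Z

    private
      row-correct : ∀ {l a r l₁ a₁ r₁} o →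
        ⟦ rowE ⟧ (at 1F l₁ a₁ r₁ (at 2F l a r ρ)) o ≡ row (length l) (length r) ++ o
      row-correct {l} {a} {r} {l₁} {a₁} {r₁} o = begin
        ⟦ rowE ⟧ σ o
          ≡⟨ for-reps {0F} {lvl 2F prv} {_} {σ} zeroE Z (λ _ _ _ _ → refl) _ ⟩
        reps (length l) Z ++ One ++ ⟦ for {0F} (lvl 2F nxt) all zeroE ⟧ σ o
          ≡⟨ cong (λ u → reps (length l) Z ++ One ++ u)
                  (for-reps {0F} {lvl 2F nxt} {_} {σ} zeroE Z (λ _ _ _ _ → refl) o) ⟩
        reps (length l) Z ++ (One ++ reps (length r) Z) ++ o
          ≡⟨ List.++-assoc (reps (length l) Z) (One ++ reps (length r) Z) o ⟨
        row (length l) (length r) ++ o ∎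
        where
        open ≡-Reasoning
        σ : Env
        σ = at 1F l₁ a₁ r₁ (at 2F l a r ρ)

      sinkRow-correct : ∀ {l a r} o →
        ⟦ sinkRowE ⟧ (at 2F l a r ρ) o ≡ row 0 (suc (length g)) ++ o
      sinkRow-correct {l} {a} {r} o = begin
        ⟦ sinkRowE ⟧ σ o
          ≡⟨ for-all {1F} {inp} (iftop (lvl 1F cur) (on isSink) oneE zeroE) σ o ⟩
        One ++ Z ++ eachIn F (lin ∷ sink ∷ []) (map inj₁ wc) o
          ≡⟨ cong (λ u → One ++ Z ++ u) (symbols wc _) ⟩
        One ++ Z ++ reps (length wc) Z ++ o
          ≡⟨ cong (λ k → One ++ Z ++ reps k Z ++ o) length-wc ⟩
        row 0 (suc (length g)) ++ o ∎
        where
        open ≡-Reasoning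
        σ : Env
        σ = at 2F l a r ρ
        F : List Γ → Γ → List Γ → Word → Word
        F l a r = ⟦ iftop {2F} (lvl 1F cur) (on isSink) oneE zeroE ⟧ (at 1F l a r σ)
        symbols : ∀ w l → eachIn F l (map inj₁ w) o ≡ reps (length w) Z ++ o
        symbols []      l = refl
        symbols (a ∷ w) l = cong (Z ++_) (symbols w (inj₁ a ∷ l))

      rowOf : ∀ (t : Fin K) y → y + suc (toℕ t) ≡ K →
              encodeVector encodeℚᵘ (indicator t) ≡ row (toℕ t) y
      rowOf t y = concat-tabulate-point t y (λ i → float (does (i Fin.≟ t)))
        where
        float : ∀ b → encodeℚᵘ (natℚᵘ (if b then 1 else 0)) ≡ (if b then One else Z)
        float true  = refl
        float false = refl

      -- For a state with `x` states before it and `y` after it; the middle row is that of its own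
      -- action.
      transitions : ℕ → ℕ → Word
      transitions x y = reps x (row x y) ++ row 0 (suc (length g)) ++ reps y (row x y)

      transition-symbol : ∀ l a r o →
        ⟦ transitionE ⟧ (at 2F l (inj₁ a) r ρ) o ≡ transitions (length l) (length r) ++ o
      transition-symbol l a r o = begin
        ⟦ transitionE ⟧ σ o
          ≡⟨ for-reps {1F} {lvl 2F prv} {_} {σ} rowE R (λ l₁ a₁ r₁ → row-correct {l} {inj₁ a} {r} {l₁} {a₁} {r₁}) _ ⟩
        reps (length l) R ++ ⟦ sinkRowE ⟧ σ (⟦ for {1F} (lvl 2F nxt) all rowE ⟧ σ o)
          ≡⟨ cong (reps (length l) R ++_) (sinkRow-correct {l} {inj₁ a} {r} _) ⟩
        reps (length l) R ++ S ++ ⟦ for {1F} (lvl 2F nxt) all rowE ⟧ σ o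
          ≡⟨ cong (λ u → reps (length l) R ++ S ++ u)
                  (for-reps {1F} {lvl 2F nxt} {_} {σ} rowE R (λ l₁ a₁ r₁ → row-correct {l} {inj₁ a} {r} {l₁} {a₁} {r₁}) o) ⟩
        reps (length l) R ++ S ++ reps (length r) R ++ o
          ≡⟨ cong (reps (length l) R ++_) (List.++-assoc S _ o) ⟨
        reps (length l) R ++ (S ++ reps (length r) R) ++ o
          ≡⟨ List.++-assoc (reps (length l) R) _ o ⟨
        transitions (length l) (length r) ++ o ∎
        where
        open ≡-Reasoning
        σ : Env
        σ = at 2F l (inj₁ a) r ρ
        R S : Word
        R = row (length l) (length r)
        S = row 0 (suc (length g))

      transition-mark : ∀ l b r o →
        ⟦ transitionE ⟧ (at 2F l (inj₂ b) r ρ) o ≡ reps K (row (length l) (length r)) ++ o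
      transition-mark l b r o =
        trans (for-reps {1F} {inp} {_} {at 2F l (inj₂ b) r ρ} rowE (row (length l) (length r))
                (λ l₁ a₁ r₁ → row-correct {l} {inj₂ b} {r} {l₁} {a₁} {r₁}) o)
              (cong (λ k → reps k (row (length l) (length r)) ++ o) length-inp)

      transition-target : ∀ j y → y + suc (toℕ j) ≡ length g →
        transitions (toℕ j + 2) y ≡
        encodeVector (encodeVector encodeℚᵘ) (λ a → indicator (target g (suc (suc j)) a))
      transition-target j y e = trans (cong (λ x → transitions x y) (ℕ.+-comm (toℕ j) 2))
        (sym (concat-tabulate-point (suc (suc j)) y rows e′))
        where
        e′ : y + suc (toℕ (suc (suc j))) ≡ K
        e′ = trans (ℕ.+-suc y _) (cong suc (trans (ℕ.+-suc y _) (cong suc e)))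
        rows : ∀ a → encodeVector encodeℚᵘ (indicator (target g (suc (suc j)) a)) ≡
                     (if does (a Fin.≟ suc (suc j)) then row 0 (suc (length g)) else row (2 + toℕ j) y)
        rows a with does (a Fin.≟ suc (suc j))
        ... | true  = rowOf 0F (suc (length g)) (ℕ.+-comm (suc (length g)) 1)
        ... | false = rowOf (suc (suc j)) y e′

    transition-correct : ∀ o →
      ⟦ for inp all transitionE ⟧ ρ o
        ≡ encodeVector {n = K} (encodeVector {n = K} (encodeVector encodeℚᵘ))
            (λ s a → indicator (target g s a)) ++ o
    transition-correct o = begin
      ⟦ for {2F} inp all transitionE ⟧ ρ o
        ≡⟨ for-all {2F} {inp} transitionE ρ o ⟩
      F [] sink (lin ∷ map inj₁ wc) o₁
        ≡⟨ transition-mark [] true (lin ∷ map inj₁ wc) o₁ ⟩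
      reps K (row 0 (suc (length {A = Γ} (map inj₁ wc)))) ++ o₁
        ≡⟨ cong (reps K (row 0 (suc (length {A = Γ} (map inj₁ wc)))) ++_) (transition-mark (sink ∷ []) false (map inj₁ wc) o₂) ⟩
      reps K (row 0 (suc (length {A = Γ} (map inj₁ wc)))) ++ reps K (row 1 (length {A = Γ} (map inj₁ wc))) ++ o₂
        ≡⟨ cong (λ m → reps K (row 0 (suc m)) ++ reps K (row 1 m) ++ o₂) (trans (length-symbols wc) length-wc) ⟩
      reps K (row 0 (suc (length g))) ++ reps K (row 1 (length g)) ++ o₂
        ≡⟨ cong₂ _++_ (constant 0F (suc (length g)) (ℕ.+-comm (suc (length g)) 1))
             (cong₂ _++_ (constant 1F (length g) (ℕ.+-comm (length g) 2))
               (eachIn-tabulate transitions wc (lin ∷ sink ∷ []) eP transition-symbol length-wc transition-target o)) ⟩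
      e (P 0F) ++ e (P 1F) ++ concat (tabulate eP) ++ o
        ≡⟨ cong (e (P 0F) ++_) (List.++-assoc (e (P 1F)) _ o) ⟨
      e (P 0F) ++ (e (P 1F) ++ concat (tabulate eP)) ++ o
        ≡⟨ List.++-assoc (e (P 0F)) _ o ⟨
      encodeVector e P ++ o ∎
      where
      open ≡-Reasoning
      F : List Γ → Γ → List Γ → Word → Word
      F l a r = ⟦ transitionE ⟧ (at 2F l a r ρ)
      o₁ o₂ : Word
      o₂ = eachIn F (lin ∷ sink ∷ []) (map inj₁ wc) o
      o₁ = F (sink ∷ []) lin (map inj₁ wc) o₂
      P : Fin K → Fin K → Vector ℚᵘ K
      P s a = indicator (target g s a)
      e : Vector (Vector ℚᵘ K) K → Word
      e = encodeVector (encodeVector encodeℚᵘ)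
      eP : Fin (length g) → Word
      eP j = e (P (suc (suc j)))
      constant : ∀ t y → y + suc (toℕ t) ≡ K → reps K (row (toℕ t) y) ≡ e (λ _ → indicator t)
      constant t y eq = sym (trans (concat-tabulate-cong {K} (λ _ → rowOf t y eq))
                                       (concat-tabulate-const K (row (toℕ t) y)))

    private
      costs : ℕ → Word
      costs x = reps K (encodeℚᵘ (natℚᵘ (itemCost x)))

      costRow : List Γ → Γ → List Γ → Word → Word
      costRow l a r = ⟦ for {1F} inp all costE ⟧ (at 2F l a r ρ)

      costRow-reps : ∀ l a r u →
        (∀ l₁ a₁ r₁ o → ⟦ costE ⟧ (at 1F l₁ a₁ r₁ (at 2F l a r ρ)) o ≡ u ++ o) →
        ∀ o → costRow l a r o ≡ reps K u ++ o
      costRow-reps l a r u h o =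
        trans (for-reps {1F} {inp} {_} {at 2F l a r ρ} costE u h o)
              (cong (λ k → reps k u ++ o) length-inp)

      cost-sep : ∀ l r o → costRow l (inj₁ sep) r o ≡ costs 0 ++ o
      cost-sep l r = costRow-reps l (inj₁ sep) r Z (λ _ _ _ _ → refl)

      cost-inner : ∀ {a} l r → T (isDigit a) → AfterDigit true l → ∀ o →
                   costRow l (inj₁ a) r o ≡ costs 0 ++ o
      cost-inner {0b} l r _ h = costRow-reps l (inj₁ 0b) r Z (λ _ _ _ o →
        if-true h)
      cost-inner {1b} l r _ h = costRow-reps l (inj₁ 1b) r Z (λ _ _ _ o →
        if-true h)

      takeWhileᵇ-digits : ∀ {w} rest → Digits w →
        takeWhileᵇ (symbolic isDigit) (map inj₁ (w ++ sep ∷ rest)) ≡ map inj₁ w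
      takeWhileᵇ-digits rest []                 = refl
      takeWhileᵇ-digits {0b ∷ w} rest (_ ∷ ds)  = cong (inj₁ 0b ∷_) (takeWhileᵇ-digits rest ds)
      takeWhileᵇ-digits {1b ∷ w} rest (_ ∷ ds)  = cong (inj₁ 1b ∷_) (takeWhileᵇ-digits rest ds)

      cost-first : ∀ {a w} c l rest → bits (suc c) ≡ a ∷ w → AfterDigit false l → ∀ o →
                   costRow l (inj₁ a) (map inj₁ (w ++ sep ∷ rest)) o ≡ costs (suc c) ++ o
      cost-first {a} {w} c l rest eq h =
        costRow-reps l (inj₁ a) (map inj₁ (w ++ sep ∷ rest)) (encodeℚᵘ (natℚᵘ (itemCost (suc c)))) entry-correct
        where
        digits : Digits (a ∷ w)
        digits = subst Digits eq (bits-digits (suc c))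
        entry-correct : ∀ l₁ a₁ r₁ o →
          ⟦ costE ⟧ (at 1F l₁ a₁ r₁ (at 2F l (inj₁ a) (map inj₁ (w ++ sep ∷ rest)) ρ)) o
            ≡ encodeℚᵘ (natℚᵘ (itemCost (suc c))) ++ o
        entry-correct l₁ a₁ r₁ o with digits
        ... | d ∷ ds = begin
          ⟦ costE ⟧ σ o
            ≡⟨ digit-branch a d ⟩
          X
            -- No digit precedes, so a number starts here.
            ≡⟨ if-false h ⟩
          1b ∷ 0b ∷ ⟦ digit {1F} 2F ⟧ σ (⟦ for {0F} (lvl 2F nxt) (symbolic isDigit) (digit 0F) ⟧ σ (Z ++ o))
            ≡⟨ cong (λ u → 1b ∷ 0b ∷ u) (digit-correct {1F} 2F {σ} {a} d refl) ⟩
          1b ∷ 0b ∷ a ∷ ⟦ for {0F} (lvl 2F nxt) (symbolic isDigit) (digit 0F) ⟧ σ (Z ++ o)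
            ≡⟨ cong (λ u → 1b ∷ 0b ∷ a ∷ eachIn _ [] u (Z ++ o)) (takeWhileᵇ-digits rest ds) ⟩
          1b ∷ 0b ∷ a ∷ eachIn (λ l a r → ⟦ digit {0F} 0F ⟧ (at 0F l a r σ)) [] (map inj₁ w) (Z ++ o)
            ≡⟨ cong (λ u → 1b ∷ 0b ∷ a ∷ u) (eachIn-digits {0F} 0F σ [] (Z ++ o) ds) ⟩
          (1b ∷ 0b ∷ a ∷ w) ++ sep ∷ 1b ∷ sep ∷ o
            ≡⟨ List.++-assoc (1b ∷ 0b ∷ a ∷ w) (sep ∷ []) (1b ∷ sep ∷ o) ⟨
          ((1b ∷ 0b ∷ a ∷ w) ++ sep ∷ []) ++ 1b ∷ sep ∷ o
            ≡⟨ List.++-assoc ((1b ∷ 0b ∷ a ∷ w) ++ sep ∷ []) (1b ∷ sep ∷ []) o ⟨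
          (((1b ∷ 0b ∷ a ∷ w) ++ sep ∷ []) ++ 1b ∷ sep ∷ []) ++ o
            ≡⟨ cong (λ u → ((u ++ sep ∷ []) ++ 1b ∷ sep ∷ []) ++ o)
                 (trans (bits-odd (suc c * 2)) (cong (1b ∷_) (trans (bits-even c) (cong (0b ∷_) eq)))) ⟨
          encodeℚᵘ (natℚᵘ (itemCost (suc c))) ++ o ∎
          where
          open ≡-Reasoning
          σ : Env
          σ = at 1F l₁ a₁ r₁ (at 2F l (inj₁ a) (map inj₁ (w ++ sep ∷ rest)) ρ)
          X Y : Word
          Y = 1b ∷ 0b ∷ ⟦ digit {1F} 2F ⟧ σ (⟦ for {0F} (lvl 2F nxt) (symbolic isDigit) (digit 0F) ⟧ σ (Z ++ o))
          X = if on (symbolic isDigit) (top l) then Z ++ o else Y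
          digit-branch : ∀ a → T (isDigit a) → (if isDigit a then X else Z ++ o) ≡ X
          digit-branch 0b _ = refl
          digit-branch 1b _ = refl

      linear-entry : ∀ l r l₁ a₁ r₁ o →
        ⟦ costE ⟧ (at 1F l₁ (inj₁ a₁) r₁ (at 2F l lin r ρ)) o ≡ encodeℚᵘ (natℚᵘ (1 + speed g)) ++ o
      linear-entry l r l₁ a₁ r₁ o = begin
        1b ∷ ⟦ zeros {0F} ⟧ σ (1b ∷ Z ++ o)
          ≡⟨ cong (1b ∷_) (zeros-correct {0F} σ _) ⟩
        1b ∷ replicate (length (ρ inp)) 0b ++ 1b ∷ Z ++ o
          ≡⟨ cong (λ k → 1b ∷ replicate k 0b ++ 1b ∷ Z ++ o) length-inp ⟩
        1b ∷ replicate K 0b ++ 1b ∷ Z ++ o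
          ≡⟨ cong (1b ∷_) (List.++-assoc (replicate K 0b) (1b ∷ []) (Z ++ o)) ⟨
        (1b ∷ replicate K 0b ++ 1b ∷ []) ++ Z ++ o
          ≡⟨ List.++-assoc (1b ∷ replicate K 0b ++ 1b ∷ []) Z o ⟨
        ((1b ∷ replicate K 0b ++ 1b ∷ []) ++ Z) ++ o
          ≡⟨ cong (_++ o) (List.++-assoc (1b ∷ replicate K 0b ++ 1b ∷ []) (sep ∷ []) (1b ∷ sep ∷ [])) ⟨
        (((1b ∷ replicate K 0b ++ 1b ∷ []) ++ sep ∷ []) ++ 1b ∷ sep ∷ []) ++ o
          ≡⟨ cong (λ u → ((u ++ sep ∷ []) ++ 1b ∷ sep ∷ []) ++ o) (bits-1+2^ K) ⟨
        encodeℚᵘ (natℚᵘ (1 + speed g)) ++ o ∎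
        where
        open ≡-Reasoning
        σ : Env
        σ = at 1F l₁ (inj₁ a₁) r₁ (at 2F l lin r ρ)

      linear-row : ∀ l r o →
        costRow l lin r o ≡ encodeVector {n = K} (encodeℚᵘ ∘ natℚᵘ) (costℕ g 1F) ++ o
      linear-row l r o = begin
        costRow l lin r o
          ≡⟨ for-all {1F} {inp} costE (at 2F l lin r ρ) o ⟩
        One ++ One ++ eachIn F (lin ∷ sink ∷ []) (map inj₁ wc) o
          ≡⟨ cong (λ v → One ++ One ++ v) (symbols wc (lin ∷ sink ∷ [])) ⟩
        One ++ One ++ reps (length wc) u ++ o
          ≡⟨ cong (λ k → One ++ One ++ reps k u ++ o) length-wc ⟩
        One ++ One ++ reps (length g) u ++ o
          ≡⟨ cong (λ v → One ++ One ++ v ++ o) (concat-tabulate-const (length g) u) ⟨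
        encodeVector {n = K} (encodeℚᵘ ∘ natℚᵘ) (costℕ g 1F) ++ o ∎
        where
        open ≡-Reasoning
        F : List Γ → Γ → List Γ → Word → Word
        F l₁ a₁ r₁ = ⟦ costE ⟧ (at 1F l₁ a₁ r₁ (at 2F l lin r ρ))
        u : Word
        u = encodeℚᵘ (natℚᵘ (1 + speed g))
        symbols : ∀ w l₁ → eachIn F l₁ (map inj₁ w) o ≡ reps (length w) u ++ o
        symbols []      l₁ = refl
        symbols (a ∷ w) l₁ = trans (linear-entry l r l₁ a (map inj₁ w) _)
          (trans (cong (u ++_) (symbols w (inj₁ a ∷ l₁))) (sym (List.++-assoc u _ o)))

    cost-correct : ∀ {n} (c : Vector ℕ n) → wc ≡ encodeVector encodeℕ c → g ≡ weights c → ∀ o →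
      ⟦ for inp all (for inp all costE) ⟧ ρ o
        ≡ encodeVector {n = K} (encodeVector {n = K} encodeℚᵘ) (λ s a → natℚᵘ (costℕ g s a)) ++ o
    cost-correct c refl refl o = begin
      ⟦ for {2F} inp all (for {1F} inp all costE) ⟧ ρ o
        ≡⟨ for-all {2F} {inp} (for {1F} inp all costE) ρ o ⟩
      costRow [] sink (lin ∷ map inj₁ wc) (costRow (sink ∷ []) lin (map inj₁ wc) (eachIn costRow (lin ∷ sink ∷ []) (map inj₁ wc) o))
        ≡⟨ costRow-reps [] sink (lin ∷ map inj₁ wc) One (λ _ _ _ _ → refl) _ ⟩
      reps K One ++ costRow (sink ∷ []) lin (map inj₁ wc) (eachIn costRow (lin ∷ sink ∷ []) (map inj₁ wc) o)
        ≡⟨ cong (reps K One ++_) (linear-row (sink ∷ []) (map inj₁ wc) _) ⟩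
      reps K One ++ linear ++ eachIn costRow (lin ∷ sink ∷ []) (map inj₁ wc) o
        -- The final `refl`: the symbol before the list is the mark `lin`, not a digit.
        ≡⟨ cong (λ u → reps K One ++ linear ++ u) (weights-emitted {costRow} {costs} cost-sep cost-inner cost-first c (lin ∷ sink ∷ []) refl o) ⟩
      reps K One ++ linear ++ concat (map costs g) ++ o
        ≡⟨ cong₂ (λ u v → u ++ linear ++ v ++ o) (sym (concat-tabulate-const K One)) items ⟩
      constant ++ linear ++ concat (tabulate rows) ++ o
        ≡⟨ cong (constant ++_) (List.++-assoc linear _ o) ⟨
      constant ++ (linear ++ concat (tabulate rows)) ++ o
        ≡⟨ List.++-assoc constant _ o ⟨
      encodeVector {n = K} (encodeVector {n = K} encodeℚᵘ) (λ s a → natℚᵘ (costℕ g s a)) ++ o ∎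
      where
      open ≡-Reasoning
      constant linear : Word
      constant = encodeVector {n = K} (encodeℚᵘ ∘ natℚᵘ) (costℕ g 0F)
      linear   = encodeVector {n = K} (encodeℚᵘ ∘ natℚᵘ) (costℕ g 1F)
      rows : Fin (length g) → Word
      rows j = encodeVector {n = K} (encodeℚᵘ ∘ natℚᵘ) (costℕ g (suc (suc j)))
      items : concat (map costs g) ≡ concat (tabulate rows)
      items = trans (cong (concat ∘ map costs) (sym (List.tabulate-lookup g)))
                (trans (cong concat (List.map-tabulate (lookup g) costs))
                  (concat-tabulate-cong (λ j → sym (concat-tabulate-const K (encodeℚᵘ (natℚᵘ (itemCost (lookup g j))))))))

  length-weights : ∀ {n} (c : Vector ℕ n) → length (encodeVector encodeℕ c) ≡ length (weights c)
  length-weights {zero}  c = refl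
  length-weights {suc n} c = begin
    length (encodeℕ (c zero) ++ encodeVector encodeℕ (c ∘ suc))
      ≡⟨ List.length-++ (encodeℕ (c zero)) ⟩
    length (encodeℕ (c zero)) + length (encodeVector encodeℕ (c ∘ suc))
      ≡⟨ cong₂ _+_ (trans (List.length-++ (bits (c zero))) (trans (ℕ.+-comm _ 1)
           (cong suc (sym (List.length-replicate (length (bits (c zero)))))))) (length-weights (c ∘ suc)) ⟩
    length (block (c zero)) + length (weights (c ∘ suc))
      ≡⟨ List.length-++ (block (c zero)) ⟨
    length (weights c) ∎
    where open ≡-Reasoning

  signed : ℤ → Word
  signed (+ d)    = bits d
  signed -[1+ d ] = minus ∷ bits (suc d)

  encodeℤ-signed : ∀ d → encodeℤ d ≡ signed d ++ sep ∷ []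
  encodeℤ-signed (+ d)    = refl
  encodeℤ-signed -[1+ d ] = refl

  instance-correct : ∀ I → let open SqrtSumInstance I in
    ⟦ instanceE ⟧ (environment {signed d} {encodeVector encodeℕ c} {weights c} (length-weights c)) []
      ≡ DecisionProblem.encode STOCHASTIC-BLIND-POLICY (reduction I)
  instance-correct I = begin
    ⟦ number {2F} ⟧ ρ _
      ≡⟨ number-correct {2F} {ρ} (size g) refl _ ⟩
    encodeℕ (size g) ++ ⟦ number {2F} ⟧ ρ _
      ≡⟨ cong (encodeℕ (size g) ++_) (number-correct {2F} {ρ} (size g) refl _) ⟩
    encodeℕ (size g) ++ encodeℕ (size g) ++ ⟦ discountE ⟧ ρ o₄
      ≡⟨ cong (λ u → encodeℕ (size g) ++ encodeℕ (size g) ++ u) rest ⟩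
    encodeℕ (size g) ++ encodeℕ (size g) ++ encodeℚᵘ γ ++ encodeVector (encodeVector encodeℚᵘ) C
      ++ encodeVector encodeℚᵘ μ ++ encodeVector (encodeVector (encodeVector encodeℚᵘ)) p ++ encodeℚᵘ r ∎
    where
    open ≡-Reasoning
    open SqrtSumInstance I using (c; d)
    open BlindPolicyInstance (reduction I)
    g = weights c
    len = length-weights c
    ρ = environment {signed d} {encodeVector encodeℕ c} {g} len
    o₁ o₂ o₃ o₄ : Word
    o₁ = ⟦ thresholdE ⟧ ρ []
    o₂ = ⟦ for {2F} inp all transitionE ⟧ ρ o₁
    o₃ = ⟦ for {2F} inp all (emit 1b · emit sep · number {1F}) ⟧ ρ o₂
    o₄ = ⟦ for {2F} inp all (for {1F} inp all costE) ⟧ ρ o₃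
    rest : ⟦ discountE ⟧ ρ o₄ ≡ encodeℚᵘ γ ++ encodeVector (encodeVector encodeℚᵘ) C
      ++ encodeVector encodeℚᵘ μ ++ encodeVector (encodeVector (encodeVector encodeℚᵘ)) p ++ encodeℚᵘ r
    rest = trans (discount-correct {signed d} {encodeVector encodeℕ c} {g} len o₄) (cong (encodeℚᵘ γ ++_)
      (trans (cost-correct {signed d} {encodeVector encodeℕ c} {g} len c refl refl o₃) (cong (encodeVector (encodeVector encodeℚᵘ) C ++_)
      (trans (uniform-correct {signed d} {encodeVector encodeℕ c} {g} len o₂) (cong (encodeVector encodeℚᵘ μ ++_)
      (trans (transition-correct {signed d} {encodeVector encodeℕ c} {g} len o₁) (cong (encodeVector (encodeVector (encodeVector encodeℚᵘ)) p ++_)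
      (trans (threshold-correct {signed d} {encodeVector encodeℕ c} {g} len d (encodeℤ-signed d) []) (List.++-identityʳ _)))))))))

  -- Preparing the work tapes

  private
    -- A loop tape, borrowed before any loop runs and emptied again to satisfy `Fresh`.
    tmp : RVar
    tmp = lvl 0F prv

    ι : Fin 5 → Var
    ι 0F = rd inp
    ι 1F = rd dd
    ι 2F = rd bin
    ι 3F = scr
    ι 4F = rd tmp

    ι-injective : Injective _≡_ _≡_ ι
    ι-injective {0F} {0F} _ = refl
    ι-injective {1F} {1F} _ = refl
    ι-injective {2F} {2F} _ = refl
    ι-injective {3F} {3F} _ = refl
    ι-injective {4F} {4F} _ = refl
    ι-injective {0F} {1F} ()
    ι-injective {0F} {2F} ()
    ι-injective {0F} {3F} ()
    ι-injective {0F} {4F} ()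
    ι-injective {1F} {2F} ()
    ι-injective {1F} {3F} ()
    ι-injective {1F} {4F} ()
    ι-injective {2F} {3F} ()
    ι-injective {2F} {4F} ()
    ι-injective {3F} {4F} ()

  open Slots ι ι-injective (λ _ → [])

  unlessSep : Symbol → Bool
  unlessSep sep = false
  unlessSep _   = true

  -- The ones at the least significant end become zeros parked on `scr`, the digit after them
  -- becomes 1, and the zeros return.
  incrementBin : Prog
  incrementBin =
      while (rd bin) (on (symbolic is1)) (pop (rd bin) ⨾ push (inj₁ 0b) scr)
    ⨾ ite (rd bin) (on (symbolic is0)) (pop (rd bin) ⨾ push (inj₁ 1b) (rd bin)) (push (inj₁ 1b) (rd bin))
    ⨾ while scr some (transfer scr (rd bin))

  -- The first separator of the input is the one that ends `d`. The marks are pushed before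
  -- counting, so `bin` receives the number of all states.
  prepare : Prog
  prepare =
      while (rd inp) (on (symbolic unlessSep)) (transfer (rd inp) scr)
    ⨾ pop (rd inp)
    ⨾ while scr some (transfer scr (rd dd))
    ⨾ push lin (rd inp)
    ⨾ push sink (rd inp)
    ⨾ while (rd inp) some (transfer (rd inp) (rd tmp) ⨾ incrementBin)
    ⨾ while (rd tmp) some (transfer (rd tmp) (rd inp))

  module _ (i d : List Γ) where

    -- The invariant is the equation: reversing the parked digits onto the increment of the
    -- remainder always gives the increment of the original word.
    carry-triple : ∀ w u t → ∃[ w′ ] ∃[ u′ ]
      Triple (while (rd bin) (on (symbolic is1)) (pop (rd bin) ⨾ push (inj₁ 0b) scr))
        (slots (i ,, d ,, map inj₁ w ,, map inj₁ u ,, t ,, ⟨⟩))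
        (slots (i ,, d ,, map inj₁ w′ ,, map inj₁ u′ ,, t ,, ⟨⟩)) (1 + length w * 4)
      × on (symbolic is1) (top (map inj₁ w′)) ≡ false
      × u′ ʳ++ increment w′ ≡ u ʳ++ increment w
      × length u′ ≤ length u + length w
    carry-triple []          u t = [] , u , while-done-slots 2F refl , refl , refl , ℕ.m≤m+n _ 0
    carry-triple (0b ∷ w)    u t = 0b ∷ w , u , weaken (s≤s z≤n) (while-done-slots 2F refl) , refl , refl , ℕ.m≤m+n _ _
    carry-triple (minus ∷ w) u t = minus ∷ w , u , weaken (s≤s z≤n) (while-done-slots 2F refl) , refl , refl , ℕ.m≤m+n _ _
    carry-triple (sep ∷ w)   u t = sep ∷ w , u , weaken (s≤s z≤n) (while-done-slots 2F refl) , refl , refl , ℕ.m≤m+n _ _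
    carry-triple (1b ∷ w)    u t =
      let w′ , u′ , P , e , eq , len = carry-triple w (0b ∷ u) t
      in  w′ , u′ ,
          weaken (ℕ.≤-reflexive (cong suc (ℕ.+-suc 3 _)))
            (while-step-slots 2F refl (pop-slots 2F refl ⟫ push-slots (inj₁ 0b) 3F) P) ,
          e , eq , ℕ.≤-trans len (ℕ.≤-reflexive (sym (ℕ.+-suc (length u) (length w))))

    carried-triple : ∀ u w t →
      Triple (while scr some (transfer scr (rd bin)))
        (slots (i ,, d ,, map inj₁ w ,, map inj₁ u ,, t ,, ⟨⟩))
        (slots (i ,, d ,, map inj₁ (u ʳ++ w) ,, [] ,, t ,, ⟨⟩)) (1 + length u * 4)
    carried-triple []      w t = while-done-slots 3F refl
    carried-triple (a ∷ u) w t = weaken (ℕ.≤-reflexive (cong suc (ℕ.+-suc 3 _)))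
      (while-step-slots 3F refl (transfer-slots 3F 2F (λ ()) refl) (carried-triple u (a ∷ w) t))

    set-triple : ∀ w u t → on (symbolic is1) (top (map inj₁ w)) ≡ false →
      Triple (ite (rd bin) (on (symbolic is0)) (pop (rd bin) ⨾ push (inj₁ 1b) (rd bin)) (push (inj₁ 1b) (rd bin)))
        (slots (i ,, d ,, map inj₁ w ,, u ,, t ,, ⟨⟩))
        (slots (i ,, d ,, map inj₁ (increment w) ,, u ,, t ,, ⟨⟩)) 4
    set-triple []          u t _ = weaken (ℕ.n≤1+n 3) (ite-false refl (push-slots (inj₁ 1b) 2F))
    set-triple (0b ∷ w)    u t _ = ite-true refl (pop-slots 2F refl ⟫ push-slots (inj₁ 1b) 2F)
    set-triple (minus ∷ w) u t _ = weaken (ℕ.n≤1+n 3) (ite-false refl (push-slots (inj₁ 1b) 2F))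
    set-triple (sep ∷ w)   u t _ = weaken (ℕ.n≤1+n 3) (ite-false refl (push-slots (inj₁ 1b) 2F))

  incrementTime : ℕ → ℕ
  incrementTime N = (1 + N * 4) + (4 + (1 + N * 4))

  increment-triple : ∀ {N} i d w t → length w ≤ N →
    Triple incrementBin
      (slots (i ,, d ,, map inj₁ w ,, [] ,, t ,, ⟨⟩))
      (slots (i ,, d ,, map inj₁ (increment w) ,, [] ,, t ,, ⟨⟩)) (incrementTime N)
  increment-triple i d w t w≤N =
    let w′ , u′ , P , e , eq , len = carry-triple i d w [] t
    in  weaken (s≤s (ℕ.*-monoˡ-≤ 4 w≤N)) P
        ⟫ set-triple i d w′ (map inj₁ u′) t e
        ⟫ weaken (s≤s (ℕ.*-monoˡ-≤ 4 (ℕ.≤-trans len w≤N)))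
            (restate (λ _ → refl) (λ v → cong (λ z → slots (i ,, d ,, map inj₁ z ,, [] ,, t ,, ⟨⟩) v) eq)
              (carried-triple i d u′ (increment w′) t))

  length-increment : ∀ w → length (increment w) ≤ suc (length w)
  length-increment []          = s≤s z≤n
  length-increment (0b ∷ w)    = ℕ.n≤1+n _
  length-increment (1b ∷ w)    = s≤s (length-increment w)
  length-increment (minus ∷ w) = ℕ.≤-refl
  length-increment (sep ∷ w)   = ℕ.≤-refl

  length-bits : ∀ n → length (bits n) ≤ n
  length-bits zero    = z≤n
  length-bits (suc n) = ℕ.≤-trans (length-increment (bits n)) (s≤s (length-bits n))

  split-triple : ∀ {w} rest u d b t → All (T ∘ unlessSep) w →
    Triple (while (rd inp) (on (symbolic unlessSep)) (transfer (rd inp) scr))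
      (slots (map inj₁ (w ++ sep ∷ rest) ,, d ,, b ,, u ,, t ,, ⟨⟩))
      (slots (map inj₁ (sep ∷ rest) ,, d ,, b ,, (map inj₁ w ʳ++ u) ,, t ,, ⟨⟩)) (1 + length w * 4)
  split-triple rest u d b t [] = while-done-slots 0F refl
  split-triple {a ∷ w} rest u d b t (h ∷ hs) = weaken (ℕ.≤-reflexive (cong suc (ℕ.+-suc 3 _)))
    (while-step-slots 0F (test a h) (transfer-slots 0F 3F (λ ()) refl) (split-triple rest (inj₁ a ∷ u) d b t hs))
    where
    test : ∀ a → T (unlessSep a) → unlessSep a ≡ true
    test 0b    _ = refl
    test 1b    _ = refl
    test minus _ = refl

  store-d-triple : ∀ u i d b t →
    Triple (while scr some (transfer scr (rd dd)))
      (slots (i ,, d ,, b ,, u ,, t ,, ⟨⟩)) (slots (i ,, (u ʳ++ d) ,, b ,, [] ,, t ,, ⟨⟩)) (1 + length u * 4)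
  store-d-triple []      i d b t = while-done-slots 3F refl
  store-d-triple (a ∷ u) i d b t = weaken (ℕ.≤-reflexive (cong suc (ℕ.+-suc 3 _)))
    (while-step-slots 3F refl (transfer-slots 3F 1F (λ ()) refl) (store-d-triple u i (a ∷ d) b t))

  rewind-triple : ∀ t i d b u →
    Triple (while (rd tmp) some (transfer (rd tmp) (rd inp)))
      (slots (i ,, d ,, b ,, u ,, t ,, ⟨⟩)) (slots ((t ʳ++ i) ,, d ,, b ,, u ,, [] ,, ⟨⟩)) (1 + length t * 4)
  rewind-triple []      i d b u = while-done-slots 4F refl
  rewind-triple (a ∷ t) i d b u = weaken (ℕ.≤-reflexive (cong suc (ℕ.+-suc 3 _)))
    (while-step-slots 4F refl (transfer-slots 4F 0F (λ ()) refl) (rewind-triple t (a ∷ i) d b u))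

  -- The counter's length is bounded by its value rather than by a logarithm, which still keeps the
  -- time polynomial.
  count-triple : ∀ {N} w n d t → length w + n ≤ N →
    Triple (while (rd inp) some (transfer (rd inp) (rd tmp) ⨾ incrementBin))
      (slots (w ,, d ,, map inj₁ (bits n) ,, [] ,, t ,, ⟨⟩))
      (slots ([] ,, d ,, map inj₁ (bits (length w + n)) ,, [] ,, (w ʳ++ t) ,, ⟨⟩))
      (1 + length w * (4 + incrementTime N))
  count-triple []      n d t h = while-done-slots 0F refl
  count-triple {N} (a ∷ w) n d t h = weaken (ℕ.≤-reflexive (cong suc (ℕ.+-suc (3 + incrementTime N) _)))
    (while-step-slots 0F refl
      (transfer-slots 0F 4F (λ ()) refl
        ⟫ increment-triple w d (bits n) (a ∷ t) (ℕ.≤-trans (length-bits n) (ℕ.m+n≤o⇒n≤o (suc (length w)) h)))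
      (restate (λ _ → refl)
        (λ v → cong (λ k → slots ([] ,, d ,, map inj₁ (bits k) ,, [] ,, (w ʳ++ (a ∷ t)) ,, ⟨⟩) v) (ℕ.+-suc (length w) n))
        (count-triple w (suc n) d (a ∷ t) (ℕ.≤-trans (ℕ.≤-reflexive (ℕ.+-suc (length w) n)) h))))

  prepareTime : ℕ → ℕ
  prepareTime N =
    (1 + N * 4) + (1 + ((1 + N * 4) + (2 + (2 + ((1 + N * (4 + incrementTime N)) + (1 + N * 4))))))

  signed-unlessSep : ∀ d → All (T ∘ unlessSep) (signed d)
  signed-unlessSep = λ { (+ d)    → All.map weakenDigit (bits-digits d)
                       ; -[1+ d ] → _ ∷ All.map weakenDigit (bits-digits (suc d)) }
    where
    weakenDigit : ∀ {a} → T (isDigit a) → T (unlessSep a)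
    weakenDigit {0b} _ = _
    weakenDigit {1b} _ = _

  reverse-twice : ∀ (w : List Γ) → (w ʳ++ []) ʳ++ [] ≡ w
  reverse-twice w = trans (List.ʳ++-ʳ++ w) (List.++-identityʳ w)

  prepare-triple : ∀ {D wc N} → All (T ∘ unlessSep) D → length D ≤ N → 2 + length wc ≤ N →
    Triple prepare
      (slots (map inj₁ (D ++ sep ∷ wc) ,, [] ,, [] ,, [] ,, [] ,, ⟨⟩))
      (slots ((sink ∷ lin ∷ map inj₁ wc) ,, map inj₁ D ,, map inj₁ (bits (2 + length wc)) ,, [] ,, [] ,, ⟨⟩))
      (prepareTime N)
  prepare-triple {D} {wc} {N} hD D≤N w≤N =
      weaken (s≤s (ℕ.*-monoˡ-≤ 4 D≤N)) (split-triple wc [] [] [] [] hD)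
    ⟫ pop-slots 0F refl
    ⟫ weaken (s≤s (ℕ.*-monoˡ-≤ 4 (ℕ.≤-trans (ℕ.≤-reflexive (trans (length-reverse (map inj₁ D)) (length-symbols D))) D≤N)))
        (restate (λ _ → refl)
          (λ v → cong (λ z → slots (map inj₁ wc ,, z ,, [] ,, [] ,, [] ,, ⟨⟩) v) (reverse-twice (map inj₁ D)))
          (store-d-triple (map inj₁ D ʳ++ []) (map inj₁ wc) [] [] []))
    ⟫ push-slots lin 0F
    ⟫ push-slots sink 0F
    ⟫ weaken (s≤s (ℕ.*-monoˡ-≤ (4 + incrementTime N) W≤N))
        (restate (λ _ → refl)
          (λ v → cong (λ k → slots ([] ,, map inj₁ D ,, map inj₁ (bits k) ,, [] ,, (W ʳ++ []) ,, ⟨⟩) v)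
            (trans (ℕ.+-identityʳ _) length-W))
          (count-triple W 0 (map inj₁ D) [] (ℕ.≤-trans (ℕ.≤-reflexive (ℕ.+-identityʳ _)) W≤N)))
    ⟫ weaken (s≤s (ℕ.*-monoˡ-≤ 4 (ℕ.≤-trans (ℕ.≤-reflexive (length-reverse W)) W≤N)))
        (restate (λ _ → refl)
          (λ v → cong (λ z → slots (z ,, map inj₁ D ,, map inj₁ (bits (2 + length wc)) ,, [] ,, [] ,, ⟨⟩) v) (reverse-twice W))
          (rewind-triple (W ʳ++ []) [] _ _ []))
    where
    W : List Γ
    W = sink ∷ lin ∷ map inj₁ wc
    length-W : length W ≡ 2 + length wc
    length-W = cong (λ m → suc (suc m)) (length-symbols wc)
    W≤N : length W ≤ N
    W≤N = ℕ.≤-trans (ℕ.≤-reflexive length-W) w≤N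

  -- Polynomial bounds

  *-^ : ∀ m n k → (m * n) ^ k ≡ m ^ k * n ^ k
  *-^ m n zero    = refl
  *-^ m n (suc k) = trans (cong (m * n *_) (*-^ m n k)) (ℕ.[m*n]*[o*p]≡[m*o]*[n*p] m n (m ^ k) (n ^ k))

  -- With the positive base `suc n`, powers are monotone in the exponent even at 0; a sum is then
  -- handled by adding exponents.
  PolyBounded : (ℕ → ℕ) → Set
  PolyBounded f = ∃[ c ] ∃[ k ] ∀ n → f n ≤ c * suc n ^ k

  const-poly : ∀ c → PolyBounded (λ _ → c)
  const-poly c = c , 0 , λ n → ℕ.≤-reflexive (sym (ℕ.*-identityʳ c))

  id-poly : PolyBounded (λ n → 2 + n)
  id-poly = 2 , 1 , λ n → ℕ.≤-trans (ℕ.+-monoʳ-≤ 2 (ℕ.m≤m*n n 2))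
    (ℕ.≤-reflexive (trans (ℕ.*-comm (suc n) 2) (cong (2 *_) (sym (ℕ.^-identityʳ (suc n))))))

  +-poly : ∀ {f g} → PolyBounded f → PolyBounded g → PolyBounded (λ n → f n + g n)
  +-poly (c , k , hf) (d , l , hg) = c + d , k + l , λ n → ℕ.≤-trans
    (ℕ.+-mono-≤ (ℕ.≤-trans (hf n) (ℕ.*-monoʳ-≤ c (ℕ.^-monoʳ-≤ (suc n) (ℕ.m≤m+n k l))))
                (ℕ.≤-trans (hg n) (ℕ.*-monoʳ-≤ d (ℕ.^-monoʳ-≤ (suc n) (ℕ.m≤n+m l k)))))
    (ℕ.≤-reflexive (sym (ℕ.*-distribʳ-+ (suc n ^ (k + l)) c d)))

  *-poly : ∀ {f g} → PolyBounded f → PolyBounded g → PolyBounded (λ n → f n * g n)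
  *-poly (c , k , hf) (d , l , hg) = c * d , k + l , λ n → ℕ.≤-trans
    (ℕ.*-mono-≤ (hf n) (hg n))
    (ℕ.≤-reflexive (trans (ℕ.[m*n]*[o*p]≡[m*o]*[n*p] c (suc n ^ k) d (suc n ^ l))
      (cong (c * d *_) (sym (ℕ.^-distribˡ-+-* (suc n) k l)))))

  -- For n ≥ 1 the base n + 1 is at most 2 n, at the price of the factor 2^k; the constant term
  -- takes care of n = 0.
  poly-bound : ∀ {f} → PolyBounded f → ∃[ c ] ∃[ k ] ∀ n → f n ≤ c * n ^ k + c
  poly-bound {f} (c , k , h) = c * 2 ^ k , k , bound
    where
    open ℕ.≤-Reasoning
    bound : ∀ n → f n ≤ c * 2 ^ k * n ^ k + c * 2 ^ k
    bound zero = begin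
      f 0                              ≤⟨ h 0 ⟩
      c * 1 ^ k                        ≤⟨ ℕ.*-monoʳ-≤ c (ℕ.^-monoˡ-≤ k (s≤s z≤n)) ⟩
      c * 2 ^ k                        ≤⟨ ℕ.m≤n+m _ _ ⟩
      c * 2 ^ k * 0 ^ k + c * 2 ^ k    ∎
    bound (suc n) = begin
      f (suc n)                              ≤⟨ h (suc n) ⟩
      c * suc (suc n) ^ k                    ≤⟨ ℕ.*-monoʳ-≤ c (ℕ.^-monoˡ-≤ k double) ⟩
      c * (2 * suc n) ^ k                    ≡⟨ cong (c *_) (*-^ 2 (suc n) k) ⟩
      c * (2 ^ k * suc n ^ k)                ≡⟨ ℕ.*-assoc c (2 ^ k) (suc n ^ k) ⟨
      c * 2 ^ k * suc n ^ k                  ≤⟨ ℕ.m≤m+n _ _ ⟩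
      c * 2 ^ k * suc n ^ k + c * 2 ^ k      ∎
      where
      double : 2 + n ≤ 2 * suc n
      double = begin
        2 + n               ≤⟨ ℕ.+-monoʳ-≤ 2 (ℕ.m≤n*m n 2) ⟩
        2 + 2 * n           ≡⟨ ℕ.*-suc 2 n ⟨
        2 * suc n           ∎

  loop-poly : ∀ {f} → PolyBounded f → PolyBounded (λ n → 1 + (2 + n) * f n)
  loop-poly f = +-poly (const-poly 1) (*-poly id-poly f)

  time-poly : ∀ {n} (e : Emitter n) → PolyBounded (λ N → time e (2 + N))
  time-poly (emit a)        = const-poly 2
  time-poly (e · f)         = +-poly (time-poly f) (time-poly e)
  time-poly (iftop x b e f) = +-poly (const-poly 1) (+-poly (time-poly e) (time-poly f))
  time-poly (for x b e)     =
    +-poly (loop-poly (const-poly 6)) (+-poly (loop-poly (const-poly 4))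
      (+-poly (loop-poly (+-poly (const-poly 7) (time-poly e))) (loop-poly (const-poly 2))))

  incrementTime-poly : PolyBounded (λ N → incrementTime (2 + N))
  incrementTime-poly = +-poly (loop-poly (const-poly 4)) (+-poly (const-poly 4) (loop-poly (const-poly 4)))

  prepareTime-poly : PolyBounded (λ N → prepareTime (2 + N))
  prepareTime-poly = +-poly (loop-poly (const-poly 4)) (+-poly (const-poly 1) (+-poly (loop-poly (const-poly 4))
    (+-poly (const-poly 2) (+-poly (const-poly 2)
      (+-poly (loop-poly (+-poly (const-poly 4) incrementTime-poly)) (loop-poly (const-poly 4)))))))

  reduction-polynomialTime : PolynomialTime (DecisionProblem.encode SQRT-SUM)
                               (DecisionProblem.encode STOCHASTIC-BLIND-POLICY) reduction
  reduction-polynomialTime = record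
    { machine     = machine reducer
    ; coefficient = proj₁ bound
    ; degree      = proj₁ (proj₂ bound)
    ; computes    = λ I → let t , c , run , eq , t≤ = triple-run reducer (reducer-triple I) refl in
        t , c , run , trans eq (instance-correct I) , ℕ.≤-trans t≤ (proj₂ (proj₂ bound) (inputLength I))
    }
    where
    reducer : Prog
    reducer = prepare ⨾ compile instanceE

    inputLength : SqrtSumInstance → ℕ
    inputLength I = length (DecisionProblem.encode SQRT-SUM I)

    bound : ∃[ c ] ∃[ k ] ∀ n → prepareTime (2 + n) + time instanceE (2 + n) ≤ c * n ^ k + c
    bound = poly-bound (+-poly prepareTime-poly (time-poly instanceE))

    module _ (I : SqrtSumInstance) where
      open SqrtSumInstance I using (c; d)
      wc D w : Word
      wc = encodeVector encodeℕ c
      D  = signed d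
      w  = DecisionProblem.encode SQRT-SUM I
      N : ℕ
      -- Two more than the input, for the marks.
      N = 2 + length w
      w≡ : w ≡ D ++ sep ∷ wc
      w≡ = trans (cong (_++ wc) (encodeℤ-signed d)) (List.++-assoc D (sep ∷ []) wc)
      length-w : length w ≡ length D + suc (length wc)
      length-w = trans (cong length w≡) (List.length-++ D)
      D≤N : length D ≤ N
      D≤N = ℕ.≤-trans (ℕ.m≤m+n _ _) (ℕ.≤-trans (ℕ.≤-reflexive (sym length-w)) (ℕ.m≤n+m _ 2))
      wc≤N : 2 + length wc ≤ N
      wc≤N = s≤s (s≤s (ℕ.≤-trans (ℕ.n≤1+n _) (ℕ.≤-trans (ℕ.m≤n+m _ (length D)) (ℕ.≤-reflexive (sym length-w)))))
      ρ : Env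
      ρ = environment {D} {wc} {weights c} (length-weights c)

      initial≗ : initialStore reducer w ≗ slots (map inj₁ (D ++ sep ∷ wc) ,, [] ,, [] ,, [] ,, [] ,, ⟨⟩)
      initial≗ = slots-unique in-slot elsewhere
        where
        in-slot : ∀ k → initialStore reducer w (ι k) ≡ Vec.lookup (map inj₁ (D ++ sep ∷ wc) ,, [] ,, [] ,, [] ,, [] ,, ⟨⟩) k
        in-slot 0F = cong (map inj₁) w≡
        in-slot 1F = refl
        in-slot 2F = refl
        in-slot 3F = refl
        in-slot 4F = refl
        elsewhere : ∀ v → (∀ k → ι k ≢ v) → initialStore reducer w v ≡ []
        elsewhere (rd inp) ∉ι = ⊥-elim (∉ι 0F refl)
        elsewhere (rd dd) ∉ι = refl
        elsewhere (rd bin) ∉ι = refl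
        elsewhere (rd (lvl _ _)) ∉ι = refl
        elsewhere scr ∉ι = refl
        elsewhere out ∉ι = refl

      prepared≗ : slots ((sink ∷ lin ∷ map inj₁ wc) ,, map inj₁ D ,, map inj₁ (bits (2 + length wc)) ,, [] ,, [] ,, ⟨⟩) ≗ store ρ []
      prepared≗ v = sym (slots-unique in-slot elsewhere v)
        where
        in-slot : ∀ k → store ρ [] (ι k) ≡ Vec.lookup ((sink ∷ lin ∷ map inj₁ wc) ,, map inj₁ D ,, map inj₁ (bits (2 + length wc)) ,, [] ,, [] ,, ⟨⟩) k
        in-slot 0F = refl
        in-slot 1F = refl
        in-slot 2F = cong (λ m → map inj₁ (bits (2 + m))) (sym (length-weights c))
        in-slot 3F = refl
        in-slot 4F = refl
        elsewhere : ∀ v → (∀ k → ι k ≢ v) → store ρ [] v ≡ []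
        elsewhere (rd inp) ∉ι = ⊥-elim (∉ι 0F refl)
        elsewhere (rd dd) ∉ι = ⊥-elim (∉ι 1F refl)
        elsewhere (rd bin) ∉ι = ⊥-elim (∉ι 2F refl)
        elsewhere (rd (lvl _ _)) ∉ι = refl
        elsewhere scr ∉ι = refl
        elsewhere out ∉ι = refl

      bounded : Bounded N ρ
      bounded inp       = ℕ.≤-trans (ℕ.≤-reflexive (cong (λ m → suc (suc m)) (length-symbols wc))) wc≤N
      bounded dd        = ℕ.≤-trans (ℕ.≤-reflexive (length-symbols D)) D≤N
      bounded bin       = ℕ.≤-trans (ℕ.≤-reflexive (length-symbols (bits (size (weights c)))))
                            (ℕ.≤-trans (length-bits (size (weights c)))
                              (ℕ.≤-trans (ℕ.≤-reflexive (cong (λ m → suc (suc m)) (sym (length-weights c)))) wc≤N))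
      bounded (lvl _ _) = z≤n

      reducer-triple : Triple reducer (initialStore reducer w) (store ρ (⟦ instanceE ⟧ ρ []))
                              (prepareTime N + time instanceE N)
      reducer-triple =
        restate initial≗ prepared≗ (prepare-triple (signed-unlessSep d) D≤N wc≤N)
          ⟫ compile-correct instanceE (λ _ _ _ → refl) bounded

-- Real arithmetic through rational sequences

module Reals where

  open import Algebra.Bundles using (CommutativeRing)
  open import Data.Rational.Base using (ℚ; 0ℚ; 1ℚ; ½; _+_; _*_; _-_; -_; _<_; _≤_; ∣_∣; Positive; 1/_; positive; nonNegative; mkℚ; toℚᵘ)
  import Data.Rational.Base as ℚ
  open import Data.Rational.Properties
  open import Data.Rational.Solver using (module +-*-Solver)
  open import Level using (0ℓ)
  open +-*-Solver

  0<½* : ∀ {ε} → 0ℚ < ε → 0ℚ < ½ * ε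
  0<½* {ε} 0<ε = subst (_< ½ * ε) (*-zeroʳ ½) (*-monoʳ-<-pos ½ 0<ε)

  halves : ∀ ε → ½ * ε + ½ * ε ≡ ε
  halves ε = trans (sym (*-distribʳ-+ ε ½ ½)) (*-identityˡ ε)

  *-pos : ∀ {p q} → 0ℚ < p → 0ℚ < q → 0ℚ < p * q
  *-pos {p} {q} 0<p 0<q = subst (_< p * q) (*-zeroʳ p) (*-monoʳ-<-pos p {{positive 0<p}} 0<q)

  *-nonneg : ∀ {p q} → 0ℚ ≤ p → 0ℚ ≤ q → 0ℚ ≤ p * q
  *-nonneg {p} {q} 0≤p 0≤q = subst (_≤ p * q) (*-zeroʳ p) (*-monoˡ-≤-nonNeg p {{nonNegative 0≤p}} 0≤q)

  p≤∣p∣ : ∀ p → p ≤ ∣ p ∣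
  p≤∣p∣ p with ∣p∣≡p∨∣p∣≡-p p | ≤-total 0ℚ p
  ... | inj₁ e | _        = ≤-reflexive (sym e)
  ... | inj₂ e | inj₁ 0≤p = ≤-reflexive (sym (0≤p⇒∣p∣≡p 0≤p))
  ... | inj₂ e | inj₂ p≤0 = ≤-trans p≤0 (0≤∣p∣ p)

  -p≤∣p∣ : ∀ p → - p ≤ ∣ p ∣
  -p≤∣p∣ p = subst (- p ≤_) (∣-p∣≡∣p∣ p) (p≤∣p∣ (- p))

  ∣p∣<q : ∀ {p q} → p < q → - p < q → ∣ p ∣ < q
  ∣p∣<q {p} p<q -p<q with ∣p∣≡p∨∣p∣≡-p p
  ... | inj₁ e = subst (_< _) (sym e) p<q
  ... | inj₂ e = subst (_< _) (sym e) -p<q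

  ∣p∣<q⇒0<p+q : ∀ {p q} → ∣ p ∣ < q → 0ℚ < p + q
  ∣p∣<q⇒0<p+q {p} {q} h = subst (_< p + q) (+-inverseʳ p) (+-monoʳ-< p (≤-<-trans (-p≤∣p∣ p) h))

  square-nonneg : ∀ p → 0ℚ ≤ p * p
  square-nonneg p with ≤-total 0ℚ p
  ... | inj₁ 0≤p = *-nonneg 0≤p 0≤p
  ... | inj₂ p≤0 = subst (0ℚ ≤_) (solve 1 (λ p → (:- p) :* (:- p) := p :* p) refl p)
                     (*-nonneg (neg-antimono-≤ p≤0) (neg-antimono-≤ p≤0))

  <⇒0< : ∀ {p q} → p < q → 0ℚ < q - p
  <⇒0< {p} {q} p<q = subst (_< q - p) (+-inverseʳ p) (+-monoˡ-< (- p) p<q)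

  0<⇒< : ∀ {p q} → 0ℚ < q - p → p < q
  0<⇒< {p} {q} h = subst₂ _<_ (+-identityˡ p) (solve 2 (λ p q → (q :- p) :+ p := q) refl p q)
                     (+-monoˡ-< p h)

  ≤⇒0≤ : ∀ {p q} → p ≤ q → 0ℚ ≤ q - p
  ≤⇒0≤ {p} {q} p≤q = subst (_≤ q - p) (+-inverseʳ p) (+-monoˡ-≤ (- p) p≤q)

  Eventually : (ℕ → Set) → Set
  Eventually P = ∃[ N ] ∀ n → N ℕ.≤ n → P n

  both : ∀ {P Q : ℕ → Set} → Eventually P → Eventually Q → Eventually (λ n → P n × Q n)
  both (M , p) (N , q) = M ℕ.⊔ N , λ n h →
    p n (ℕ.m⊔n≤o⇒m≤o M N h) , q n (ℕ.m⊔n≤o⇒n≤o M N h)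

  mapₑ : ∀ {P Q : ℕ → Set} → (∀ n → P n → Q n) → Eventually P → Eventually Q
  mapₑ f (N , p) = N , λ n h → f n (p n h)

  -- Equality of reals is nullity of the difference, and the order likewise becomes `NonNeg∞`; the
  -- laws of both relations reduce to closure properties of these two predicates.
  Null : (ℕ → ℚ) → Set
  Null z = ∀ ε → 0ℚ < ε → Eventually (λ n → ∣ z n ∣ < ε)

  NonNeg∞ : (ℕ → ℚ) → Set
  NonNeg∞ z = ∀ ε → 0ℚ < ε → Eventually (λ n → 0ℚ < z n + ε)

  null-resp : ∀ {z w} → z ≗ w → Null z → Null w
  null-resp eq h ε 0<ε = mapₑ (λ n → subst (λ p → ∣ p ∣ < ε) (eq n)) (h ε 0<ε)

  null-+ : ∀ {z w} → Null z → Null w → Null (λ n → z n + w n)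
  null-+ {z} {w} hz hw ε 0<ε =
    mapₑ (λ n (p , q) → subst (∣ z n + w n ∣ <_) (halves ε)
            (≤-<-trans (∣p+q∣≤∣p∣+∣q∣ (z n) (w n)) (+-mono-< p q)))
         (both (hz _ (0<½* 0<ε)) (hw _ (0<½* 0<ε)))

  EventuallyBounded : (ℕ → ℚ) → Set
  EventuallyBounded x = ∃[ B ] 0ℚ < B × Eventually (λ n → ∣ x n ∣ < B)

  bounded : ∀ x → EventuallyBounded (seq x)
  bounded x with cauchy x 1ℚ (positive⁻¹ 1ℚ)
  ... | N , h = 1ℚ + ∣ seq x N ∣ , +-mono-<-≤ (positive⁻¹ 1ℚ) (0≤∣p∣ (seq x N)) , N , λ n h′ →
    subst (_< 1ℚ + ∣ seq x N ∣)
      (cong ∣_∣ (solve 2 (λ a b → (a :- b) :+ b := a) refl (seq x n) (seq x N)))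
      (≤-<-trans (∣p+q∣≤∣p∣+∣q∣ (seq x n - seq x N) (seq x N))
        (+-monoˡ-< ∣ seq x N ∣ (h n N h′ ℕ.≤-refl)))

  -- A factor below B is compensated by shrinking the other one.
  shrink : ∀ B ε → 0ℚ < B → 0ℚ < ε →
    ∃[ δ ] 0ℚ < δ × (∀ p q → ∣ p ∣ < B → ∣ q ∣ < δ → ∣ p * q ∣ < ε)
  shrink B ε 0<B 0<ε = δ , *-pos (positive⁻¹ (1/ B)) 0<ε , bound
    where
    instance
      _ = positive 0<B
      _ = pos⇒nonZero B
      _ = 1/pos⇒pos B
    δ : ℚ
    δ = 1/ B * ε
    bound : ∀ p q → ∣ p ∣ < B → ∣ q ∣ < δ → ∣ p * q ∣ < ε
    bound p q hp hq = begin-strict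
      ∣ p * q ∣       ≡⟨ ∣p*q∣≡∣p∣*∣q∣ p q ⟩
      ∣ p ∣ * ∣ q ∣   ≤⟨ *-monoʳ-≤-nonNeg ∣ q ∣ {{∣-∣-nonNeg q}} (<⇒≤ hp) ⟩
      B * ∣ q ∣       <⟨ *-monoʳ-<-pos B hq ⟩
      B * (1/ B * ε)  ≡⟨ *-assoc B (1/ B) ε ⟨
      B * 1/ B * ε    ≡⟨ cong (_* ε) (*-inverseʳ B) ⟩
      1ℚ * ε          ≡⟨ *-identityˡ ε ⟩
      ε               ∎
      where open ≤-Reasoning

  null-* : ∀ {x z} → EventuallyBounded x → Null z → Null (λ n → x n * z n)
  null-* (B , 0<B , hB) hz ε 0<ε with shrink B ε 0<B 0<ε
  ... | δ , 0<δ , h = mapₑ (λ n (p , q) → h _ _ p q) (both hB (hz δ 0<δ))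

  nonneg∞-resp : ∀ {z w} → z ≗ w → NonNeg∞ z → NonNeg∞ w
  nonneg∞-resp eq h ε 0<ε = mapₑ (λ n → subst (λ p → 0ℚ < p + ε) (eq n)) (h ε 0<ε)

  nonneg∞-+ : ∀ {z w} → NonNeg∞ z → NonNeg∞ w → NonNeg∞ (λ n → z n + w n)
  nonneg∞-+ {z} {w} hz hw ε 0<ε =
    mapₑ (λ n (p , q) → subst (0ℚ <_)
            (trans (solve 3 (λ z w e → (z :+ e) :+ (w :+ e) := (z :+ w) :+ (e :+ e)) refl (z n) (w n) (½ * ε))
                   (cong (z n + w n +_) (halves ε)))
            (+-mono-< p q))
         (both (hz _ (0<½* 0<ε)) (hw _ (0<½* 0<ε)))

  null⇒nonneg∞ : ∀ {z} → Null z → NonNeg∞ z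
  null⇒nonneg∞ h ε 0<ε = mapₑ (λ _ → ∣p∣<q⇒0<p+q) (h ε 0<ε)

  pointwise⇒nonneg∞ : ∀ {z} → (∀ n → 0ℚ ≤ z n) → NonNeg∞ z
  pointwise⇒nonneg∞ h ε 0<ε = 0 , λ n _ → +-mono-≤-< (h n) 0<ε

  private
    negative-small : ∀ {p δ} → p ≤ 0ℚ → 0ℚ < δ → 0ℚ < p + δ → ∣ p ∣ < δ
    negative-small {p} {δ} p≤0 0<δ h = ∣p∣<q (≤-<-trans p≤0 0<δ)
      (0<⇒< (subst (0ℚ <_) (solve 2 (λ p d → p :+ d := d :- (:- p)) refl p δ) h))

  -- The product is negative only where one factor is; there that factor is close to 0 while the
  -- other one is bounded.
  nonneg∞-* : ∀ {x y} → EventuallyBounded x → EventuallyBounded y →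
              NonNeg∞ x → NonNeg∞ y → NonNeg∞ (λ n → x n * y n)
  nonneg∞-* {x} {y} (B , 0<B , hB) (B′ , 0<B′ , hB′) hx hy ε 0<ε
    with shrink B ε 0<B 0<ε | shrink B′ ε 0<B′ 0<ε
  ... | δ , 0<δ , h | δ′ , 0<δ′ , h′ =
    mapₑ case (both (both hB hB′) (both (hx δ′ 0<δ′) (hy δ 0<δ)))
    where
    case : ∀ n → (∣ x n ∣ < B × ∣ y n ∣ < B′) × (0ℚ < x n + δ′ × 0ℚ < y n + δ) → 0ℚ < x n * y n + ε
    case n ((bx , by) , (px , py)) with ≤-total 0ℚ (x n) | ≤-total 0ℚ (y n)
    ... | inj₁ 0≤x | inj₁ 0≤y = +-mono-≤-< (*-nonneg 0≤x 0≤y) 0<ε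
    ... | inj₁ 0≤x | inj₂ y≤0 = ∣p∣<q⇒0<p+q (h (x n) (y n) bx (negative-small y≤0 0<δ py))
    ... | inj₂ x≤0 | _        =
      ∣p∣<q⇒0<p+q (subst (λ p → ∣ p ∣ < ε) (*-comm (y n) (x n)) (h′ (y n) (x n) by (negative-small x≤0 0<δ′ px)))

  -- The ring of real numbers

  ≗⇒≃ℝ : ∀ {x y} → seq x ≗ seq y → x ≃ℝ y
  ≗⇒≃ℝ {x} {y} eq ε 0<ε = 0 , λ n _ →
    subst (_< ε) (sym (cong ∣_∣ (trans (cong (_- seq y n) (eq n)) (+-inverseʳ (seq y n))))) 0<ε

  ≃ℝ-refl : ∀ {x} → x ≃ℝ x
  ≃ℝ-refl {x} = ≗⇒≃ℝ {x} {x} (λ _ → refl)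

  ≃ℝ-sym : ∀ {x y} → x ≃ℝ y → y ≃ℝ x
  ≃ℝ-sym {x} {y} h ε 0<ε = mapₑ (λ n → subst (_< ε)
    (trans (sym (∣-p∣≡∣p∣ (seq x n - seq y n)))
           (cong ∣_∣ (solve 2 (λ a b → :- (a :- b) := b :- a) refl (seq x n) (seq y n))))) (h ε 0<ε)

  ≃ℝ-trans : ∀ {x y z} → x ≃ℝ y → y ≃ℝ z → x ≃ℝ z
  ≃ℝ-trans {x} {y} {z} h h′ =
    null-resp (λ n → solve 3 (λ a b c → (a :- b) :+ (b :- c) := a :- c) refl (seq x n) (seq y n) (seq z n))
              (null-+ h h′)

  +ℝ-cong : ∀ {x y u v} → x ≃ℝ y → u ≃ℝ v → x +ℝ u ≃ℝ y +ℝ v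
  +ℝ-cong {x} {y} {u} {v} h h′ =
    null-resp (λ n → solve 4 (λ x y u v → (x :- y) :+ (u :- v) := (x :+ u) :- (y :+ v)) refl
                       (seq x n) (seq y n) (seq u n) (seq v n))
              (null-+ h h′)

  *ℝ-cong : ∀ {x y u v} → x ≃ℝ y → u ≃ℝ v → x *ℝ u ≃ℝ y *ℝ v
  *ℝ-cong {x} {y} {u} {v} h h′ =
    null-resp (λ n → solve 4 (λ x y u v → u :* (x :- y) :+ y :* (u :- v) := (x :* u) :- (y :* v)) refl
                       (seq x n) (seq y n) (seq u n) (seq v n))
              (null-+ (null-* (bounded u) h) (null-* (bounded y) h′))

  -1ℝ : ℝ
  -1ℝ = fromℚᵘ (mkℚᵘ -[1+ 0 ] 0)

  -- As a product with -1, negation inherits the Cauchy property.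
  -ℝ_ : ℝ → ℝ
  -ℝ x = -1ℝ *ℝ x

  -- Wrapping the equality and the order in records lets Agda infer the numbers
  -- they relate.

  infix 4 _≈_ _≼_

  record _≈_ (x y : ℝ) : Set where
    constructor wrap
    field unwrap : x ≃ℝ y

  record _≼_ (x y : ℝ) : Set where
    constructor wrap≤
    field unwrap≤ : x ≤ℝ y

  open _≈_ public
  open _≼_ public

  pointwise : ∀ {x y} → seq x ≗ seq y → x ≈ y
  pointwise {x} {y} h = wrap (≗⇒≃ℝ {x} {y} h)

  ℝ-commutativeRing : CommutativeRing 0ℓ 0ℓ
  ℝ-commutativeRing = record
    { Carrier = ℝ ; _≈_ = _≈_ ; _+_ = _+ℝ_ ; _*_ = _*ℝ_ ; -_ = -ℝ_ ; 0# = 0ℝ ; 1# = 1ℝ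
    ; isCommutativeRing = record
      { isRing = record
        { +-isAbelianGroup = record
          { isGroup = record
            { isMonoid = record
              { isSemigroup = record
                { isMagma = record
                  { isEquivalence = record
                    { refl  = λ {x} → wrap (≃ℝ-refl {x})
                    ; sym   = λ {x} {y} h → wrap (≃ℝ-sym {x} {y} (unwrap h))
                    ; trans = λ {x} {y} {z} h h′ → wrap (≃ℝ-trans {x} {y} {z} (unwrap h) (unwrap h′)) }
                  ; ∙-cong = λ {x} {y} {u} {v} h h′ → wrap (+ℝ-cong {x} {y} {u} {v} (unwrap h) (unwrap h′)) }
                ; assoc = λ x y z → pointwise (λ n → +-assoc (seq x n) (seq y n) (seq z n)) }
              ; identity = (λ x → pointwise (λ n → +-identityˡ (seq x n)))
                         , (λ x → pointwise (λ n → +-identityʳ (seq x n))) }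
            ; inverse = (λ x → pointwise (λ n → solve 1 (λ x → con (- 1ℚ) :* x :+ x := con 0ℚ) refl (seq x n)))
                      , (λ x → pointwise (λ n → solve 1 (λ x → x :+ con (- 1ℚ) :* x := con 0ℚ) refl (seq x n)))
            ; ⁻¹-cong = λ {x} {y} h → wrap (*ℝ-cong { -1ℝ} { -1ℝ} {x} {y} (≃ℝ-refl { -1ℝ}) (unwrap h)) }
          ; comm = λ x y → pointwise (λ n → +-comm (seq x n) (seq y n)) }
        ; *-cong = λ {x} {y} {u} {v} h h′ → wrap (*ℝ-cong {x} {y} {u} {v} (unwrap h) (unwrap h′))
        ; *-assoc = λ x y z → pointwise (λ n → *-assoc (seq x n) (seq y n) (seq z n))
        ; *-identity = (λ x → pointwise (λ n → *-identityˡ (seq x n)))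
                     , (λ x → pointwise (λ n → *-identityʳ (seq x n)))
        ; distrib = (λ x y z → pointwise (λ n → *-distribˡ-+ (seq x n) (seq y n) (seq z n)))
                  , (λ x y z → pointwise (λ n → *-distribʳ-+ (seq x n) (seq y n) (seq z n))) }
      ; *-comm = λ x y → pointwise (λ n → *-comm (seq x n) (seq y n)) } }

  -- x ≈ y because x − y is a combination of differences of equal reals.

  combine₁ : ∀ {x y a b} p → a ≈ b →
    (∀ n → seq p n * (seq a n - seq b n) ≡ seq x n - seq y n) → x ≈ y
  combine₁ p h e = wrap (null-resp e (null-* (bounded p) (unwrap h)))

  combine₂ : ∀ {x y a b c d} p q → a ≈ b → c ≈ d →
    (∀ n → seq p n * (seq a n - seq b n) + seq q n * (seq c n - seq d n) ≡ seq x n - seq y n) → x ≈ y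
  combine₂ p q h h′ e = wrap (null-resp e (null-+ (null-* (bounded p) (unwrap h)) (null-* (bounded q) (unwrap h′))))

  difference : ∀ {x y} → x ≤ℝ y → NonNeg∞ (λ n → seq y n - seq x n)
  difference {x} {y} h ε 0<ε = mapₑ (λ n p → subst (0ℚ <_)
    (solve 3 (λ x y e → (y :+ e) :- x := (y :- x) :+ e) refl (seq x n) (seq y n) ε) (<⇒0< p)) (h ε 0<ε)

  difference⁻¹ : ∀ {x y} → NonNeg∞ (λ n → seq y n - seq x n) → x ≤ℝ y
  difference⁻¹ {x} {y} h ε 0<ε = mapₑ (λ n p → 0<⇒< (subst (0ℚ <_)
    (solve 3 (λ x y e → (y :- x) :+ e := (y :+ e) :- x) refl (seq x n) (seq y n) ε) p)) (h ε 0<ε)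

  nonneg : ∀ {x} → 0ℝ ≤ℝ x → NonNeg∞ (seq x)
  nonneg {x} h = nonneg∞-resp (λ n → solve 1 (λ x → x :- con 0ℚ := x) refl (seq x n)) (difference {0ℝ} {x} h)

  nonneg⁻¹ : ∀ {x} → NonNeg∞ (seq x) → 0ℝ ≤ℝ x
  nonneg⁻¹ {x} h = difference⁻¹ {0ℝ} {x} (nonneg∞-resp (λ n → solve 1 (λ x → x := x :- con 0ℚ) refl (seq x n)) h)

  ≤-by : ∀ {x y} z → 0ℝ ≤ℝ z → y ≃ℝ x +ℝ z → x ≤ℝ y
  ≤-by {x} {y} z 0≤z eq = difference⁻¹ {x} {y}
    (nonneg∞-resp (λ n → solve 3 (λ x y z → z :+ (y :- (x :+ z)) := y :- x) refl (seq x n) (seq y n) (seq z n))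
      (nonneg∞-+ {seq z} {λ n → seq y n - (seq x n + seq z n)} (nonneg {z} 0≤z) (null⇒nonneg∞ eq)))

  ≤-pointwise : ∀ {x y} → (∀ n → seq x n ≤ seq y n) → x ≤ℝ y
  ≤-pointwise {x} {y} h = difference⁻¹ {x} {y} (pointwise⇒nonneg∞ (λ n → ≤⇒0≤ (h n)))

  ≃ℝ⇒≤ℝ : ∀ {x y} → x ≃ℝ y → x ≤ℝ y
  ≃ℝ⇒≤ℝ {x} {y} h = difference⁻¹ {x} {y} (null⇒nonneg∞ (≃ℝ-sym {x} {y} h))

  ≤ℝ-trans : ∀ {x y z} → x ≤ℝ y → y ≤ℝ z → x ≤ℝ z
  ≤ℝ-trans {x} {y} {z} h h′ = difference⁻¹ {x} {z}
    (nonneg∞-resp (λ n → solve 3 (λ a b c → (b :- a) :+ (c :- b) := c :- a) refl (seq x n) (seq y n) (seq z n))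
      (nonneg∞-+ {λ n → seq y n - seq x n} {λ n → seq z n - seq y n} (difference {x} {y} h) (difference {y} {z} h′)))

  +ℝ-mono-≤ℝ : ∀ {x y u v} → x ≤ℝ y → u ≤ℝ v → x +ℝ u ≤ℝ y +ℝ v
  +ℝ-mono-≤ℝ {x} {y} {u} {v} h h′ = difference⁻¹ {x +ℝ u} {y +ℝ v}
    (nonneg∞-resp (λ n → solve 4 (λ x y u v → (y :- x) :+ (v :- u) := (y :+ v) :- (x :+ u)) refl
                           (seq x n) (seq y n) (seq u n) (seq v n))
      (nonneg∞-+ {λ n → seq y n - seq x n} {λ n → seq v n - seq u n} (difference {x} {y} h) (difference {u} {v} h′)))

  *ℝ-nonneg : ∀ {x y} → 0ℝ ≤ℝ x → 0ℝ ≤ℝ y → 0ℝ ≤ℝ x *ℝ y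
  *ℝ-nonneg {x} {y} h h′ = nonneg⁻¹ {x *ℝ y} (nonneg∞-* (bounded x) (bounded y) (nonneg {x} h) (nonneg {y} h′))

  squareℝ-nonneg : ∀ x → 0ℝ ≤ℝ x *ℝ x
  squareℝ-nonneg x = ≤-pointwise {0ℝ} {x *ℝ x} (λ n → square-nonneg (seq x n))

  *ℝ-monoˡ-≤ℝ : ∀ {x y} z → 0ℝ ≤ℝ z → x ≤ℝ y → z *ℝ x ≤ℝ z *ℝ y
  *ℝ-monoˡ-≤ℝ {x} {y} z 0≤z h = difference⁻¹ {z *ℝ x} {z *ℝ y}
    (nonneg∞-resp (λ n → solve 3 (λ x y z → z :* (y :- x) := z :* y :- z :* x) refl (seq x n) (seq y n) (seq z n))
      (nonneg∞-* (bounded z) bounded-difference (nonneg {z} 0≤z) (difference {x} {y} h)))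
    where
    bounded-difference : EventuallyBounded (λ n → seq y n - seq x n)
    bounded-difference =
      let B , 0<B , hB = bounded (y +ℝ -ℝ x) in
      B , 0<B , mapₑ (λ n → subst (λ p → ∣ p ∣ < B)
        (solve 2 (λ x y → y :+ con (- 1ℚ) :* x := y :- x) refl (seq x n) (seq y n))) hB

  -- a² ≤ b² and 0 ≤ b give a ≤ b: otherwise a ≥ b + ε infinitely often, and
  -- then a² exceeds b² by about ε².
  square-cancel-≤ : ∀ {a b} → 0ℝ ≤ℝ b → a *ℝ a ≤ℝ b *ℝ b → a ≤ℝ b
  square-cancel-≤ {a} {b} 0≤b h ε 0<ε =
    -- The tolerances come from (β + ε)² = β² + ε² / 2 + 2 ε (β + ε / 4).
    mapₑ case (both (nonneg {b} 0≤b (½ * (½ * ε)) (0<½* (0<½* 0<ε))) (h (½ * (ε * ε)) (0<½* (*-pos 0<ε 0<ε))))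
    where
    case : ∀ n → 0ℚ < seq b n + ½ * (½ * ε) × seq a n * seq a n < seq b n * seq b n + ½ * (ε * ε) →
           seq a n < seq b n + ε
    case n (b> , a²<) with seq a n <? seq b n + ε
    ... | yes lt = lt
    ... | no ¬lt = ⊥-elim (<-irrefl refl (<-≤-trans a²< (begin
      β * β + ½ * (ε * ε)
        ≡⟨ +-identityʳ _ ⟨
      β * β + ½ * (ε * ε) + 0ℚ
        ≤⟨ +-monoʳ-≤ (β * β + ½ * (ε * ε))
             (*-nonneg (<⇒≤ (+-mono-< 0<ε 0<ε)) (<⇒≤ b>)) ⟩
      β * β + ½ * (ε * ε) + (ε + ε) * (β + ½ * (½ * ε))
        ≡⟨ solve 2 (λ b e → b :* b :+ con ½ :* (e :* e) :+ (e :+ e) :* (b :+ con ½ :* (con ½ :* e))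
                            := (b :+ e) :* (b :+ e)) refl β ε ⟩
      (β + ε) * (β + ε)
        ≤⟨ *-monoˡ-≤-nonNeg (β + ε) {{nonNegative 0≤β+ε}} (≮⇒≥ ¬lt) ⟩
      (β + ε) * α
        ≤⟨ *-monoʳ-≤-nonNeg α {{nonNegative (≤-trans 0≤β+ε (≮⇒≥ ¬lt))}} (≮⇒≥ ¬lt) ⟩
      α * α ∎)))
      where
      open ≤-Reasoning
      α = seq a n
      β = seq b n
      0≤β+ε : 0ℚ ≤ β + ε
      0≤β+ε = ≤-trans (<⇒≤ b>) (+-monoʳ-≤ β (begin
        ½ * (½ * ε)                  ≡⟨ +-identityʳ _ ⟨
        ½ * (½ * ε) + 0ℚ             ≤⟨ +-monoʳ-≤ (½ * (½ * ε)) (<⇒≤ (+-mono-< (0<½* 0<ε) (0<½* (0<½* 0<ε)))) ⟩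
        ½ * (½ * ε) + (½ * ε + ½ * (½ * ε))
          ≡⟨ solve 1 (λ e → con ½ :* (con ½ :* e) :+ (con ½ :* e :+ con ½ :* (con ½ :* e)) := e) refl ε ⟩
        ε                            ∎))

  ≈⇒≼ : ∀ {x y} → x ≈ y → x ≼ y
  ≈⇒≼ {x} {y} h = wrap≤ (≃ℝ⇒≤ℝ {x} {y} (unwrap h))

  ≼-trans : ∀ {x y z} → x ≼ y → y ≼ z → x ≼ z
  ≼-trans {x} {y} {z} h h′ = wrap≤ (≤ℝ-trans {x} {y} {z} (unwrap≤ h) (unwrap≤ h′))

  +-mono-≼ : ∀ {x y u v} → x ≼ y → u ≼ v → x +ℝ u ≼ y +ℝ v
  +-mono-≼ {x} {y} {u} {v} h h′ = wrap≤ (+ℝ-mono-≤ℝ {x} {y} {u} {v} (unwrap≤ h) (unwrap≤ h′))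

  *-monoˡ-≼ : ∀ {x y} z → 0ℝ ≼ z → x ≼ y → z *ℝ x ≼ z *ℝ y
  *-monoˡ-≼ {x} {y} z h h′ = wrap≤ (*ℝ-monoˡ-≤ℝ {x} {y} z (unwrap≤ h) (unwrap≤ h′))

  *-nonneg-≼ : ∀ {x y} → 0ℝ ≼ x → 0ℝ ≼ y → 0ℝ ≼ x *ℝ y
  *-nonneg-≼ {x} {y} h h′ = wrap≤ (*ℝ-nonneg {x} {y} (unwrap≤ h) (unwrap≤ h′))

  square-nonneg-≼ : ∀ x → 0ℝ ≼ x *ℝ x
  square-nonneg-≼ x = wrap≤ (squareℝ-nonneg x)

  ≼-by : ∀ {x y} z → 0ℝ ≼ z → y ≈ x +ℝ z → x ≼ y
  ≼-by {x} {y} z h e = wrap≤ (≤-by {x} {y} z (unwrap≤ h) (unwrap e))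

  square-cancel-≼ : ∀ {a b} → 0ℝ ≼ b → a *ℝ a ≼ b *ℝ b → a ≼ b
  square-cancel-≼ {a} {b} h h′ = wrap≤ (square-cancel-≤ {a} {b} (unwrap≤ h) (unwrap≤ h′))

  fromℚᵘ-+ : ∀ p q → ℚ.fromℚᵘ (p ℚᵘ.+ q) ≡ ℚ.fromℚᵘ p + ℚ.fromℚᵘ q
  fromℚᵘ-+ p q = toℚᵘ-injective (begin
    toℚᵘ (ℚ.fromℚᵘ (p ℚᵘ.+ q))                     ≈⟨ toℚᵘ-fromℚᵘ (p ℚᵘ.+ q) ⟩
    p ℚᵘ.+ q                                        ≈⟨ ℚᵘ.+-cong (toℚᵘ-fromℚᵘ p) (toℚᵘ-fromℚᵘ q) ⟨
    toℚᵘ (ℚ.fromℚᵘ p) ℚᵘ.+ toℚᵘ (ℚ.fromℚᵘ q)        ≈⟨ toℚᵘ-homo-+ (ℚ.fromℚᵘ p) (ℚ.fromℚᵘ q) ⟨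
    toℚᵘ (ℚ.fromℚᵘ p + ℚ.fromℚᵘ q)                  ∎)
    where open ℚᵘ.≃-Reasoning

  fromℚᵘ-* : ∀ p q → ℚ.fromℚᵘ (p ℚᵘ.* q) ≡ ℚ.fromℚᵘ p * ℚ.fromℚᵘ q
  fromℚᵘ-* p q = toℚᵘ-injective (begin
    toℚᵘ (ℚ.fromℚᵘ (p ℚᵘ.* q))                     ≈⟨ toℚᵘ-fromℚᵘ (p ℚᵘ.* q) ⟩
    p ℚᵘ.* q                                        ≈⟨ ℚᵘ.*-cong (toℚᵘ-fromℚᵘ p) (toℚᵘ-fromℚᵘ q) ⟨
    toℚᵘ (ℚ.fromℚᵘ p) ℚᵘ.* toℚᵘ (ℚ.fromℚᵘ q)        ≈⟨ toℚᵘ-homo-* (ℚ.fromℚᵘ p) (ℚ.fromℚᵘ q) ⟨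
    toℚᵘ (ℚ.fromℚᵘ p * ℚ.fromℚᵘ q)                  ∎)
    where open ℚᵘ.≃-Reasoning

  fromℚᵘ-mono-≤ : ∀ {p q} → p ℚᵘ.≤ q → ℚ.fromℚᵘ p ≤ ℚ.fromℚᵘ q
  fromℚᵘ-mono-≤ {p} {q} h = toℚᵘ-cancel-≤
    (ℚᵘ.≤-respˡ-≃ (ℚᵘ.≃-sym (toℚᵘ-fromℚᵘ p)) (ℚᵘ.≤-respʳ-≃ (ℚᵘ.≃-sym (toℚᵘ-fromℚᵘ q)) h))

  fromℚᵘ-mono-< : ∀ {p q} → p ℚᵘ.< q → ℚ.fromℚᵘ p < ℚ.fromℚᵘ q
  fromℚᵘ-mono-< {p} {q} h = toℚᵘ-cancel-<
    (ℚᵘ.<-respˡ-≃ (ℚᵘ.≃-sym (toℚᵘ-fromℚᵘ p)) (ℚᵘ.<-respʳ-≃ (ℚᵘ.≃-sym (toℚᵘ-fromℚᵘ q)) h))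

  constant-+ : ∀ {p q r} → p ℚᵘ.+ q ℚᵘ.≃ r → fromℚᵘ p +ℝ fromℚᵘ q ≈ fromℚᵘ r
  constant-+ {p} {q} {r} h = pointwise
    (λ _ → trans (sym (fromℚᵘ-+ p q)) (fromℚᵘ-cong h))

  constant-* : ∀ {p q r} → p ℚᵘ.* q ℚᵘ.≃ r → fromℚᵘ p *ℝ fromℚᵘ q ≈ fromℚᵘ r
  constant-* {p} {q} {r} h = pointwise
    (λ _ → trans (sym (fromℚᵘ-* p q)) (fromℚᵘ-cong h))

  constant-≤ : ∀ {p q} → p ℚᵘ.≤ q → fromℚᵘ p ≼ fromℚᵘ q
  constant-≤ {p} {q} h = wrap≤ (≤-pointwise {fromℚᵘ p} {fromℚᵘ q} (λ _ → fromℚᵘ-mono-≤ h))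

  constant-≰ : ∀ {p q} → q ℚᵘ.< p → fromℚᵘ p ≼ fromℚᵘ q → ⊥
  constant-≰ {p} {q} q<p h =
    -- At the tolerance p - q the constant sequences would satisfy p < q + (p - q).
    let N , h′ = unwrap≤ h (ℚ.fromℚᵘ p - ℚ.fromℚᵘ q) (<⇒0< (fromℚᵘ-mono-< q<p)) in
    <-irrefl (solve 2 (λ p q → p := q :+ (p :- q)) refl (ℚ.fromℚᵘ p) (ℚ.fromℚᵘ q)) (h′ N ℕ.≤-refl)

  floorSqrt : ∀ n → ∃[ a ] (a ℕ.* a ℕ.≤ n) × (n ℕ.< suc a ℕ.* suc a)
  floorSqrt zero    = 0 , z≤n , s≤s z≤n
  floorSqrt (suc n) with floorSqrt n
  ... | a , a²≤n , n< with suc a ℕ.* suc a ℕ.≤? suc n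
  ...   | no ¬le = a , ℕ.m≤n⇒m≤1+n a²≤n , ℕ.≰⇒> ¬le
  ...   | yes le = suc a , le , ℕ.≤-<-trans n< (ℕ.*-mono-< (ℕ.n<1+n (suc a)) (ℕ.n<1+n (suc a)))

  -- Square roots of natural numbers

  fraction : ℕ → ℕ → ℚ
  fraction k n = ℚ.fromℚᵘ (mkℚᵘ (ℤ.+ k) n)

  fraction-suc : ∀ k n → fraction (suc k) n ≡ fraction k n + fraction 1 n
  fraction-suc k n = trans (fromℚᵘ-cong {mkℚᵘ (ℤ.+ suc k) n} {mkℚᵘ (ℤ.+ k) n ℚᵘ.+ mkℚᵘ (ℤ.+ 1) n} (ℚᵘ.≃-sym (*≡* (identity (ℤ.+ k) (ℤ.+ suc n)))))
                           (fromℚᵘ-+ (mkℚᵘ (ℤ.+ k) n) (mkℚᵘ (ℤ.+ 1) n))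
    where
    open import Data.Integer.Tactic.RingSolver using (solve-∀)
    identity : ∀ x y → (x ℤ.* y ℤ.+ ℤ.+ 1 ℤ.* y) ℤ.* y ≡ (ℤ.+ 1 ℤ.+ x) ℤ.* (y ℤ.* y)
    identity = solve-∀

  fraction-nonneg : ∀ k n → 0ℚ ≤ fraction k n
  fraction-nonneg k n = fromℚᵘ-mono-≤ {0ℚᵘ} (ℚᵘ.nonNegative⁻¹ (mkℚᵘ (ℤ.+ k) n))

  fraction-null : Null (fraction 1)
  fraction-null ε 0<ε = positive-case ε (positive 0<ε)
    where
    positive-case : ∀ ε → Positive ε → Eventually (λ n → ∣ fraction 1 n ∣ < ε)
    positive-case ε@(mkℚ (ℤ.+ suc p) d _) _ = suc d , λ n d<n →
      subst (_< ε) (sym (0≤p⇒∣p∣≡p (fraction-nonneg 1 n)))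
        (toℚᵘ-cancel-< (ℚᵘ.<-respˡ-≃ (ℚᵘ.≃-sym (toℚᵘ-fromℚᵘ (mkℚᵘ (ℤ.+ 1) n)))
          (*<* (subst₂ ℤ._<_ (sym (ℤ.*-identityˡ (ℤ.+ suc d))) (ℤ.pos-* (suc p) (suc n))
            (ℤ.+<+ (ℕ.<-≤-trans (s≤s d<n) (ℕ.m≤n*m (suc n) (suc p))))))))
    positive-case (mkℚ (ℤ.+ zero) d _) record { pos = () }
    positive-case (mkℚ -[1+ p ] d _) record { pos = () }

  private
    square-≤ : ∀ {k n c} → k ℕ.* k ℕ.≤ c ℕ.* (suc n ℕ.* suc n) → fraction k n * fraction k n ≤ fraction c 0
    square-≤ {k} {n} {c} h = subst (_≤ fraction c 0) (fromℚᵘ-* (mkℚᵘ (ℤ.+ k) n) (mkℚᵘ (ℤ.+ k) n))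
      (fromℚᵘ-mono-≤ {mkℚᵘ (ℤ.+ k) n ℚᵘ.* mkℚᵘ (ℤ.+ k) n} {mkℚᵘ (ℤ.+ c) 0} (*≤* (subst₂ ℤ._≤_ (trans (ℤ.pos-* k k) (sym (ℤ.*-identityʳ _)))
        (ℤ.pos-* c (suc n ℕ.* suc n)) (ℤ.+≤+ h))))

    square-> : ∀ {k n c} → c ℕ.* (suc n ℕ.* suc n) ℕ.< k ℕ.* k → fraction c 0 < fraction k n * fraction k n
    square-> {k} {n} {c} h = subst (fraction c 0 <_) (fromℚᵘ-* (mkℚᵘ (ℤ.+ k) n) (mkℚᵘ (ℤ.+ k) n))
      (fromℚᵘ-mono-< {mkℚᵘ (ℤ.+ c) 0} {mkℚᵘ (ℤ.+ k) n ℚᵘ.* mkℚᵘ (ℤ.+ k) n} (*<* (subst₂ ℤ._<_ (ℤ.pos-* c (suc n ℕ.* suc n))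
        (trans (ℤ.pos-* k k) (sym (ℤ.*-identityʳ _))) (ℤ.+<+ h))))

    square-cancel-< : ∀ {p q} → 0ℚ ≤ q → p * p < q * q → p < q
    square-cancel-< {p} {q} 0≤q h with p <? q
    ... | yes lt = lt
    ... | no ¬lt = ⊥-elim (<-irrefl refl (<-≤-trans h (≤-trans
      (*-monoˡ-≤-nonNeg q {{nonNegative 0≤q}} (≮⇒≥ ¬lt))
      (*-monoʳ-≤-nonNeg p {{nonNegative (≤-trans 0≤q (≮⇒≥ ¬lt))}} (≮⇒≥ ¬lt)))))

  module _ (c : ℕ) where

    private
      -- `root n` / (n + 1) is √c rounded down to a multiple of 1 / (n + 1).
      root : ℕ → ℕ
      root n = proj₁ (floorSqrt (c ℕ.* (suc n ℕ.* suc n)))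

      approx : ℕ → ℚ
      approx n = fraction (root n) n

      approx-nonneg : ∀ n → 0ℚ ≤ approx n
      approx-nonneg n = fraction-nonneg (root n) n

      below : ∀ n → approx n * approx n ≤ fraction c 0
      below n = square-≤ {root n} {n} {c} (proj₁ (proj₂ (floorSqrt (c ℕ.* (suc n ℕ.* suc n)))))

      above : ∀ n → fraction c 0 < (approx n + fraction 1 n) * (approx n + fraction 1 n)
      above n = subst (λ p → fraction c 0 < p * p) (fraction-suc (root n) n)
        (square-> {suc (root n)} {n} {c} (proj₂ (proj₂ (floorSqrt (c ℕ.* (suc n ℕ.* suc n))))))

      -- The indices are unrelated because both sides are compared with c: the square of the left is
      -- at most c, that of the right exceeds it.
      close : ∀ m n → approx m < approx n + fraction 1 n
      close m n = square-cancel-< (+-mono-≤ (approx-nonneg n) (fraction-nonneg 1 n))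
                    (≤-<-trans (below m) (above n))

      approx-cauchy : IsCauchy approx
      approx-cauchy ε 0<ε =
        let N , small = fraction-null ε 0<ε
            near : ∀ m n → N ℕ.≤ n → approx m - approx n < ε
            near m n h = <-trans
              (0<⇒< (subst (0ℚ <_) (solve 3 (λ x y e → (y :+ e) :- x := e :- (x :- y)) refl
                                     (approx m) (approx n) (fraction 1 n)) (<⇒0< (close m n))))
              (≤-<-trans (p≤∣p∣ (fraction 1 n)) (small n h))
        in  N , λ m n hm hn → ∣p∣<q (near m n hn)
              (subst (_< ε) (solve 2 (λ x y → y :- x := :- (x :- y)) refl (approx m) (approx n)) (near n m hm))

    abstract
      √ : ℝ
      √ = mkℝ approx approx-cauchy

      -- The width (a + δ)² - a² of the interval in which `below` and `above` enclose c.
      gap-null : Null (λ n → approx n * fraction 1 n + approx n * fraction 1 n + fraction 1 n * fraction 1 n)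
      gap-null = null-+ (null-+ part part)
                     (null-* (1ℚ , positive⁻¹ 1ℚ , fraction-null 1ℚ (positive⁻¹ 1ℚ)) fraction-null)
          where
          part : Null (λ n → approx n * fraction 1 n)
          part = null-* (bounded √) fraction-null

      √-isSqrt : IsSqrt √ c
      √-isSqrt = ≤-pointwise {0ℝ} {√} approx-nonneg , λ ε 0<ε →
        mapₑ (λ n small → ∣p∣<q
          (≤-<-trans (subst (approx n * approx n - fraction c 0 ≤_) (+-inverseʳ (fraction c 0))
                       (+-monoˡ-≤ (- fraction c 0) (below n))) 0<ε)
          (<-trans
            (0<⇒< (subst (0ℚ <_)
              (solve 3 (λ c s e → (s :+ e) :* (s :+ e) :- c := (s :* e :+ s :* e :+ e :* e) :- (:- (s :* s :- c)))
                refl (fraction c 0) (approx n) (fraction 1 n))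
              (<⇒0< (above n))))
            (≤-<-trans (p≤∣p∣ _) small)))
          (gap-null ε 0<ε)

  abstract
    √0≈0 : √ 0 ≈ 0ℝ
    √0≈0 = pointwise (λ n → fromℚᵘ-cong {mkℚᵘ (ℤ.+ 0) n} {0ℚᵘ} (*≡* refl))

-- Correctness of the reduction

module Correctness where

  open Instances
  open Reals
  open import Algebra.Bundles using (CommutativeRing)
  open import Data.List.Base using (lookup)
  import Algebra.Properties.CommutativeMonoid.Sum as CommutativeMonoidSum
  import Algebra.Properties.Semiring.Sum as SemiringSum
  open import Data.Rational.Base using (ℚ; 0ℚ; 1ℚ; _+_; _*_; _-_; -_)
  import Data.Rational.Base as ℚ
  import Data.Rational.Properties as ℚ
  open import Data.Rational.Solver using (module +-*-Solver)
  open +-*-Solver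
  module R = CommutativeRing ℝ-commutativeRing
  open import Relation.Binary.Reasoning.Setoid R.setoid

  combine₃ : ∀ {x y a b c d e f} p q r → a ≈ b → c ≈ d → e ≈ f →
    (∀ n → seq p n * (seq a n - seq b n) + seq q n * (seq c n - seq d n) + seq r n * (seq e n - seq f n)
             ≡ seq x n - seq y n) → x ≈ y
  combine₃ p q r h h′ h″ eq = wrap (null-resp eq
    (null-+ (null-+ (null-* (bounded p) (unwrap h)) (null-* (bounded q) (unwrap h′))) (null-* (bounded r) (unwrap h″))))

  difference-nonneg : ∀ {x y} → x ≼ y → 0ℝ ≼ y +ℝ (-ℝ x)
  difference-nonneg {x} {y} h =
    ≼-trans (≈⇒≼ (R.sym (R.-‿inverseʳ x))) (+-mono-≼ h (≈⇒≼ (R.refl { -ℝ x})))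

  -- The counterpart of `combine₁` for the order: an inequality times a nonnegative factor, up to a
  -- ring identity.
  ≼-scale : ∀ {x y x′ y′} q → 0ℝ ≼ q → x ≼ y →
    (∀ n → seq q n * (seq y n - seq x n) ≡ seq y′ n - seq x′ n) → x′ ≼ y′
  ≼-scale {x} {y} {x′} {y′} q 0≤q x≤y h =
    ≼-by (q *ℝ (y +ℝ (-ℝ x))) (*-nonneg-≼ 0≤q (difference-nonneg x≤y)) (pointwise (λ n → ≡.trans
      (solve 2 (λ x′ y′ → y′ := x′ :+ (y′ :- x′)) refl (seq x′ n) (seq y′ n))
      (cong (seq x′ n +_) (≡.trans (≡.sym (h n))
        (solve 3 (λ q x y → q :* (y :- x) := q :* (y :+ con (- 1ℚ) :* x)) refl (seq q n) (seq x n) (seq y n))))))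

  sum-cong : ∀ {n} {f g : Vector ℝ n} → (∀ i → f i ≈ g i) → sumℝ f ≈ sumℝ g
  sum-cong = CommutativeMonoidSum.sum-cong-≋ R.+-commutativeMonoid

  sum-+ : ∀ {n} (f g : Vector ℝ n) → sumℝ (λ i → f i +ℝ g i) ≈ sumℝ f +ℝ sumℝ g
  sum-+ = CommutativeMonoidSum.∑-distrib-+ R.+-commutativeMonoid

  sum-*ˡ : ∀ {n} c (f : Vector ℝ n) → sumℝ (λ i → c *ℝ f i) ≈ c *ℝ sumℝ f
  sum-*ˡ c f = R.sym (SemiringSum.*-distribˡ-sum R.semiring c f)

  sum-*ʳ : ∀ {n} c (f : Vector ℝ n) → sumℝ (λ i → f i *ℝ c) ≈ sumℝ f *ℝ c
  sum-*ʳ c f = R.sym (SemiringSum.*-distribʳ-sum R.semiring c f)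

  sum-zero : ∀ {n} {f : Vector ℝ n} → (∀ i → f i ≈ 0ℝ) → sumℝ f ≈ 0ℝ
  sum-zero {n} h = R.trans (sum-cong h) (CommutativeMonoidSum.sum-replicate-zero R.+-commutativeMonoid n)

  sum-point : ∀ {n} (i : Fin n) {y} {f : Vector ℝ n} →
    (∀ j → f j ≈ (if does (j Fin.≟ i) then y else 0ℝ)) → sumℝ f ≈ y
  sum-point zero    {y} h = R.trans (R.+-cong (h zero) (sum-zero (h ∘ suc))) (R.+-identityʳ y)
  sum-point (suc i) {y} h = R.trans (R.+-cong (h zero) (sum-point i (h ∘ suc))) (R.+-identityˡ y)

  sum-mono : ∀ {n} {f g : Vector ℝ n} → (∀ i → f i ≼ g i) → sumℝ f ≼ sumℝ g
  sum-mono {zero}  h = ≈⇒≼ R.refl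
  sum-mono {suc n} h = +-mono-≼ (h zero) (sum-mono (h ∘ suc))

  +-nonneg : ∀ {x y} → 0ℝ ≼ x → 0ℝ ≼ y → 0ℝ ≼ x +ℝ y
  +-nonneg h h′ = ≼-trans (≈⇒≼ (R.sym (R.+-identityˡ 0ℝ))) (+-mono-≼ h h′)

  sum-nonneg : ∀ {n} {f : Vector ℝ n} → (∀ i → 0ℝ ≼ f i) → 0ℝ ≼ sumℝ f
  sum-nonneg {zero}  h = ≈⇒≼ R.refl
  sum-nonneg {suc n} h = +-nonneg (h zero) (sum-nonneg (h ∘ suc))

  natℝ : ℕ → ℝ
  natℝ n = fromℚᵘ (natℚᵘ n)

  natℝ-nonneg : ∀ n → 0ℝ ≼ natℝ n
  natℝ-nonneg n = constant-≤ (ℚᵘ.nonNegative⁻¹ (natℚᵘ n))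

  natℝ-+ : ∀ a b → natℝ (a ℕ.+ b) ≈ natℝ a +ℝ natℝ b
  natℝ-+ a b = R.sym (constant-+ {natℚᵘ a} {natℚᵘ b} {natℚᵘ (a ℕ.+ b)} (*≡* (cong (ℤ._* ℤ.+ 1)
    (≡.trans (≡.cong₂ ℤ._+_ (ℤ.*-identityʳ (ℤ.+ a)) (ℤ.*-identityʳ (ℤ.+ b))) refl))))

  natℝ-double : ∀ a → natℝ (a ℕ.* 2) ≈ natℝ a +ℝ natℝ a
  natℝ-double a = subst (λ n → natℝ n ≈ natℝ a +ℝ natℝ a) a+a≡a*2 (natℝ-+ a a)
    where
    a+a≡a*2 : a ℕ.+ a ≡ a ℕ.* 2
    a+a≡a*2 = ≡.sym (≡.trans (ℕ.*-comm a 2) (cong (a ℕ.+_) (ℕ.+-identityʳ a)))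

  natℝ-mono : ∀ {a b} → a ℕ.≤ b → natℝ a ≼ natℝ b
  natℝ-mono {a} {b} h = constant-≤ {natℚᵘ a} {natℚᵘ b} (*≤* (ℤ.*-monoʳ-≤-nonNeg (ℤ.+ 1) (ℤ.+≤+ h)))

  reciprocal : ℕ → ℝ
  reciprocal t = fromℚᵘ (mkℚᵘ (ℤ.+ 1) t)

  reciprocal-nonneg : ∀ t → 0ℝ ≼ reciprocal t
  reciprocal-nonneg t = constant-≤ (ℚᵘ.nonNegative⁻¹ (mkℚᵘ (ℤ.+ 1) t))

  reciprocal-* : ∀ t k → reciprocal t *ℝ natℝ k ≈ fromℚᵘ (mkℚᵘ (ℤ.+ k) t)
  reciprocal-* t k = constant-* {mkℚᵘ (ℤ.+ 1) t} {natℚᵘ k} {mkℚᵘ (ℤ.+ k) t} (*≡* (≡.cong₂ ℤ._*_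
    (ℤ.*-identityˡ (ℤ.+ k)) (cong ℤ.+_ (≡.sym (ℕ.*-identityʳ (suc t))))))

  reciprocal-inverse : ∀ t → reciprocal t *ℝ natℝ (suc t) ≈ 1ℝ
  reciprocal-inverse t = R.trans (reciprocal-* t (suc t))
    (pointwise (λ _ → ℚ.fromℚᵘ-cong {mkℚᵘ (ℤ.+ suc t) t} {1ℚᵘ} (*≡* (ℤ.*-comm (ℤ.+ suc t) (ℤ.+ 1)))))

  fromℚᵘ-neg : ∀ p → ℚ.fromℚᵘ (ℚᵘ.- p) ≡ - ℚ.fromℚᵘ p
  fromℚᵘ-neg p = ℚ.toℚᵘ-injective (ℚᵘ.≃-trans (ℚ.toℚᵘ-fromℚᵘ (ℚᵘ.- p)) (ℚᵘ.≃-sym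
    (ℚᵘ.≃-trans (ℚ.toℚᵘ-homo‿- (ℚ.fromℚᵘ p)) (ℚᵘ.-‿cong (ℚ.toℚᵘ-fromℚᵘ p)))))

  -- The Bellman equations of the instance

  module Bellman (m t : ℕ) (w : Fin m → ℕ) where

    open Blind m t w renaming (states to K)

    κ T D : ℝ
    κ = reciprocal (suc m)
    T = natℝ t
    D = natℝ (suc t)

    item : Fin m → Fin K
    item j = suc (suc j)

    private
      γ μ : ℚᵘ
      γ = mkℚᵘ (ℤ.+ t) t
      μ = mkℚᵘ (ℤ.+ 1) (suc m)

      D≈1+T : D ≈ 1ℝ +ℝ T
      D≈1+T = natℝ-+ 1 t

      γD≈T : fromℚᵘ γ *ℝ D ≈ T
      γD≈T = begin
        fromℚᵘ γ *ℝ D               ≈⟨ R.*-congʳ (R.sym (reciprocal-* t t)) ⟩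
        reciprocal t *ℝ T *ℝ D      ≈⟨ combine₁ T (reciprocal-inverse t)
          (λ n → solve 3 (λ r T D → T :* (r :* D :- con 1ℚ) := r :* T :* D :- T) refl
                   (seq (reciprocal t) n) (seq T n) (seq D n)) ⟩
        T                           ∎

      μD≈κ : fromℚᵘ ((1ℚᵘ ℚᵘ.- γ) ℚᵘ.* μ) *ℝ D ≈ κ
      μD≈κ = begin
        fromℚᵘ ((1ℚᵘ ℚᵘ.- γ) ℚᵘ.* μ) *ℝ D
          ≈⟨ R.*-congʳ {D} split ⟩
        (1ℝ +ℝ -ℝ fromℚᵘ γ) *ℝ κ *ℝ D
          ≈⟨ combine₂ κ (-ℝ κ) D≈1+T γD≈T
               (λ n → solve 4 (λ γ k D T → k :* (D :- (con 1ℚ :+ T)) :+ con (- 1ℚ) :* k :* (γ :* D :- T)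
                                  := (con 1ℚ :+ con (- 1ℚ) :* γ) :* k :* D :- k) refl
                        (seq (fromℚᵘ γ) n) (seq κ n) (seq D n) (seq T n)) ⟩
        κ ∎
        where
        split : fromℚᵘ ((1ℚᵘ ℚᵘ.- γ) ℚᵘ.* μ) ≈ (1ℝ +ℝ -ℝ fromℚᵘ γ) *ℝ κ
        split = pointwise (λ _ → ≡.trans (fromℚᵘ-* (1ℚᵘ ℚᵘ.- γ) μ) (cong (_* ℚ.fromℚᵘ μ)
          (≡.trans (fromℚᵘ-+ 1ℚᵘ (ℚᵘ.- γ)) (cong (1ℚ +_) (≡.trans (fromℚᵘ-neg γ)
            (solve 1 (λ x → :- x := con (- 1ℚ) :* x) refl (ℚ.fromℚᵘ γ)))))))

    ind : Fin K → Fin K → ℝ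
    ind u s = fromℚᵘ (indicator u s)

    private
      scale-bool : ∀ b y → fromℚᵘ (natℚᵘ (if b then 1 else 0)) *ℝ y ≈ (if b then y else 0ℝ)
      scale-bool true  y = R.*-identityˡ y
      scale-bool false y = R.zeroˡ y

      ind-* : ∀ s u y → ind u s *ℝ y ≈ (if does (s Fin.≟ u) then y else 0ℝ)
      ind-* s u y = scale-bool (does (s Fin.≟ u)) y

      module _ {A : Set} {z : A} where

        -- An item state is entered from itself only, and not under its own action.
        from-state : ∀ a i (y : Fin K → A) s →
          (if does (item i Fin.≟ next s a) then y s else z)
            ≡ (if does (s Fin.≟ item i) then (if does (a Fin.≟ item i) then z else y (item i)) else z)
        from-state a i y 0F = refl
        from-state a i y 1F = refl
        from-state a i y (suc (suc j)) with j Fin.≟ i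
        from-state a i y (suc (suc j)) | yes refl with does (a Fin.≟ item i)
        ... | true  = refl
        ... | false rewrite dec-true (i Fin.≟ i) refl = refl
        from-state a i y (suc (suc j)) | no j≢i with does (a Fin.≟ item j)
        ... | true  = refl
        ... | false rewrite dec-false (i Fin.≟ j) (j≢i ∘ ≡.sym) = refl

        to-lin : ∀ a (y : Fin K → A) s →
          (if does (1F Fin.≟ next s a) then y s else z) ≡ (if does (s Fin.≟ 1F) then y 1F else z)
        to-lin a y 0F = refl
        to-lin a y 1F = refl
        to-lin a y (suc (suc j)) with does (a Fin.≟ item j)
        ... | true  = refl
        ... | false = refl

        to-sink : ∀ a j (y : A) →
          (if does (0F Fin.≟ next (item j) a) then y else z) ≡ (if does (a Fin.≟ item j) then y else z)
        to-sink a j y with does (a Fin.≟ item j)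
        ... | true  = refl
        ... | false = refl

        symmetric : ∀ (y : Fin m → A) i j →
          (if does (i Fin.≟ j) then y j else z) ≡ (if does (j Fin.≟ i) then y i else z)
        symmetric y i j with j Fin.≟ i
        ... | yes refl rewrite dec-true (i Fin.≟ i) refl = refl
        ... | no j≢i rewrite dec-false (i Fin.≟ j) (j≢i ∘ ≡.sym) = refl

    module _ (π x : Vector ℝ K) where

      arriving : Fin K → Fin K → ℝ
      arriving a s̄ = sumℝ (λ s → ind (next s a) s̄ *ℝ x s)

      inflow : Fin K → ℝ
      inflow s̄ = sumℝ (λ a → π a *ℝ arriving a s̄)

      captured : ℝ
      captured = sumℝ (λ j → π (item j) *ℝ x (item j))

      -- The only mass that changes state goes from the items, each under its own action, to state
      -- 0.
      leaving entering : Fin K → ℝ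
      leaving (suc (suc j)) = π (item j) *ℝ x (item j)
      leaving _             = 0ℝ
      entering 0F      = captured
      entering (suc _) = 0ℝ

      private
        arriving-item : ∀ a i → arriving a (item i) ≈ (if does (a Fin.≟ item i) then 0ℝ else x (item i))
        arriving-item a i = sum-point (item i) (λ s → R.trans (ind-* (item i) (next s a) (x s)) (R.reflexive (from-state a i x s)))

        arriving-lin : ∀ a → arriving a 1F ≈ x 1F
        arriving-lin a = sum-point 1F (λ s → R.trans (ind-* 1F (next s a) (x s)) (R.reflexive (to-lin a x s)))

        captures : Fin K → ℝ
        captures a = sumℝ (λ j → if does (a Fin.≟ item j) then x (item j) else 0ℝ)

        captures-item : ∀ i → captures (item i) ≈ x (item i)
        captures-item i = sum-point i (λ j → R.reflexive (symmetric (x ∘ item) i j))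

        arriving-sink : ∀ a → arriving a 0F ≈ x 0F +ℝ captures a
        arriving-sink a = R.+-cong (R.*-identityˡ (x 0F))
          (R.trans (R.+-cong (R.zeroˡ (x 1F)) (sum-cong case)) (R.+-identityˡ (captures a)))
          where
          case : ∀ j → ind (next (item j) a) 0F *ℝ x (item j) ≈ (if does (a Fin.≟ item j) then x (item j) else 0ℝ)
          case j = R.trans (ind-* 0F (next (item j) a) (x (item j))) (R.reflexive (to-sink a j (x (item j))))

      module _ (∑π≈1 : sumℝ π ≈ 1ℝ) where

        private
          average : ∀ y → sumℝ (λ a → π a *ℝ y) ≈ y
          average y = R.trans (sum-*ʳ y π) (R.trans (R.*-congʳ ∑π≈1) (R.*-identityˡ y))

        -- Conservation of mass. As the probabilities sum to 1, all of `x s` would return to `s` but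
        -- for what leaves and enters.
        inflow-balance : ∀ s → inflow s +ℝ leaving s ≈ x s +ℝ entering s
        inflow-balance 0F = R.trans (R.+-identityʳ _) (begin
          inflow 0F
            ≈⟨ sum-cong (λ a → R.trans (R.*-congˡ {π a} (arriving-sink a)) (R.distribˡ (π a) (x 0F) (captures a))) ⟩
          sumℝ (λ a → π a *ℝ x 0F +ℝ π a *ℝ captures a)
            ≈⟨ sum-+ (λ a → π a *ℝ x 0F) (λ a → π a *ℝ captures a) ⟩
          sumℝ (λ a → π a *ℝ x 0F) +ℝ sumℝ (λ a → π a *ℝ captures a)
            ≈⟨ R.+-cong (average (x 0F)) (R.+-cong (no-capture 0F (sum-zero {m} {λ _ → 0ℝ} (λ _ → R.refl {0ℝ})))
                 (R.+-cong (no-capture 1F (sum-zero {m} {λ _ → 0ℝ} (λ _ → R.refl {0ℝ}))) (sum-cong {f = λ i → π (item i) *ℝ captures (item i)} (λ i → R.*-congˡ {π (item i)} (captures-item i))))) ⟩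
          x 0F +ℝ (0ℝ +ℝ (0ℝ +ℝ captured))
            ≈⟨ R.+-congˡ (R.trans (R.+-identityˡ _) (R.+-identityˡ _)) ⟩
          x 0F +ℝ captured ∎)
          where
          no-capture : ∀ a → captures a ≈ 0ℝ → π a *ℝ captures a ≈ 0ℝ
          no-capture a h = R.trans (R.*-congˡ h) (R.zeroʳ (π a))
        inflow-balance 1F = R.+-congʳ (R.trans (sum-cong (λ a → R.*-congˡ {π a} (arriving-lin a))) (average (x 1F)))
        inflow-balance (suc (suc i)) = begin
          inflow (item i) +ℝ y
            ≈⟨ R.+-congˡ (R.sym (sum-point (item i) {y} {λ a → if does (a Fin.≟ item i) then y else 0ℝ} (λ a → R.refl {if does (a Fin.≟ item i) then y else 0ℝ}))) ⟩
          inflow (item i) +ℝ sumℝ (λ a → if does (a Fin.≟ item i) then y else 0ℝ)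
            ≈⟨ R.sym (sum-+ (λ a → π a *ℝ arriving a (item i)) (λ a → if does (a Fin.≟ item i) then y else 0ℝ)) ⟩
          sumℝ (λ a → π a *ℝ arriving a (item i) +ℝ (if does (a Fin.≟ item i) then y else 0ℝ))
            ≈⟨ sum-cong case ⟩
          sumℝ (λ a → π a *ℝ x (item i))
            ≈⟨ average (x (item i)) ⟩
          x (item i)
            ≈⟨ R.sym (R.+-identityʳ (x (item i))) ⟩
          x (item i) +ℝ 0ℝ ∎
          where
          y : ℝ
          y = π (item i) *ℝ x (item i)
          case : ∀ a → π a *ℝ arriving a (item i) +ℝ (if does (a Fin.≟ item i) then y else 0ℝ) ≈ π a *ℝ x (item i)
          case a = R.trans (R.+-congʳ (R.*-congˡ (arriving-item a i))) (split a (a Fin.≟ item i))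
            where
            split : ∀ a (d : Dec (a ≡ item i)) →
              π a *ℝ (if does d then 0ℝ else x (item i)) +ℝ (if does d then y else 0ℝ) ≈ π a *ℝ x (item i)
            split a (yes refl) = R.trans (R.+-congʳ (R.zeroʳ (π a))) (R.+-identityˡ y)
            split a (no _)     = R.+-identityʳ _

        -- `Balanced` is `Occupancy` multiplied by 1 + T, with the inflow eliminated by
        -- `inflow-balance`. At an item it says x (1 + T π) = κ, that is x = κ / Y without a
        -- division.
        Occupancy Balanced : Fin K → Set
        Occupancy s = x s ≈ fromℚᵘ ((1ℚᵘ ℚᵘ.- γ) ℚᵘ.* μ) +ℝ fromℚᵘ γ *ℝ inflow s
        Balanced  s = x s +ℝ T *ℝ leaving s ≈ κ +ℝ T *ℝ entering s

        private
          scaled : ∀ S → D *ℝ (fromℚᵘ ((1ℚᵘ ℚᵘ.- γ) ℚᵘ.* μ) +ℝ fromℚᵘ γ *ℝ S) ≈ κ +ℝ T *ℝ S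
          scaled S = combine₂ 1ℝ S μD≈κ γD≈T (λ n → solve 6 (λ D c γ S k T →
            con 1ℚ :* (c :* D :- k) :+ S :* (γ :* D :- T) := D :* (c :+ γ :* S) :- (k :+ T :* S)) refl
            (seq D n) (seq (fromℚᵘ ((1ℚᵘ ℚᵘ.- γ) ℚᵘ.* μ)) n) (seq (fromℚᵘ γ) n) (seq S n) (seq κ n) (seq T n))

        occupancy⇒balanced : ∀ s → Occupancy s → Balanced s
        occupancy⇒balanced s h =
          combine₃ 1ℝ T (-ℝ x s) (R.trans (R.*-congˡ {D} h) (scaled (inflow s))) (inflow-balance s) D≈1+T
            (λ n → solve 7 (λ x D k T S l e →
              con 1ℚ :* (D :* x :- (k :+ T :* S)) :+ T :* ((S :+ l) :- (x :+ e)) :+ con (- 1ℚ) :* x :* (D :- (con 1ℚ :+ T))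
                := (x :+ T :* l) :- (k :+ T :* e)) refl
              (seq (x s) n) (seq D n) (seq κ n) (seq T n) (seq (inflow s) n) (seq (leaving s) n) (seq (entering s) n))

        balanced⇒occupancy : ∀ s → Balanced s → Occupancy s
        balanced⇒occupancy s h = cancel (R.trans Dx≈ (R.sym (scaled (inflow s))))
          where
          Dx≈ : D *ℝ x s ≈ κ +ℝ T *ℝ inflow s
          Dx≈ = combine₃ 1ℝ (-ℝ T) (x s) h (inflow-balance s) D≈1+T
            (λ n → solve 7 (λ x D k T S l e →
              con 1ℚ :* ((x :+ T :* l) :- (k :+ T :* e)) :+ con (- 1ℚ) :* T :* ((S :+ l) :- (x :+ e)) :+ x :* (D :- (con 1ℚ :+ T))
                := D :* x :- (k :+ T :* S)) refl
              (seq (x s) n) (seq D n) (seq κ n) (seq T n) (seq (inflow s) n) (seq (leaving s) n) (seq (entering s) n))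
          cancel : ∀ {y z} → D *ℝ y ≈ D *ℝ z → y ≈ z
          cancel {y} {z} h = combine₂ (reciprocal t) (z +ℝ -ℝ y) h (reciprocal-inverse t)
            (λ n → solve 4 (λ r D y z → r :* (D :* y :- D :* z) :+ (z :+ con (- 1ℚ) :* y) :* (r :* D :- con 1ℚ) := y :- z)
              refl (seq (reciprocal t) n) (seq D n) (seq y n) (seq z n))

        -- The three places where an item causes cost: through the mass it sends to state 0, through
        -- its action in state 1, and in its own state.
        itemTerm : Fin m → ℝ
        itemTerm j = T *ℝ (π (item j) *ℝ x (item j)) +ℝ (κ *ℝ (T *ℝ π (item j)) +ℝ x (item j) *ℝ natℝ (itemCost (w j)))

        costℝ : ℝ
        costℝ = sumℝ (λ s → sumℝ (λ a → x s *ℝ π a *ℝ natℝ (stepCost s a)))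

        private
          constant-row : ∀ y c → sumℝ (λ a → y *ℝ π a *ℝ c) ≈ y *ℝ c
          constant-row y c = begin
            sumℝ (λ a → y *ℝ π a *ℝ c)   ≈⟨ sum-*ʳ c (λ a → y *ℝ π a) ⟩
            sumℝ (λ a → y *ℝ π a) *ℝ c   ≈⟨ R.*-congʳ (R.trans (sum-*ˡ y π) (R.trans (R.*-congˡ ∑π≈1) (R.*-identityʳ y))) ⟩
            y *ℝ c                       ∎

          Π : ℝ
          Π = sumℝ (λ j → π (item j))

          linear-row : sumℝ (λ a → x 1F *ℝ π a *ℝ natℝ (stepCost 1F a)) ≈ x 1F +ℝ x 1F *ℝ (T *ℝ Π)
          linear-row = begin
            x 1F *ℝ π 0F *ℝ 1ℝ +ℝ (x 1F *ℝ π 1F *ℝ 1ℝ +ℝ sumℝ (λ j → x 1F *ℝ π (item j) *ℝ D))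
              ≈⟨ R.+-congˡ (R.+-congˡ (R.trans (sum-*ʳ D (λ j → x 1F *ℝ π (item j))) (R.*-congʳ (sum-*ˡ (x 1F) (π ∘ item))))) ⟩
            x 1F *ℝ π 0F *ℝ 1ℝ +ℝ (x 1F *ℝ π 1F *ℝ 1ℝ +ℝ x 1F *ℝ Π *ℝ D)
              ≈⟨ combine₂ (x 1F) (x 1F *ℝ Π) ∑π≈1 D≈1+T (λ n → solve 6 (λ y a b P D T →
                   y :* ((a :+ (b :+ P)) :- con 1ℚ) :+ y :* P :* (D :- (con 1ℚ :+ T))
                     := (y :* a :* con 1ℚ :+ (y :* b :* con 1ℚ :+ y :* P :* D)) :- (y :+ y :* (T :* P))) refl
                   (seq (x 1F) n) (seq (π 0F) n) (seq (π 1F) n) (seq Π n) (seq D n) (seq T n)) ⟩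
            x 1F +ℝ x 1F *ℝ (T *ℝ Π) ∎

        -- By balance, states 0 and 1 have occupancies κ + T · `captured` and κ. Both κ split off,
        -- and all else sorts by items.
        cost-decomposition : (∀ s → Balanced s) → costℝ ≈ (κ +ℝ κ) +ℝ sumℝ itemTerm
        cost-decomposition h = begin
          costℝ
            ≈⟨ R.+-cong (R.trans (constant-row (x 0F) 1ℝ) (R.*-identityʳ (x 0F)))
                 (R.+-cong linear-row (sum-cong (λ j → constant-row (x (item j)) (natℝ (itemCost (w j)))))) ⟩
          x 0F +ℝ (x 1F +ℝ x 1F *ℝ (T *ℝ Π) +ℝ costs)
            ≈⟨ combine₂ 1ℝ (1ℝ +ℝ T *ℝ Π) (h 0F) (h 1F) (λ n → solve 7 (λ x₀ x₁ T k E P c →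
                 con 1ℚ :* ((x₀ :+ T :* con 0ℚ) :- (k :+ T :* E)) :+ (con 1ℚ :+ T :* P) :* ((x₁ :+ T :* con 0ℚ) :- (k :+ T :* con 0ℚ))
                   := (x₀ :+ (x₁ :+ x₁ :* (T :* P) :+ c)) :- ((k :+ k) :+ (T :* E :+ (k :* (T :* P) :+ c)))) refl
                 (seq (x 0F) n) (seq (x 1F) n) (seq T n) (seq κ n) (seq captured n) (seq Π n) (seq costs n)) ⟩
          (κ +ℝ κ) +ℝ (T *ℝ captured +ℝ (κ *ℝ (T *ℝ Π) +ℝ costs))
            ≈⟨ R.+-congˡ (R.+-cong (R.sym (sum-*ˡ T (λ j → π (item j) *ℝ x (item j)))) (R.+-congʳ (R.trans (R.*-congˡ (R.sym (sum-*ˡ T (π ∘ item))))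
                 (R.sym (sum-*ˡ κ (λ j → T *ℝ π (item j))))))) ⟩
          (κ +ℝ κ) +ℝ (sumℝ (λ j → T *ℝ (π (item j) *ℝ x (item j))) +ℝ (sumℝ (λ j → κ *ℝ (T *ℝ π (item j))) +ℝ costs))
            ≈⟨ R.+-congˡ (R.sym (R.trans (sum-+ f (λ j → h′ j +ℝ h″ j)) (R.+-congˡ (sum-+ h′ h″)))) ⟩
          (κ +ℝ κ) +ℝ sumℝ itemTerm ∎
          where
          f h′ h″ : Vector ℝ m
          f j  = T *ℝ (π (item j) *ℝ x (item j))
          h′ j = κ *ℝ (T *ℝ π (item j))
          h″ j = x (item j) *ℝ natℝ (itemCost (w j))
          costs : ℝ
          costs = sumℝ (λ j → x (item j) *ℝ natℝ (itemCost (w j)))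

  √-nonneg : ∀ c → 0ℝ ≼ √ c
  √-nonneg c = wrap≤ (proj₁ (√-isSqrt c))

  √-square : ∀ c → √ c *ℝ √ c ≈ natℝ c
  √-square c = wrap (proj₂ (√-isSqrt c))

  -- Any witness s has the same square as `√ c`; this transfers a sum bound from arbitrary roots to
  -- the constructed ones.
  √-least : ∀ {s c} → IsSqrt s c → √ c ≼ s
  √-least {s} {c} (0≤s , s²≃c) = square-cancel-≼ (wrap≤ 0≤s)
    (≈⇒≼ (R.trans (√-square c) (R.sym {s *ℝ s} (wrap s²≃c))))

  1≼√ : ∀ c → 1ℝ ≼ √ (suc c)
  1≼√ c = square-cancel-≼ (√-nonneg (suc c))
    (≼-trans (≈⇒≼ (R.*-identityˡ 1ℝ)) (≼-trans (natℝ-mono {1} {suc c} (s≤s z≤n)) (≈⇒≼ (R.sym {√ (suc c) *ℝ √ (suc c)} {natℝ (suc c)} (√-square (suc c))))))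

  itemCost-suc : ∀ c → let G = natℝ (suc c) in
    natℝ (itemCost (suc c)) ≈ 1ℝ +ℝ ((G +ℝ G) +ℝ (G +ℝ G))
  itemCost-suc c = R.trans (natℝ-+ 1 (suc c ℕ.* 2 ℕ.* 2)) (R.+-congˡ {1ℝ}
    (R.trans (natℝ-double (suc c ℕ.* 2)) (R.+-cong (natℝ-double (suc c)) (natℝ-double (suc c)))))

  -- For Y = 1 + T p and x Y = κ, the terms below are κ (Y + 4 G / Y) and
  -- κ (Y - 1 / Y), up to completing the square.

  module _ {x p κ T c : ℝ} (balance : x +ℝ T *ℝ (p *ℝ x) ≈ κ) where

    positive-term : ∀ {s G} → s *ℝ s ≈ G → c ≈ 1ℝ +ℝ ((G +ℝ G) +ℝ (G +ℝ G)) →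
      let e = (1ℝ +ℝ T *ℝ p) +ℝ (-ℝ (s +ℝ s)) in
      T *ℝ (p *ℝ x) +ℝ (κ *ℝ (T *ℝ p) +ℝ x *ℝ c)
        ≈ (κ *ℝ (s +ℝ s) +ℝ κ *ℝ (s +ℝ s)) +ℝ x *ℝ (e *ℝ e)
    positive-term {s} {G} s²≈G c≈ =
      -- With Y = 1 + T p and x Y = κ, the left side is κ Y + 4 x G, and for s² = G its excess over
      -- 4 κ s is x (Y - 2 s)².
      combine₃ (((s +ℝ s) +ℝ (s +ℝ s)) +ℝ (-ℝ (T *ℝ p))) (-ℝ ((x +ℝ x) +ℝ (x +ℝ x))) x balance s²≈G c≈
        (λ n → solve 7 (λ x p k T c s G →
          let e = (con 1ℚ :+ T :* p) :+ con (- 1ℚ) :* (s :+ s) in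
          (((s :+ s) :+ (s :+ s)) :+ con (- 1ℚ) :* (T :* p)) :* ((x :+ T :* (p :* x)) :- k)
            :+ con (- 1ℚ) :* ((x :+ x) :+ (x :+ x)) :* (s :* s :- G)
            :+ x :* (c :- (con 1ℚ :+ ((G :+ G) :+ (G :+ G))))
            := (T :* (p :* x) :+ (k :* (T :* p) :+ x :* c))
               :- ((k :* (s :+ s) :+ k :* (s :+ s)) :+ x :* (e :* e))) refl
          (seq x n) (seq p n) (seq κ n) (seq T n) (seq c n) (seq s n) (seq G n))

    zero-term : c ≈ 0ℝ →
      T *ℝ (p *ℝ x) +ℝ (κ *ℝ (T *ℝ p) +ℝ x *ℝ c) ≈ x *ℝ ((T *ℝ p) *ℝ ((1ℝ +ℝ 1ℝ) +ℝ T *ℝ p))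
    -- Here the left side is κ Y - x = x (Y² - 1), factored as x (Y - 1) (Y + 1).
    zero-term c≈0 = combine₂ (-ℝ (T *ℝ p)) x balance c≈0
      (λ n → solve 5 (λ x p k T c →
        con (- 1ℚ) :* (T :* p) :* ((x :+ T :* (p :* x)) :- k) :+ x :* (c :- con 0ℚ)
          := (T :* (p :* x) :+ (k :* (T :* p) :+ x :* c))
             :- x :* ((T :* p) :* ((con 1ℚ :+ con 1ℚ) :+ T :* p))) refl
        (seq x n) (seq p n) (seq κ n) (seq T n) (seq c n))

  -- The least cost and where it is attained

  module _ (m t : ℕ) (w : Fin m → ℕ) where

    open Bellman m t w

    Yes : ℤ → Set
    Yes d = DecisionProblem.Yes STOCHASTIC-BLIND-POLICY (record { mdp = Blind.blindMDP m t w ; r = threshold m d })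

    -- 4 κ s, the least contribution of an item whose number has root s.
    four : ℝ → ℝ
    four s = κ *ℝ (s +ℝ s) +ℝ κ *ℝ (s +ℝ s)

    Σ√ : ℝ
    Σ√ = sumℝ (λ j → √ (w j))

    κ-nonneg : 0ℝ ≼ κ
    κ-nonneg = reciprocal-nonneg (suc m)

    T-nonneg : 0ℝ ≼ T
    T-nonneg = natℝ-nonneg t

    four-0 : ∀ {s} → s ≈ 0ℝ → four s ≈ 0ℝ
    four-0 {s} h = combine₁ ((κ +ℝ κ) +ℝ (κ +ℝ κ)) h (λ n → solve 2 (λ k s →
      ((k :+ k) :+ (k :+ k)) :* (s :- con 0ℚ) := (k :* (s :+ s) :+ k :* (s :+ s)) :- con 0ℚ) refl (seq κ n) (seq s n))

    four-nonneg : ∀ {s} → 0ℝ ≼ s → 0ℝ ≼ four s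
    four-nonneg h = +-nonneg half half
      where half = *-nonneg-≼ κ-nonneg (+-nonneg h h)

    sum-four : sumℝ (λ j → four (√ (w j))) ≈ four Σ√
    sum-four = R.trans (sum-+ f f) (R.+-cong half half)
      where
      f : Vector ℝ m
      f j = κ *ℝ (√ (w j) +ℝ √ (w j))
      half : sumℝ f ≈ κ *ℝ (Σ√ +ℝ Σ√)
      half = R.trans (sum-*ˡ κ (λ j → √ (w j) +ℝ √ (w j))) (R.*-congˡ {κ} (sum-+ (λ j → √ (w j)) (λ j → √ (w j))))

    threshold-+ : ∀ d → fromℚᵘ (threshold m (ℤ.+ d)) ≈ (κ +ℝ κ) +ℝ four (natℝ d)
    threshold-+ d = begin
      fromℚᵘ (threshold m (ℤ.+ d))
        ≈⟨ R.sym (reciprocal-* (suc m) ((1 ℕ.+ d ℕ.* 2) ℕ.* 2)) ⟩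
      κ *ℝ natℝ ((1 ℕ.+ d ℕ.* 2) ℕ.* 2)
        ≈⟨ R.*-congˡ {κ} (R.trans (natℝ-double (1 ℕ.+ d ℕ.* 2)) (R.+-cong half half)) ⟩
      κ *ℝ ((1ℝ +ℝ (natℝ d +ℝ natℝ d)) +ℝ (1ℝ +ℝ (natℝ d +ℝ natℝ d)))
        ≈⟨ pointwise (λ n → solve 2 (λ k d → k :* ((con 1ℚ :+ (d :+ d)) :+ (con 1ℚ :+ (d :+ d)))
             := (k :+ k) :+ (k :* (d :+ d) :+ k :* (d :+ d))) refl (seq κ n) (seq (natℝ d) n)) ⟩
      (κ +ℝ κ) +ℝ four (natℝ d) ∎
      where
      half : natℝ (1 ℕ.+ d ℕ.* 2) ≈ 1ℝ +ℝ (natℝ d +ℝ natℝ d)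
      half = R.trans (natℝ-+ 1 (d ℕ.* 2)) (R.+-congˡ {1ℝ} (natℝ-double d))

    threshold-negative : ∀ d → 0ℝ ≼ fromℚᵘ (threshold m -[1+ d ]) → ⊥
    threshold-negative d = constant-≰ {0ℚᵘ} {threshold m -[1+ d ]} (ℚᵘ.negative⁻¹ (mkℚᵘ -[1+ 0 ] (suc m)))

    four-cancel : ∀ {a b} → (κ +ℝ κ) +ℝ four a ≼ (κ +ℝ κ) +ℝ four b → a ≼ b
    four-cancel {a} {b} h = ≼-trans (≈⇒≼ (R.sym (unit a)))
      (≼-trans (≼-scale q (*-nonneg-≼ (reciprocal-nonneg 3) (natℝ-nonneg K)) h (λ n →
          solve 4 (λ q k a b → q :* (((k :+ k) :+ (k :* (b :+ b) :+ k :* (b :+ b))) :- ((k :+ k) :+ (k :* (a :+ a) :+ k :* (a :+ a))))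
            := q :* ((k :+ k) :+ (k :+ k)) :* b :- q :* ((k :+ k) :+ (k :+ k)) :* a) refl
            (seq q n) (seq κ n) (seq a n) (seq b n)))
        (≈⇒≼ (unit b)))
      where
      K : ℕ
      K = suc (suc m)
      q : ℝ
      -- K / 4, the inverse of 4 κ.
      q = reciprocal 3 *ℝ natℝ K
      unit : ∀ y → q *ℝ ((κ +ℝ κ) +ℝ (κ +ℝ κ)) *ℝ y ≈ y
      unit y = combine₁ y (reciprocal-inverse (suc m)) (λ n → solve 3 (λ k K y →
        y :* (k :* K :- con 1ℚ) := con (ℚ.fromℚᵘ (mkℚᵘ (ℤ.+ 1) 3)) :* K :* ((k :+ k) :+ (k :+ k)) :* y :- y) refl
        (seq κ n) (seq (natℝ K) n) (seq y n))

    module _ (π x : Vector ℝ (Blind.states m t w)) (π≥0 : ∀ a → 0ℝ ≼ π a) (∑π≈1 : sumℝ π ≈ 1ℝ)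
             (x≥0 : ∀ s → 0ℝ ≼ x s) (balanced : ∀ s → Balanced π x ∑π≈1 s) where

      item-balance : ∀ j → x (item j) +ℝ T *ℝ (π (item j) *ℝ x (item j)) ≈ κ
      item-balance j = R.trans (balanced (item j)) (R.trans (R.+-congˡ {κ} (R.zeroʳ T)) (R.+-identityʳ κ))

      zero-lower : ∀ j → four (√ 0) ≼
        T *ℝ (π (item j) *ℝ x (item j)) +ℝ (κ *ℝ (T *ℝ π (item j)) +ℝ x (item j) *ℝ natℝ 0)
      zero-lower j = ≼-trans (≈⇒≼ (four-0 {√ 0} √0≈0)) (≼-trans nonneg-bound (≈⇒≼ (R.sym term≈bound)))
        where
        p bound : ℝ
        p = π (item j)
        bound = x (item j) *ℝ ((T *ℝ p) *ℝ ((1ℝ +ℝ 1ℝ) +ℝ T *ℝ p))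
        Tp≥0 : 0ℝ ≼ T *ℝ p
        Tp≥0 = *-nonneg-≼ {T} {p} T-nonneg (π≥0 (item j))
        nonneg-bound : 0ℝ ≼ bound
        nonneg-bound = *-nonneg-≼ {x (item j)} {(T *ℝ p) *ℝ ((1ℝ +ℝ 1ℝ) +ℝ T *ℝ p)} (x≥0 (item j))
          (*-nonneg-≼ {T *ℝ p} {(1ℝ +ℝ 1ℝ) +ℝ T *ℝ p} Tp≥0 (+-nonneg {1ℝ +ℝ 1ℝ} {T *ℝ p} (+-nonneg {1ℝ} {1ℝ} (natℝ-nonneg 1) (natℝ-nonneg 1)) Tp≥0))
        term≈bound : T *ℝ (p *ℝ x (item j)) +ℝ (κ *ℝ (T *ℝ p) +ℝ x (item j) *ℝ natℝ 0) ≈ bound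
        term≈bound = zero-term {x (item j)} {p} {κ} {T} {natℝ 0} (item-balance j) (R.refl {0ℝ})
      positive-lower : ∀ j c → four (√ (suc c)) ≼
        T *ℝ (π (item j) *ℝ x (item j)) +ℝ (κ *ℝ (T *ℝ π (item j)) +ℝ x (item j) *ℝ natℝ (itemCost (suc c)))
      positive-lower j c =
        ≼-by (x (item j) *ℝ (e *ℝ e)) (*-nonneg-≼ (x≥0 (item j)) (square-nonneg-≼ e))
          (positive-term {x (item j)} {π (item j)} {κ} {T} {natℝ (itemCost (suc c))} (item-balance j)
            {√ (suc c)} {natℝ (suc c)} (√-square (suc c)) (itemCost-suc c))
        where
        e : ℝ
        e = (1ℝ +ℝ T *ℝ π (item j)) +ℝ (-ℝ (√ (suc c) +ℝ √ (suc c)))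

      item-lower : ∀ j g → four (√ g) ≼
        T *ℝ (π (item j) *ℝ x (item j)) +ℝ (κ *ℝ (T *ℝ π (item j)) +ℝ x (item j) *ℝ natℝ (itemCost g))
      item-lower j zero    = zero-lower j
      item-lower j (suc c) = positive-lower j c

      cost-lower : (κ +ℝ κ) +ℝ four Σ√ ≼ costℝ π x ∑π≈1
      cost-lower = ≼-trans (+-mono-≼ (≈⇒≼ (R.refl {κ +ℝ κ})) (≼-trans (≈⇒≼ (R.sym sum-four)) (sum-mono {f = λ j → four (√ (w j))} {itemTerm π x ∑π≈1} (λ j → item-lower j (w j)))))
        (≈⇒≼ (R.sym (cost-decomposition π x ∑π≈1 balanced)))

    sound : ∀ d → Yes d → Σ√ ≼ fromℤ d
    sound d (π , (π≥0 , ∑π) , x , (x≥0 , occ) , cost≤) = conclude d bound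
      where
      ∑π≈1 : sumℝ π ≈ 1ℝ
      ∑π≈1 = wrap ∑π
      bound : (κ +ℝ κ) +ℝ four Σ√ ≼ fromℚᵘ (threshold m d)
      bound = ≼-trans
        (cost-lower π x (λ a → wrap≤ (π≥0 a)) ∑π≈1 (λ s → wrap≤ (x≥0 s))
          (λ s → occupancy⇒balanced π x ∑π≈1 s (wrap (occ s))))
        (wrap≤ cost≤)
      conclude : ∀ d → (κ +ℝ κ) +ℝ four Σ√ ≼ fromℚᵘ (threshold m d) → Σ√ ≼ fromℤ d
      conclude (ℤ.+ d) h = four-cancel (≼-trans h (≈⇒≼ (threshold-+ d)))
      conclude -[1+ d ] h = ⊥-elim (threshold-negative d (≼-trans
        (+-nonneg (+-nonneg κ-nonneg κ-nonneg) (four-nonneg (sum-nonneg (λ j → √-nonneg (w j))))) h))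

    -- Conversely, Y = 2 √ c is optimal.

    module _ (τ : ℝ) (τ≥0 : 0ℝ ≼ τ) (τT≈1 : τ *ℝ T ≈ 1ℝ) (∑w≤T : sumℝ (λ j → natℝ (w j)) ≼ T) where

      -- Y - 1 at the optimum, that is T times the probability of the action. For 0 the best
      -- admissible value is Y = 1.
      excess : ℕ → ℝ
      excess zero    = 0ℝ
      excess (suc c) = (√ (suc c) +ℝ √ (suc c)) +ℝ (-ℝ 1ℝ)

      -- κ / (2 √c), with the inverse root written as √c / c so that only a natural number is
      -- inverted.
      occupancy : ℕ → ℝ
      occupancy zero    = κ
      occupancy (suc c) = κ *ℝ (√ (suc c) *ℝ reciprocal (suc (c ℕ.* 2)))

      excess-nonneg : ∀ c → 0ℝ ≼ excess c
      excess-nonneg zero    = ≈⇒≼ R.refl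
      excess-nonneg (suc c) = difference-nonneg
        (≼-trans (≈⇒≼ (R.sym (R.+-identityʳ 1ℝ))) (+-mono-≼ (1≼√ c) (√-nonneg (suc c))))

      -- For positive c the difference is (√c - 1)². Together with `∑w≤T` this keeps the sum of the
      -- item probabilities at most 1.
      excess-bound : ∀ c → excess c ≼ natℝ c
      excess-bound zero    = ≈⇒≼ R.refl
      excess-bound (suc c) = ≼-by (e *ℝ e) (square-nonneg-≼ e)
        (combine₁ (-ℝ 1ℝ) (√-square (suc c)) (λ n → solve 2 (λ s G →
          con (- 1ℚ) :* con 1ℚ :* (s :* s :- G)
            := G :- (((s :+ s) :+ con (- 1ℚ) :* con 1ℚ) :+ (s :+ con (- 1ℚ) :* con 1ℚ) :* (s :+ con (- 1ℚ) :* con 1ℚ))) refl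
          (seq (√ (suc c)) n) (seq (natℝ (suc c)) n)))
        where
        e : ℝ
        e = √ (suc c) +ℝ (-ℝ 1ℝ)

      occupancy-nonneg : ∀ c → 0ℝ ≼ occupancy c
      occupancy-nonneg zero    = κ-nonneg
      occupancy-nonneg (suc c) = *-nonneg-≼ κ-nonneg (*-nonneg-≼ (√-nonneg (suc c)) (reciprocal-nonneg (suc (c ℕ.* 2))))

      occupancy-balance : ∀ c → occupancy c +ℝ T *ℝ ((τ *ℝ excess c) *ℝ occupancy c) ≈ κ
      occupancy-balance zero    = pointwise (λ n → solve 3 (λ k T τ →
        k :+ T :* ((τ :* con 0ℚ) :* k) := k) refl (seq κ n) (seq T n) (seq τ n))
      occupancy-balance (suc c) =
        combine₃ (excess (suc c) *ℝ occupancy (suc c)) (κ *ℝ (i +ℝ i)) κ τT≈1 (√-square (suc c)) inverse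
          (λ n → solve 6 (λ k T τ s i G →
            let e = (s :+ s) :+ con (- 1ℚ) :* con 1ℚ
                y = k :* (s :* i) in
            e :* y :* (τ :* T :- con 1ℚ) :+ k :* (i :+ i) :* (s :* s :- G) :+ k :* (i :* (G :+ G) :- con 1ℚ)
              := (y :+ T :* ((τ :* e) :* y)) :- k) refl
            (seq κ n) (seq T n) (seq τ n) (seq (√ (suc c)) n) (seq i n) (seq (natℝ (suc c)) n))
        where
        i : ℝ
        i = reciprocal (suc (c ℕ.* 2))
        inverse : i *ℝ (natℝ (suc c) +ℝ natℝ (suc c)) ≈ 1ℝ
        inverse = R.trans (R.*-congˡ {i} (R.sym (natℝ-double (suc c)))) (reciprocal-inverse (suc (c ℕ.* 2)))

      optimal-term : ∀ c → let p = τ *ℝ excess c ; y = occupancy c in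
        T *ℝ (p *ℝ y) +ℝ (κ *ℝ (T *ℝ p) +ℝ y *ℝ natℝ (itemCost c)) ≈ four (√ c)
      optimal-term zero    = R.trans (zero-term (occupancy-balance 0) (R.refl {0ℝ}))
        (R.trans (pointwise (λ n → solve 3 (λ k T τ →
            k :* ((T :* (τ :* con 0ℚ)) :* ((con 1ℚ :+ con 1ℚ) :+ T :* (τ :* con 0ℚ))) := con 0ℚ) refl
            (seq κ n) (seq T n) (seq τ n)))
          (R.sym (four-0 {√ 0} √0≈0)))
      optimal-term (suc c) = R.trans (positive-term (occupancy-balance (suc c)) (√-square (suc c)) (itemCost-suc c))
        (combine₁ (y *ℝ e) e≈0 (λ n → solve 3 (λ f y e → y :* e :* (e :- con 0ℚ) := (f :+ y :* (e :* e)) :- f) refl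
          (seq (four s) n) (seq y n) (seq e n)))
        where
        s y e : ℝ
        s = √ (suc c)
        y = occupancy (suc c)
        e = (1ℝ +ℝ T *ℝ (τ *ℝ excess (suc c))) +ℝ (-ℝ (s +ℝ s))
        e≈0 : e ≈ 0ℝ
        e≈0 = combine₁ (excess (suc c)) τT≈1 (λ n → solve 3 (λ τ T s →
          let x = (s :+ s) :+ con (- 1ℚ) :* con 1ℚ in
          x :* (τ :* T :- con 1ℚ) := ((con 1ℚ :+ T :* (τ :* x)) :+ con (- 1ℚ) :* (s :+ s)) :- con 0ℚ) refl
          (seq τ n) (seq T n) (seq s n))

      -- The remaining probability goes to action 0, which moves no state and costs nothing extra.
      policy : Vector ℝ (Blind.states m t w)
      policy (suc (suc j)) = τ *ℝ excess (w j)
      policy 1F            = 0ℝ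
      policy 0F            = 1ℝ +ℝ (-ℝ sumℝ (λ j → τ *ℝ excess (w j)))

      state : Vector ℝ (Blind.states m t w)
      state (suc (suc j)) = occupancy (w j)
      state 1F            = κ
      state 0F            = κ +ℝ T *ℝ sumℝ (λ j → τ *ℝ excess (w j) *ℝ occupancy (w j))

      share-nonneg : ∀ j → 0ℝ ≼ τ *ℝ excess (w j)
      share-nonneg j = *-nonneg-≼ τ≥0 (excess-nonneg (w j))

      policy-nonneg : ∀ a → 0ℝ ≼ policy a
      policy-nonneg (suc (suc j)) = share-nonneg j
      policy-nonneg 1F            = ≈⇒≼ R.refl
      policy-nonneg 0F            = difference-nonneg (≼-trans (≈⇒≼ (sum-*ˡ τ (λ j → excess (w j))))
        (≼-trans (*-monoˡ-≼ τ τ≥0 (≼-trans (sum-mono (λ j → excess-bound (w j))) ∑w≤T)) (≈⇒≼ τT≈1)))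

      policy-sum : sumℝ policy ≈ 1ℝ
      policy-sum = pointwise (λ n → solve 1 (λ S →
        (con 1ℚ :+ con (- 1ℚ) :* S) :+ (con 0ℚ :+ S) := con 1ℚ) refl (seq (sumℝ (λ j → τ *ℝ excess (w j))) n))

      state-nonneg : ∀ s → 0ℝ ≼ state s
      state-nonneg (suc (suc j)) = occupancy-nonneg (w j)
      state-nonneg 1F            = κ-nonneg
      state-nonneg 0F            = +-nonneg κ-nonneg (*-nonneg-≼ T-nonneg
        (sum-nonneg (λ j → *-nonneg-≼ (share-nonneg j) (occupancy-nonneg (w j)))))

      state-balanced : ∀ s → Balanced policy state policy-sum s
      state-balanced 0F = R.trans (R.+-congˡ {state 0F} (R.zeroʳ T)) (R.+-identityʳ (state 0F))
      state-balanced 1F = R.refl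
      state-balanced (suc (suc j)) = R.trans (occupancy-balance (w j))
        (R.sym (R.trans (R.+-congˡ {κ} (R.zeroʳ T)) (R.+-identityʳ κ)))

      optimal-cost : costℝ policy state policy-sum ≈ (κ +ℝ κ) +ℝ four Σ√
      optimal-cost = R.trans (cost-decomposition policy state policy-sum state-balanced)
        (R.+-congˡ {κ +ℝ κ} (R.trans (sum-cong (λ j → optimal-term (w j))) sum-four))

      complete : ∀ d → Σ√ ≼ fromℤ d → Yes d
      complete d h = policy , ((λ a → unwrap≤ (policy-nonneg a)) , unwrap policy-sum) , state ,
        ((λ s → unwrap≤ (state-nonneg s)) ,
         (λ s → unwrap (balanced⇒occupancy policy state policy-sum s (state-balanced s)))) ,
        unwrap≤ (≼-trans (≈⇒≼ optimal-cost) (conclude d h))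
        where
        conclude : ∀ d → Σ√ ≼ fromℤ d → (κ +ℝ κ) +ℝ four Σ√ ≼ fromℚᵘ (threshold m d)
        conclude (ℤ.+ d) h = ≼-trans (≼-scale ((κ +ℝ κ) +ℝ (κ +ℝ κ)) (+-nonneg 2κ 2κ) h (λ n →
            solve 3 (λ k a b → ((k :+ k) :+ (k :+ k)) :* (b :- a)
              := ((k :+ k) :+ (k :* (b :+ b) :+ k :* (b :+ b))) :- ((k :+ k) :+ (k :* (a :+ a) :+ k :* (a :+ a)))) refl
              (seq κ n) (seq Σ√ n) (seq (natℝ d) n)))
          (≈⇒≼ (R.sym (threshold-+ d)))
          where
          2κ : 0ℝ ≼ κ +ℝ κ
          2κ = +-nonneg κ-nonneg κ-nonneg
        conclude -[1+ d ] h = ⊥-elim (constant-≰ {0ℚᵘ} {mkℚᵘ -[1+ d ] 0} (ℚᵘ.negative⁻¹ (mkℚᵘ -[1+ d ] 0))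
          (≼-trans (sum-nonneg (λ j → √-nonneg (w j))) h))

  -- From the list of weights back to the given numbers

  sum-lookup-++ : ∀ (f : ℕ → ℝ) l l′ →
    sumℝ (λ j → f (lookup (l ++ l′) j)) ≈ sumℝ (λ j → f (lookup l j)) +ℝ sumℝ (λ j → f (lookup l′ j))
  sum-lookup-++ f []      l′ = R.sym (R.+-identityˡ _)
  sum-lookup-++ f (a ∷ l) l′ = R.trans (R.+-congˡ {f a} (sum-lookup-++ f l l′)) (R.sym (R.+-assoc (f a) _ _))

  -- All entries of a block after its first are 0, and `f` vanishes there.
  sum-weights : ∀ (f : ℕ → ℝ) → f 0 ≈ 0ℝ → ∀ {n} (c : Vector ℕ n) →
    sumℝ (λ j → f (lookup (weights c) j)) ≈ sumℝ (λ i → f (c i))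
  sum-weights f f0 {zero}  c = R.refl
  sum-weights f f0 {suc n} c = R.trans (sum-lookup-++ f (block (c zero)) (weights (c ∘ suc)))
    (R.+-cong (R.trans (R.+-congˡ {f (c zero)} (padding (length (bits (c zero))))) (R.+-identityʳ (f (c zero))))
              (sum-weights f f0 (c ∘ suc)))
    where
    padding : ∀ k → sumℝ (λ j → f (lookup (replicate k 0) j)) ≈ 0ℝ
    padding zero    = R.refl
    padding (suc k) = R.trans (R.+-cong f0 (padding k)) (R.+-identityˡ 0ℝ)

  sum-natℝ : ∀ l → sumℝ (λ j → natℝ (lookup l j)) ≈ natℝ (total l)
  sum-natℝ []      = R.refl
  sum-natℝ (a ∷ l) = R.trans (R.+-congˡ {natℝ a} (sum-natℝ l)) (R.sym (natℝ-+ a (total l)))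

  weights-bounded : ∀ {n} (c : Vector ℕ n) → sumℝ (λ j → natℝ (lookup (weights c) j)) ≼ natℝ (speed (weights c))
  weights-bounded c = ≼-trans (≈⇒≼ (sum-natℝ (weights c)))
    -- The exponent of `speed` exceeds the number of weights by 3.
    (natℝ-mono (ℕ.≤-trans (total-weights c) (ℕ.^-monoʳ-≤ 2 (ℕ.m≤n+m (length (weights c)) 3))))

  -- `reciprocal` expects a predecessor, which a power of 2 does not display; the case split on a
  -- positive number provides it.
  has-inverse : ∀ n → 0 ℕ.< n → ∃[ τ ] (0ℝ ≼ τ) × (τ *ℝ natℝ n ≈ 1ℝ)
  has-inverse (suc n) _ = reciprocal n , reciprocal-nonneg n , reciprocal-inverse n

  reduction-correct : ∀ I → DecisionProblem.Yes SQRT-SUM I ⇔ DecisionProblem.Yes STOCHASTIC-BLIND-POLICY (reduction I)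
  reduction-correct I = mk⇔
    (λ { (s , isSqrt , s≤d) →
         let τ , τ≥0 , τT≈1 = has-inverse (speed g) (ℕ.m^n>0 2 (1 ℕ.+ size g)) in
         complete m (speed g) (lookup g) τ τ≥0 τT≈1 (weights-bounded c) d
           (≼-trans (≈⇒≼ sums) (≼-trans (sum-mono (λ i → √-least {s i} (isSqrt i))) (wrap≤ s≤d))) })
    (λ yes → (λ i → √ (c i)) , (λ i → √-isSqrt (c i)) ,
             unwrap≤ (≼-trans (≈⇒≼ (R.sym sums)) (sound m (speed g) (lookup g) d yes)))
    where
    open SqrtSumInstance I
    g : List ℕ
    g = weights c
    m : ℕ
    m = length g
    sums : sumℝ (λ j → √ (lookup g j)) ≈ sumℝ (λ i → √ (c i))
    sums = sum-weights √ √0≈0 c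

open Instances using (reduction)
open Emission using (reduction-polynomialTime)
open Correctness using (reduction-correct)

theorem2 : SQRT-SUM ≤ₚ STOCHASTIC-BLIND-POLICY
theorem2 = record
  { reduce         = reduction
  ; correct        = reduction-correct
  ; polynomialTime = reduction-polynomialTime
  }
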